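{- Let $x^*$ be a feasible solution of the subtour elimination LP for the $s$-$t$ path TSP on vertex set $V$, and let $G=(V,E)$ be its support graph. If no edge of $G$ is contained in more than two narrow cuts, then $\tfrac32x^*$ is a convex combination of (incidence vectors of) $\{s,t\}$-tours of $G$.
   Context: $V$ is finite and $s,t\in V$. For $U\subseteq V$, $\delta(U)$ is the set of pairs with exactly one endpoint in $U$. The subtour elimination LP for the $s$-$t$ path TSP has constraints $x\ge0$, $\sum_{e\in\delta(\{i\})}x(e)=f(\{i\})$ for all $i\in V$, and $\sum_{e\in\delta(U)}x(e)\ge f(U)$ for all $\emptyset\ne U\subsetneq V$, where $f(U)=1$ if $|U\cap\{s,t\}|=1$ and $f(U)=2$ otherwise. $E=\{e:x^*(e)>0\}$. A narrow cut is a set $Q=\delta(U)\cap E$ ($\emptyset\ne U\subsetneq V$) with $\sum_{e\in Q}x^*(e)<2$. An $\{s,t\}$-tour is a multiset of edges of $E$ forming a connected spanning multigraph on $V$ whose set of odd-degree vertices is $\{s\}\triangle\{t\}$.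
   Formalization: The feasible solution x* is taken with rational entries instead of real ones; s ≠ t is assumed explicitly, which feasibility of the stated LP forces anyway. -}

module Defs where

open import Data.Nat as ℕ using (ℕ; _%_)
open import Data.Integer using (+_)
open import Data.Bool using (Bool; true; false; if_then_else_; _xor_)
open import Data.Fin using (Fin; _≟_)
open import Data.Fin.Properties using () renaming (_<?_ to _<ᶠ?_)
import Data.Fin as F
open import Data.List using (List; []; _∷_; map)
import Data.List
open import Data.List.Relation.Unary.All using (All)
open import Data.Product using (Σ; _×_; _,_; proj₁; proj₂; ∃)
open import Data.Rational using (ℚ; 0ℚ; 1ℚ; _+_; _*_; _/_; _<_; _≤_)
open import Data.Rational.Properties using (_<?_)
open import Data.Vec.Functional using () renaming (foldr to vfoldr)
open import Relation.Nullary.Decidable using (isYes)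
open import Relation.Binary.PropositionalEquality using (_≡_; _≢_)
open import Relation.Nullary using (¬_)

-- Vertex set V = Fin n.  A vector on the pairs of V is a function
-- x : Fin n → Fin n → ℚ of which only the entries x i j with i < j are used
-- (the unordered pair {i,j} with i < j).
-- A vertex subset U ⊆ V is a predicate Fin n → Bool.

Subset : ℕ → Set
Subset n = Fin n → Bool

ℕ→ℚ : ℕ → ℚ
ℕ→ℚ k = + k / 1

Σv : ∀ {n} → (Fin n → ℚ) → ℚ
Σv g = vfoldr _+_ 0ℚ g

Σvℕ : ∀ {n} → (Fin n → ℕ) → ℕ
Σvℕ g = vfoldr ℕ._+_ 0 g

ΣE : ∀ {n} → (Fin n → Fin n → ℚ) → ℚ
ΣE g = Σv (λ i → Σv (λ j → if isYes (i <ᶠ? j) then g i j else 0ℚ))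

ΣEℕ : ∀ {n} → (Fin n → Fin n → ℕ) → ℕ
ΣEℕ g = Σvℕ (λ i → Σvℕ (λ j → if isYes (i <ᶠ? j) then g i j else 0))

crosses : ∀ {n} → Subset n → Fin n → Fin n → Bool
crosses U i j = U i xor U j

inSupp : ∀ {n} → (Fin n → Fin n → ℚ) → Fin n → Fin n → Bool
inSupp x i j = isYes (0ℚ <? x i j)

xδ : ∀ {n} → (Fin n → Fin n → ℚ) → Subset n → ℚ
xδ x U = ΣE (λ i j → if crosses U i j then x i j else 0ℚ)

xδE : ∀ {n} → (Fin n → Fin n → ℚ) → Subset n → ℚ
xδE x U = ΣE (λ i j → if crosses U i j then (if inSupp x i j then x i j else 0ℚ) else 0ℚ)

singleton : ∀ {n} → Fin n → Subset n
singleton v w = isYes (w ≟ v)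

-- |U ∩ {s,t}| = 1   (computed on the set {s,t}, so literally also when s = t)
oneOfST : ∀ {n} → Fin n → Fin n → Subset n → Bool
oneOfST s t U = if isYes (s ≟ t) then U s else (U s xor U t)

fST : ∀ {n} → Fin n → Fin n → Subset n → ℚ
fST s t U = if oneOfST s t U then ℕ→ℚ 1 else ℕ→ℚ 2

NonEmptyProper : ∀ {n} → Subset n → Set
NonEmptyProper {n} U = (∃ λ (i : Fin n) → U i ≡ true) × (∃ λ (i : Fin n) → U i ≡ false)

record SubtourLPFeasible (n : ℕ) (s t : Fin n) (x : Fin n → Fin n → ℚ) : Set where
  field
    nonneg : ∀ (i j : Fin n) → i F.< j → 0ℚ ≤ x i j
    degree : ∀ (v : Fin n) → xδ x (singleton v) ≡ fST s t (singleton v)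
    subtour : ∀ (U : Subset n) → NonEmptyProper U → fST s t U ≤ xδ x U

NarrowCutOf : ∀ {n} → (Fin n → Fin n → ℚ) → Subset n → Set
NarrowCutOf x U = NonEmptyProper U × (xδE x U < ℕ→ℚ 2)

SameCut : ∀ {n} → (Fin n → Fin n → ℚ) → Subset n → Subset n → Set
SameCut {n} x U W = ∀ (i j : Fin n) → i F.< j → 0ℚ < x i j → crosses U i j ≡ crosses W i j

InMoreThanTwoNarrowCuts : ∀ {n} → (Fin n → Fin n → ℚ) → Fin n → Fin n → Set
InMoreThanTwoNarrowCuts {n} x i j =
  Σ (Subset n) λ U₁ → Σ (Subset n) λ U₂ → Σ (Subset n) λ U₃ →
    NarrowCutOf x U₁ × NarrowCutOf x U₂ × NarrowCutOf x U₃ ×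
    crosses U₁ i j ≡ true × crosses U₂ i j ≡ true × crosses U₃ i j ≡ true ×
    ¬ SameCut x U₁ U₂ × ¬ SameCut x U₁ U₃ × ¬ SameCut x U₂ U₃

-- Multisets of edges of E: multiplicity function m (entries m i j, i < j)
-- degree of v in the multigraph given by m
degM : ∀ {n} → (Fin n → Fin n → ℕ) → Fin n → ℕ
degM m v = ΣEℕ (λ i j → if isYes (i ≟ v) then m i j else (if isYes (j ≟ v) then m i j else 0))

data Reach {n : ℕ} (m : Fin n → Fin n → ℕ) (u : Fin n) : Fin n → Set where
  here : Reach m u u
  stepF : ∀ {v w} → Reach m u v → v F.< w → 0 ℕ.< m v w → Reach m u w
  stepB : ∀ {v w} → Reach m u v → w F.< v → 0 ℕ.< m w v → Reach m u w

record STTour (n : ℕ) (s t : Fin n) (x : Fin n → Fin n → ℚ) : Set where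
  field
    mult : Fin n → Fin n → ℕ
    inE : ∀ (i j : Fin n) → i F.< j → 0 ℕ.< mult i j → 0ℚ < x i j
    connected : ∀ (u v : Fin n) → Reach mult u v
    oddSet : ∀ (v : Fin n) →
      degM mult v % 2 ≡ (if (isYes (v ≟ s) xor isYes (v ≟ t)) then 1 else 0)

IsConvexCombOfTours : ∀ (n : ℕ) (s t : Fin n) (x : Fin n → Fin n → ℚ) →
  (Fin n → Fin n → ℚ) → Set
IsConvexCombOfTours n s t x y =
  Σ (List (ℚ × STTour n s t x)) λ L →
    All (λ p → 0ℚ ≤ proj₁ p) L ×
    Data.List.foldr (λ p acc → proj₁ p + acc) 0ℚ L ≡ 1ℚ ×
    (∀ (i j : Fin n) → i F.< j →
      Data.List.foldr (λ p acc → proj₁ p * ℕ→ℚ (STTour.mult (proj₂ p) i j) + acc) 0ℚ L ≡ y i j)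

{-# OPTIONS --safe #-}
-- Let x be feasible.  The degree and cut constraints put x into the spanning tree polytope, so x dominates
-- a convex combination Σ pₖ Sₖ of connected spanning graphs.  Narrow cuts are δ(U) for U in a chain of sets
-- containing s but not t.  Since Sₖ meets δ(U) at least once and x(δ(U)) times on average, Sₖ meets δ(U) in
-- a single edge ("lonely") with probability at least 2 - x(δ(U)).
--
-- Colour the chain alternately.  As an edge lies in at most two narrow cuts, which are then consecutive,
-- cuts of the same colour share no edge.  For each Sₖ and each colour, with weight pₖ/2, delete from Sₖ the
-- lonely edges of the narrow cuts of that colour, leaving F.  On average the deleted edges of δ(U) have
-- total mass at least 1 - x(δ(U))/2, so y = x/2 + (average of deleted edges) satisfies y(δ(X)) ≥ 1 for all
-- cuts.  By Edmonds and Johnson, y dominates a convex combination of T-joins J for every even T, in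
-- particular for the T that makes F + J have odd degree exactly at s and t.  Each deleted cut has an odd
-- number of vertices of T on either side, so J crosses it, and crosses no other deleted cut with the same
-- edge; hence F + J is connected.  The average of F + J is at most 3x/2, and the deficit is filled by
-- adding parallel copies of edges in even number.
--
-- Both polyhedral theorems are proved by moving within the polyhedron until a nontrivial constraint becomes
-- tight, and then splitting the graph along the corresponding set.  For T-joins without nontrivial tight
-- cuts, counting shows that the fractional edges form a 2-regular graph with y = 1/2, whose symmetric
-- difference with a T-join in the support is again a T-join.
module Submission where

open import Defs
open import Level using (0ℓ)
open import Function using (_∘_)
open import Algebra.Bundles using (CommutativeRing; CommutativeMonoid)
import Algebra.Properties.CommutativeSemigroup as CommutativeSemigroupProperties
import Algebra.Properties.Semiring.Sum as SemiringSum
open import Data.Bool using (Bool; true; false; if_then_else_; _xor_; _∧_; _∨_; not)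
import Data.Bool.Properties as 𝔹ₚ
open 𝔹ₚ using (not-distribˡ-xor; not-injective; not-involutive; not-¬; xor-annihilates-not; xor-assoc; xor-identityʳ; xor-same; xor-∧-commutativeRing; ¬-not; ∧-assoc; ∧-conicalʳ; ∧-conicalˡ; ∧-distribʳ-xor; ∧-distribˡ-xor; ∧-identityʳ; ∧-zeroʳ; ∨-conicalˡ; ∨-idem; ∨-zeroʳ)
open import Data.Empty using (⊥; ⊥-elim)
open import Data.Fin using (Fin; zero; suc; _≟_; punchIn; toℕ; fromℕ<; combine; remQuot; _↑ˡ_; _↑ʳ_)
import Data.Fin as F
import Data.Fin.Properties as Finₚ
import Data.Integer as ℤ
import Data.Integer.Properties as ℤₚ
open import Data.List using (List; []; _∷_; _++_; map; length; allFin; foldr)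
import Data.List.Properties as Listₚ
open import Data.List.Membership.Propositional using (_∈_; find; lose)
open import Data.List.Membership.Propositional.Properties using (∈-map⁺; ∈-map⁻; ∈-++⁺ˡ; ∈-++⁺ʳ; ∈-++⁻; ∈-allFin)
open import Data.List.Relation.Unary.All using (All; []; _∷_)
open import Data.List.Relation.Unary.Any using (here; there; any?)
open import Data.Maybe using (Maybe; just; nothing)
open import Data.Nat as ℕ using (ℕ; zero; suc)
import Data.Nat.Properties as ℕₚ
open import Data.Product using (Σ; _×_; _,_; proj₁; proj₂; ∃)
open import Data.Rational using (ℚ; 0ℚ; 1ℚ; ½; _+_; _*_; _-_; -_; _/_; _<_; _≤_; 1/_; positive; nonNegative; ≢-nonZero; toℚᵘ)
import Data.Rational.Properties as ℚₚ
open ℚₚ using (_<?_; *-assoc; *-cancelˡ-≤-pos; *-comm; *-distribˡ-+; *-identityʳ; *-identityˡ; *-inverseˡ; *-monoʳ-<-pos; *-monoˡ-≤-nonNeg; *-zeroʳ; *-zeroˡ; +-identityʳ; +-identityˡ; +-inverseʳ; +-mono-<; +-mono-≤; +-monoʳ-<; +-monoʳ-≤; +-monoˡ-<; +-monoˡ-≤; <-irrefl; <-trans; <-≤-trans; <⇒≤; neg-antimono-<; neg-antimono-≤; negative⁻¹; positive⁻¹; ≤-<-trans; ≤-antisym; ≤-refl; ≤-reflexive; ≤-total; ≤-trans; ≮⇒≥)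
open import Data.Rational.Unnormalised using (mkℚᵘ; *≡*)
import Data.Rational.Unnormalised.Properties as ℚᵘₚ
open import Data.Sum using (_⊎_; inj₁; inj₂; [_,_])
import Data.Vec.Functional as VF
import Data.Vec.Functional.Properties as VFₚ
open import Relation.Binary.Definitions using (Tri; tri<; tri≈; tri>)
open import Relation.Binary.PropositionalEquality using (_≡_; _≢_; _≗_; refl; sym; trans; cong; cong₂; subst; subst₂; module ≡-Reasoning)
open import Relation.Nullary using (¬_; Dec; yes; no)
open import Relation.Nullary.Decidable using (isYes; map′; _×-dec_; _→-dec_; ¬?; decidable-stable)
open import Tactic.RingSolver using (solve-∀)
open import Tactic.RingSolver.Core.AlmostCommutativeRing using (AlmostCommutativeRing; fromCommutativeRing)

-- The vector `y` depends neither on the tree nor on the colour. It is at least 1 on every proper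
-- cut, so it provides a T-join for whichever T a deletion leaves behind. The budget closes because
-- of the average over both colours: a tour uses at most x - Λ/2 + (x/2 + Λ/2) in expectation, where
-- Λ is the expected number of narrow cuts for which the edge is the lonely one. Within a colour an
-- edge is charged to at most one cut, and the edge of J that crosses a deleted cut serves that cut
-- alone. Parity and connectivity are expressed throughout as conditions on all subsets X. Both
-- polyhedral theorems are proved for dominants: a combination only has to lie below the given
-- vector. This makes the property upward closed, allows an edge to be lowered when no tight cut
-- contains it, and leaves a deficit that is filled at the very end.

ℚ-ring : AlmostCommutativeRing 0ℓ 0ℓ
ℚ-ring = fromCommutativeRing ℚₚ.+-*-commutativeRing isZero
  where
  isZero : ∀ x → Maybe (0ℚ ≡ x)
  isZero x with 0ℚ ℚₚ.≟ x
  ... | yes p = just p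
  ... | no _ = nothing

-- Rational inequalities

0<1 : 0ℚ < 1ℚ
0<1 = positive⁻¹ 1ℚ

0≤1 : 0ℚ ≤ 1ℚ
0≤1 = <⇒≤ 0<1

0<½ : 0ℚ < ½
0<½ = positive⁻¹ ½

≤-by : ∀ {a b} d → 0ℚ ≤ d → b ≡ a + d → a ≤ b
≤-by {a} {b} d 0≤d eq = subst₂ _≤_ (+-identityʳ a) (sym eq) (+-monoʳ-≤ a 0≤d)

<-by : ∀ {a b} d → 0ℚ < d → b ≡ a + d → a < b
<-by {a} {b} d 0<d eq = subst₂ _<_ (+-identityʳ a) (sym eq) (+-monoʳ-< a 0<d)

+-diff : ∀ a b → b ≡ a + (b - a)
+-diff = solve-∀ ℚ-ring

diff≥0 : ∀ {a b} → a ≤ b → 0ℚ ≤ b - a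
diff≥0 {a} {b} a≤b = subst (_≤ b - a) (+-inverseʳ a) (+-monoˡ-≤ (- a) a≤b)

diff>0 : ∀ {a b} → a < b → 0ℚ < b - a
diff>0 {a} {b} a<b = subst (_< b - a) (+-inverseʳ a) (+-monoˡ-< (- a) a<b)

+-nonneg : ∀ {a b} → 0ℚ ≤ a → 0ℚ ≤ b → 0ℚ ≤ a + b
+-nonneg p q = ≤-trans p (≤-by _ q refl)

+-pos : ∀ {a b} → 0ℚ < a → 0ℚ < b → 0ℚ < a + b
+-pos p q = <-trans p (<-by _ q refl)

*-mono : ∀ {a b} c → 0ℚ ≤ c → a ≤ b → c * a ≤ c * b
*-mono c 0≤c a≤b = *-monoˡ-≤-nonNeg c {{nonNegative 0≤c}} a≤b

*-nonneg : ∀ {a b} → 0ℚ ≤ a → 0ℚ ≤ b → 0ℚ ≤ a * b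
*-nonneg {a} {b} p q = subst (_≤ a * b) (*-zeroʳ a) (*-mono a p q)

*-pos : ∀ {a b} → 0ℚ < a → 0ℚ < b → 0ℚ < a * b
*-pos {a} {b} p q = subst (_< a * b) (*-zeroʳ a) (*-monoʳ-<-pos a {{positive p}} q)

*-cancel : ∀ {a b} c → 0ℚ < c → c * a ≤ c * b → a ≤ b
*-cancel c p q = *-cancelˡ-≤-pos c {{positive p}} q

0<⇒≢0 : ∀ {a} → 0ℚ < a → a ≢ 0ℚ
0<⇒≢0 p eq = <-irrefl (sym eq) p

nonneg-≢0⇒pos : ∀ {a} → 0ℚ ≤ a → a ≢ 0ℚ → 0ℚ < a
nonneg-≢0⇒pos {a} p q with 0ℚ <? a
... | yes r = r
... | no r = ⊥-elim (q (≤-antisym (≮⇒≥ r) p))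

inverse : ∀ {a} → a ≢ 0ℚ → ∃ λ r → r * a ≡ 1ℚ
inverse {a} a≢0 = (1/ a) {{≢-nonZero a≢0}} , *-inverseˡ a {{≢-nonZero a≢0}}

inverse⁺ : ∀ {a} → 0ℚ < a → ∃ λ r → 0ℚ < r × r * a ≡ 1ℚ
inverse⁺ {a} 0<a with inverse (0<⇒≢0 0<a)
... | r , ra≡1 = r , 0<r , ra≡1
  where
  0<r : 0ℚ < r
  0<r with 0ℚ <? r
  ... | yes p = p
  ... | no p = ⊥-elim (<-irrefl refl (<-≤-trans 0<1
          (subst (_≤ 0ℚ) (trans (*-comm a r) ra≡1)
            (subst (a * r ≤_) (*-zeroʳ a) (*-mono a (<⇒≤ 0<a) (≮⇒≥ p))))))

ind : Bool → ℚ
ind true = 1ℚ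
ind false = 0ℚ

ind≥0 : ∀ b → 0ℚ ≤ ind b
ind≥0 true = 0≤1
ind≥0 false = ≤-refl

ind-∧ : ∀ b c → ind (b ∧ c) ≡ ind b * ind c
ind-∧ true c = sym (*-identityˡ _)
ind-∧ false c = sym (*-zeroˡ (ind c))

true≢false : true ≢ false
true≢false ()

-- Finite sums

private module QS = SemiringSum (CommutativeRing.semiring ℚₚ.+-*-commutativeRing)
private module BS = SemiringSum (CommutativeRing.semiring xor-∧-commutativeRing)

par : ∀ {m} → (Fin m → Bool) → Bool
par = VF.foldr _xor_ false

par-cong : ∀ {m} {f g : Fin m → Bool} → (∀ i → f i ≡ g i) → par f ≡ par g
par-cong = BS.sum-cong-≗

par-xor : ∀ {m} (f g : Fin m → Bool) → par (λ i → f i xor g i) ≡ par f xor par g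
par-xor = BS.∑-distrib-+

par-comm : ∀ {m n} (f : Fin m → Fin n → Bool) → par (λ i → par (f i)) ≡ par (λ j → par (λ i → f i j))
par-comm = BS.∑-comm

par-∧ : ∀ {m} b (f : Fin m → Bool) → par (λ i → b ∧ f i) ≡ b ∧ par f
par-∧ b f = sym (BS.*-distribˡ-sum b f)

par-false : ∀ {m} {f : Fin m → Bool} → (∀ i → f i ≡ false) → par f ≡ false
par-false {m} eq = trans (par-cong eq) (BS.sum-replicate-zero m)

par-true⇒∃ : ∀ {m} (f : Fin m → Bool) → par f ≡ true → ∃ λ i → f i ≡ true
par-true⇒∃ {zero} f ()
par-true⇒∃ {suc m} f p with f zero in eq
... | true = zero , eq
... | false with par-true⇒∃ (f ∘ suc) p
...   | i , q = suc i , q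

Σ-cong : ∀ {m} {f g : Fin m → ℚ} → (∀ i → f i ≡ g i) → Σv f ≡ Σv g
Σ-cong = QS.sum-cong-≗

Σ-+ : ∀ {m} (f g : Fin m → ℚ) → Σv (λ i → f i + g i) ≡ Σv f + Σv g
Σ-+ = QS.∑-distrib-+

Σ-*ˡ : ∀ {m} c (f : Fin m → ℚ) → Σv (λ i → c * f i) ≡ c * Σv f
Σ-*ˡ c f = sym (QS.*-distribˡ-sum c f)

Σ-comm : ∀ {m n} (f : Fin m → Fin n → ℚ) → Σv (λ i → Σv (f i)) ≡ Σv (λ j → Σv (λ i → f i j))
Σ-comm = QS.∑-comm

Σ-remove : ∀ {m} (i : Fin (suc m)) (f : Fin (suc m) → ℚ) → Σv f ≡ f i + Σv (λ j → f (Data.Fin.punchIn i j))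
Σ-remove i f = QS.sum-remove f

Σ-zero : ∀ {m} {f : Fin m → ℚ} → (∀ i → f i ≡ 0ℚ) → Σv f ≡ 0ℚ
Σ-zero {m} eq = trans (Σ-cong eq) (QS.sum-replicate-zero m)

Σ-mono : ∀ {m} {f g : Fin m → ℚ} → (∀ i → f i ≤ g i) → Σv f ≤ Σv g
Σ-mono {zero} h = ≤-refl
Σ-mono {suc m} h = +-mono-≤ (h zero) (Σ-mono (h ∘ suc))

Σ-nonneg : ∀ {m} {f : Fin m → ℚ} → (∀ i → 0ℚ ≤ f i) → 0ℚ ≤ Σv f
Σ-nonneg {m} {f} h = subst (_≤ Σv f) (Σ-zero {m} (λ _ → refl)) (Σ-mono h)

Σ-term : ∀ {m} {f : Fin m → ℚ} → (∀ i → 0ℚ ≤ f i) → ∀ i → f i ≤ Σv f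
Σ-term {suc m} {f} h zero = ≤-by _ (Σ-nonneg (h ∘ suc)) refl
Σ-term {suc m} {f} h (suc i) = ≤-trans (Σ-term (h ∘ suc) i) (≤-by _ (h zero) (ℚₚ.+-comm (f zero) _))

Σ-≡0 : ∀ {m} {f : Fin m → ℚ} → (∀ i → 0ℚ ≤ f i) → Σv f ≤ 0ℚ → ∀ i → f i ≡ 0ℚ
Σ-≡0 h le i = ≤-antisym (≤-trans (Σ-term h i) le) (h i)

Σ-tight : ∀ {m} {f g : Fin m → ℚ} → (∀ i → f i ≤ g i) → Σv g ≤ Σv f → ∀ i → f i ≡ g i
Σ-tight {m} {f} {g} h le i = sym (trans (+-diff (f i) (g i)) (trans (cong (f i +_) (Σ-≡0 {f = λ j → g j - f j} (λ j → diff≥0 (h j)) tot i)) (+-identityʳ _)))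
  where
  split : Σv g ≡ Σv f + Σv (λ j → g j - f j)
  split = trans (Σ-cong (λ j → +-diff (f j) (g j))) (Σ-+ f (λ j → g j - f j))
  tot : Σv (λ j → g j - f j) ≤ 0ℚ
  tot = ≤-by _ (diff≥0 le) (trans (lem (Σv f) (Σv (λ j → g j - f j))) (cong (λ q → Σv (λ j → g j - f j) + (Σv f - q)) (sym split)))
    where
    lem : ∀ p q → 0ℚ ≡ q + (p - (p + q))
    lem = solve-∀ ℚ-ring

Σ-pos⇒∃ : ∀ {m} {f : Fin m → ℚ} → (∀ i → 0ℚ ≤ f i) → 0ℚ < Σv f → ∃ λ i → 0ℚ < f i
Σ-pos⇒∃ {zero} h p = ⊥-elim (<-irrefl refl p)
Σ-pos⇒∃ {suc m} {f} h p with 0ℚ <? f zero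
... | yes q = zero , q
... | no q with Σ-pos⇒∃ (h ∘ suc) (<-≤-trans p (subst (f zero + Σv (f ∘ suc) ≤_) (+-identityˡ _) (+-monoˡ-≤ _ (≮⇒≥ q))))
...   | i , r = suc i , r

==-refl : ∀ {n} (u : Fin n) → singleton u u ≡ true
==-refl u with u ≟ u
... | yes _ = refl
... | no q = ⊥-elim (q refl)

==-≢ : ∀ {n} {u v : Fin n} → v ≢ u → singleton u v ≡ false
==-≢ {u = u} {v} q with v ≟ u
... | yes p = ⊥-elim (q p)
... | no _ = refl

==⇒≡ : ∀ {n} {u v : Fin n} → singleton u v ≡ true → v ≡ u
==⇒≡ {u = u} {v} q with v ≟ u
... | yes p = p

==-suc : ∀ {n} (u v : Fin n) → singleton (suc u) (suc v) ≡ singleton u v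
==-suc u v with v ≟ u
... | yes _ = refl
... | no _ = refl

Σ-single : ∀ {n} (u : Fin n) (f : Fin n → ℚ) → Σv (λ v → ind (singleton u v) * f v) ≡ f u
Σ-single zero f = trans (cong₂ _+_ (*-identityˡ (f zero)) (Σ-zero (λ i → *-zeroˡ (f (suc i))))) (+-identityʳ _)
Σ-single (suc u) f = trans (cong₂ _+_ (*-zeroˡ (f zero)) (trans (Σ-cong (λ i → cong (λ b → ind b * f (suc i)) (==-suc u i))) (Σ-single u (f ∘ suc)))) (+-identityˡ _)

par-single : ∀ {n} (u : Fin n) (X : Fin n → Bool) → par (λ v → X v ∧ singleton v u) ≡ X u
par-single zero X = trans (cong₂ _xor_ (∧-identityʳ (X zero)) (par-false (λ i → ∧-zeroʳ (X (suc i))))) (xor-identityʳ _)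
par-single (suc u) X = trans (cong₂ _xor_ (∧-zeroʳ (X zero)) (par-cong (λ i → cong (X (suc i) ∧_) (==-suc i u)))) (par-single u (X ∘ suc))

-- Finitely supported distributions

private variable 𝒜 ℬ 𝒞 : Set

-- Weights are strictly positive, so what holds almost surely holds for every atom; `refine` relies
-- on this.
record Atom (𝒜 : Set) : Set where
  constructor atom
  field
    weight : ℚ
    weight>0 : 0ℚ < weight
    value : 𝒜

Dist : Set → Set
Dist 𝒜 = List (Atom 𝒜)

𝔼 : Dist 𝒜 → (𝒜 → ℚ) → ℚ
𝔼 [] f = 0ℚ
𝔼 (atom w _ a ∷ L) f = w * f a + 𝔼 L f

scale : ∀ c → 0ℚ < c → Dist 𝒜 → Dist 𝒜
scale c c>0 [] = []
scale c c>0 (atom w w>0 a ∷ L) = atom (c * w) (*-pos c>0 w>0) a ∷ scale c c>0 L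

𝔼-scale : ∀ c c>0 (L : Dist 𝒜) f → 𝔼 (scale c c>0 L) f ≡ c * 𝔼 L f
𝔼-scale c c>0 [] f = sym (*-zeroʳ c)
𝔼-scale c c>0 (atom w _ a ∷ L) f = trans (cong₂ _+_ (*-assoc c w (f a)) (𝔼-scale c c>0 L f)) (sym (*-distribˡ-+ c (w * f a) (𝔼 L f)))

𝔼-++ : ∀ (L M : Dist 𝒜) f → 𝔼 (L ++ M) f ≡ 𝔼 L f + 𝔼 M f
𝔼-++ [] M f = sym (+-identityˡ _)
𝔼-++ (atom w _ a ∷ L) M f = trans (cong (w * f a +_) (𝔼-++ L M f)) (sym (ℚₚ.+-assoc (w * f a) (𝔼 L f) (𝔼 M f)))

bind : Dist 𝒜 → (𝒜 → Dist ℬ) → Dist ℬ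
bind [] k = []
bind (atom w w>0 a ∷ L) k = scale w w>0 (k a) ++ bind L k

𝔼-bind : ∀ (L : Dist 𝒜) (k : 𝒜 → Dist ℬ) f → 𝔼 (bind L k) f ≡ 𝔼 L (λ a → 𝔼 (k a) f)
𝔼-bind [] k f = refl
𝔼-bind (atom w w>0 a ∷ L) k f = trans (𝔼-++ (scale w w>0 (k a)) (bind L k) f) (cong₂ _+_ (𝔼-scale w w>0 (k a) f) (𝔼-bind L k f))

𝔼-cong : ∀ (L : Dist 𝒜) {f g : 𝒜 → ℚ} → (∀ a → f a ≡ g a) → 𝔼 L f ≡ 𝔼 L g
𝔼-cong [] h = refl
𝔼-cong (atom w _ a ∷ L) h = cong₂ (λ p q → w * p + q) (h a) (𝔼-cong L h)

𝔼-mono : ∀ (L : Dist 𝒜) {f g : 𝒜 → ℚ} → (∀ a → f a ≤ g a) → 𝔼 L f ≤ 𝔼 L g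
𝔼-mono [] h = ≤-refl
𝔼-mono (atom w w>0 a ∷ L) h = +-mono-≤ (*-mono w (<⇒≤ w>0) (h a)) (𝔼-mono L h)

𝔼-+ : ∀ (L : Dist 𝒜) (f g : 𝒜 → ℚ) → 𝔼 L (λ a → f a + g a) ≡ 𝔼 L f + 𝔼 L g
𝔼-+ [] f g = refl
𝔼-+ (atom w _ a ∷ L) f g = trans (cong (w * (f a + g a) +_) (𝔼-+ L f g)) (lem w (f a) (g a) (𝔼 L f) (𝔼 L g))
  where
  lem : ∀ w p q r s → w * (p + q) + (r + s) ≡ (w * p + r) + (w * q + s)
  lem = solve-∀ ℚ-ring

𝔼-*ˡ : ∀ (L : Dist 𝒜) c (f : 𝒜 → ℚ) → 𝔼 L (λ a → c * f a) ≡ c * 𝔼 L f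
𝔼-*ˡ [] c f = sym (*-zeroʳ c)
𝔼-*ˡ (atom w _ a ∷ L) c f = trans (cong (w * (c * f a) +_) (𝔼-*ˡ L c f)) (lem w c (f a) (𝔼 L f))
  where
  lem : ∀ w c p r → w * (c * p) + c * r ≡ c * (w * p + r)
  lem = solve-∀ ℚ-ring

𝔼-zero : ∀ (L : Dist 𝒜) → 𝔼 L (λ _ → 0ℚ) ≡ 0ℚ
𝔼-zero L = trans (𝔼-cong L (λ _ → sym (*-zeroˡ 0ℚ))) (trans (𝔼-*ˡ L 0ℚ (λ _ → 0ℚ)) (*-zeroˡ (𝔼 L (λ _ → 0ℚ))))

𝔼-nonneg : ∀ (L : Dist 𝒜) {f : 𝒜 → ℚ} → (∀ a → 0ℚ ≤ f a) → 0ℚ ≤ 𝔼 L f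
𝔼-nonneg L {f} h = subst (_≤ 𝔼 L f) (𝔼-zero L) (𝔼-mono L h)

𝔼-const : ∀ (L : Dist 𝒜) c → 𝔼 L (λ _ → 1ℚ) ≡ 1ℚ → 𝔼 L (λ _ → c) ≡ c
𝔼-const L c eq = trans (𝔼-cong L (λ _ → sym (*-identityʳ c))) (trans (𝔼-*ˡ L c (λ _ → 1ℚ)) (trans (cong (c *_) eq) (*-identityʳ c)))

𝔼-Σ : ∀ {m} (L : Dist 𝒜) (f : 𝒜 → Fin m → ℚ) → 𝔼 L (λ a → Σv (f a)) ≡ Σv (λ i → 𝔼 L (λ a → f a i))
𝔼-Σ {m = zero} L f = 𝔼-zero L
𝔼-Σ {m = suc m} L f = trans (𝔼-+ L (λ a → f a zero) (λ a → Σv (f a ∘ suc))) (cong (𝔼 L (λ a → f a zero) +_) (𝔼-Σ L (λ a → f a ∘ suc)))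

𝔼-swap : ∀ (L : Dist 𝒜) (M : Dist ℬ) (f : 𝒜 → ℬ → ℚ) → 𝔼 L (λ a → 𝔼 M (f a)) ≡ 𝔼 M (λ b → 𝔼 L (λ a → f a b))
𝔼-swap [] M f = sym (𝔼-zero M)
𝔼-swap (atom w _ a ∷ L) M f = sym (trans (𝔼-+ M (λ b → w * f a b) (λ b → 𝔼 L (λ a′ → f a′ b))) (cong₂ _+_ (𝔼-*ˡ M w (f a)) (sym (𝔼-swap L M f))))

-- Conditioning by a nonnegative density κ; atoms of density 0 are dropped.
reweigh : ∀ (κ : 𝒜 → ℚ) → (∀ a → 0ℚ < κ a → 𝒞) → Dist 𝒜 → Dist 𝒞
reweigh κ g [] = []
reweigh κ g (atom w w>0 a ∷ L) with 0ℚ <? κ a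
... | yes p = atom (w * κ a) (*-pos w>0 p) (g a p) ∷ reweigh κ g L
... | no _ = reweigh κ g L

𝔼-reweigh : ∀ (κ : 𝒜 → ℚ) (g : ∀ a → 0ℚ < κ a → 𝒞) (L : Dist 𝒜) (f : 𝒞 → ℚ) (f′ : 𝒜 → ℚ) →
  (∀ a → 0ℚ ≤ κ a) → (∀ a p → f (g a p) ≡ f′ a) → 𝔼 (reweigh κ g L) f ≡ 𝔼 L (λ a → κ a * f′ a)
𝔼-reweigh κ g [] f f′ κ≥0 eq = refl
𝔼-reweigh κ g (atom w w>0 a ∷ L) f f′ κ≥0 eq with 0ℚ <? κ a
... | yes p = cong₂ _+_ (trans (cong (w * κ a *_) (eq a p)) (*-assoc w (κ a) (f′ a))) (𝔼-reweigh κ g L f f′ κ≥0 eq)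
... | no p = trans (𝔼-reweigh κ g L f f′ κ≥0 eq) (sym (trans (cong (λ k → w * (k * f′ a) + 𝔼 L (λ a → κ a * f′ a)) κ≡0) (lem w (f′ a) _)))
  where
  κ≡0 : κ a ≡ 0ℚ
  κ≡0 = ≤-antisym (≮⇒≥ p) (κ≥0 a)
  lem : ∀ w q r → w * (0ℚ * q) + r ≡ r
  lem = solve-∀ ℚ-ring

-- Since every value is at least 1 and the mean does not exceed the total weight, no atom can lie
-- above 1. The equation is stored with each atom, which turns a statement about averages into one
-- about every member.
refine : ∀ (L : Dist 𝒜) (g : 𝒜 → ℚ) → (∀ a → 1ℚ ≤ g a) → 𝔼 L g ≤ 𝔼 L (λ _ → 1ℚ) →
  Σ (Dist (Σ 𝒜 (λ a → g a ≡ 1ℚ))) λ L′ → ∀ f → 𝔼 L′ (f ∘ proj₁) ≡ 𝔼 L f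
refine [] g g≥1 le = [] , λ f → refl
refine (atom w w>0 a ∷ L) g g≥1 le =
  atom w w>0 (a , ga≡1) ∷ proj₁ rest , λ f → cong (w * f a +_) (proj₂ rest f)
  where
  tail≥ : 𝔼 L (λ _ → 1ℚ) ≤ 𝔼 L g
  tail≥ = 𝔼-mono L g≥1
  head≥ : w * 1ℚ ≤ w * g a
  head≥ = *-mono w (<⇒≤ w>0) (g≥1 a)
  ga≡1 : g a ≡ 1ℚ
  ga≡1 = ≤-antisym (*-cancel w w>0 (≤-by _ (+-nonneg (diff≥0 le) (diff≥0 tail≥)) (lem (w * 1ℚ) (w * g a) (𝔼 L g) (𝔼 L (λ _ → 1ℚ))))) (g≥1 a)
    where
    lem : ∀ p q r s → p ≡ q + ((p + s - (q + r)) + (r - s))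
    lem = solve-∀ ℚ-ring
  rest = refine L g g≥1 (≤-by _ (+-nonneg (diff≥0 le) (diff≥0 head≥)) (lem (w * 1ℚ) (w * g a) (𝔼 L g) (𝔼 L (λ _ → 1ℚ))))
    where
    lem : ∀ p q r s → s ≡ r + ((p + s - (q + r)) + (q - p))
    lem = solve-∀ ℚ-ring

-- Membership of `y` in the dominant of the convex hull of the sets with property `P`.
record Dom {m} (P : (Fin m → Bool) → Set) (y : Fin m → ℚ) : Set where
  constructor dom
  field
    dist : Dist (Σ (Fin m → Bool) P)
    total : 𝔼 dist (λ _ → 1ℚ) ≡ 1ℚ
    below : ∀ e → 𝔼 dist (λ J → ind (proj₁ J e)) ≤ y e

module _ {m} {P : (Fin m → Bool) → Set} where

  Dom-↑ : ∀ {y y′} → (∀ e → y e ≤ y′ e) → Dom P y → Dom P y′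
  Dom-↑ h (dom L t b) = dom L t (λ e → ≤-trans (b e) (h e))

  Dom-mix : ∀ {y y₁ y₂} α β → 0ℚ < α → 0ℚ < β → α + β ≡ 1ℚ → (∀ e → α * y₁ e + β * y₂ e ≡ y e) →
    Dom P y₁ → Dom P y₂ → Dom P y
  Dom-mix {y} α β α>0 β>0 α+β≡1 eq (dom L t b) (dom L′ t′ b′) = dom
    (scale α α>0 L ++ scale β β>0 L′)
    (trans (𝔼-mix (λ _ → 1ℚ)) (trans (cong₂ (λ p q → α * p + β * q) t t′) (trans (cong₂ _+_ (*-identityʳ α) (*-identityʳ β)) α+β≡1)))
    (λ e → subst₂ _≤_ (sym (𝔼-mix _)) (eq e) (+-mono-≤ (*-mono α (<⇒≤ α>0) (b e)) (*-mono β (<⇒≤ β>0) (b′ e))))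
    where
    𝔼-mix : ∀ f → 𝔼 (scale α α>0 L ++ scale β β>0 L′) f ≡ α * 𝔼 L f + β * 𝔼 L′ f
    𝔼-mix f = trans (𝔼-++ (scale α α>0 L) (scale β β>0 L′) f) (cong₂ _+_ (𝔼-scale α α>0 L f) (𝔼-scale β β>0 L′ f))

  Dom-pure : ∀ {y} J → P J → (∀ e → ind (J e) ≤ y e) → Dom P y
  Dom-pure J p h = dom (atom 1ℚ 0<1 (J , p) ∷ []) refl (λ e → subst (_≤ _) (sym (trans (+-identityʳ _) (*-identityˡ _))) (h e))

module _ (L : Dist 𝒜) (M : Dist ℬ) (κ : 𝒜 → ℬ → ℚ) (κ≥0 : ∀ a b → 0ℚ ≤ κ a b)
  (margˡ : ∀ a → 𝔼 M (κ a) ≡ 1ℚ) (margʳ : ∀ b → 𝔼 L (λ a → κ a b) ≡ 1ℚ)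
  (g : ∀ a b → 0ℚ < κ a b → 𝒞) where

  -- A joint distribution with density `κ` relative to the product of `L` and `M`. As `κ` averages
  -- to 1 in each variable, its marginals are `L` and `M`. The combination `g` is needed only for
  -- pairs of positive density, that is, for compatible ones.
  couple : Dist 𝒞
  couple = bind L (λ a → reweigh (κ a) (g a) M)

  𝔼-couple : ∀ f (f′ : 𝒜 → ℬ → ℚ) → (∀ a b p → f (g a b p) ≡ f′ a b) → 𝔼 couple f ≡ 𝔼 L (λ a → 𝔼 M (λ b → κ a b * f′ a b))
  𝔼-couple f f′ h = trans (𝔼-bind L _ f) (𝔼-cong L (λ a → 𝔼-reweigh (κ a) (g a) M f (f′ a) (κ≥0 a) (h a)))

  𝔼-coupleˡ : ∀ f (f′ : 𝒜 → ℚ) → (∀ a b p → f (g a b p) ≡ f′ a) → 𝔼 couple f ≡ 𝔼 L f′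
  𝔼-coupleˡ f f′ h = trans (𝔼-couple f (λ a _ → f′ a) h) (𝔼-cong L (λ a →
    trans (𝔼-cong M (λ b → *-comm (κ a b) (f′ a))) (trans (𝔼-*ˡ M (f′ a) (κ a)) (trans (cong (f′ a *_) (margˡ a)) (*-identityʳ _)))))

  𝔼-coupleʳ : ∀ f (f′ : ℬ → ℚ) → (∀ a b p → f (g a b p) ≡ f′ b) → 𝔼 couple f ≡ 𝔼 M f′
  𝔼-coupleʳ f f′ h = trans (𝔼-couple f (λ _ b → f′ b) h) (trans (𝔼-swap L M _) (𝔼-cong M (λ b →
    trans (𝔼-cong L (λ a → *-comm (κ a b) (f′ b))) (trans (𝔼-*ˡ L (f′ b) (λ a → κ a b)) (trans (cong (f′ b *_) (margʳ b)) (*-identityʳ _))))))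

-- Moving to a face of a polyhedron

infix 8 _·_

_·_ : ∀ {m} → (Fin m → ℚ) → (Fin m → ℚ) → ℚ
c · y = Σv (λ e → c e * y e)

·-move : ∀ {m} (c y z : Fin m → ℚ) α → c · (λ e → y e + α * z e) ≡ c · y + α * c · z
·-move c y z α = trans (Σ-cong (λ e → lem (c e) (y e) (z e) α))
  (trans (Σ-+ (λ e → c e * y e) (λ e → α * (c e * z e))) (cong (c · y +_) (Σ-*ˡ α (λ e → c e * z e))))
  where
  lem : ∀ c y z α → c * (y + α * z) ≡ c * y + α * (c * z)
  lem = solve-∀ ℚ-ring

·-neg : ∀ {m} (c z : Fin m → ℚ) → c · (λ e → - z e) ≡ - (c · z)
·-neg c z = trans (Σ-cong (λ e → lem (c e) (z e))) (trans (Σ-*ˡ (- 1ℚ) (λ e → c e * z e)) (lem′ (c · z)))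
  where
  lem : ∀ c z → c * (- z) ≡ (- 1ℚ) * (c * z)
  lem = solve-∀ ℚ-ring
  lem′ : ∀ z → (- 1ℚ) * z ≡ - z
  lem′ = solve-∀ ℚ-ring

unit : ∀ {m} → Fin m → Fin m → ℚ
unit e f = ind (singleton e f)

unit-· : ∀ {m} e (y : Fin m → ℚ) → unit e · y ≡ y e
unit-· = Σ-single

unit-self : ∀ {m} (e : Fin m) → unit e e ≡ 1ℚ
unit-self e = cong ind (==-refl e)

unit-≢ : ∀ {m} {e f : Fin m} → f ≢ e → unit e f ≡ 0ℚ
unit-≢ q = cong ind (==-≢ q)

·-comm : ∀ {m} (c y : Fin m → ℚ) → c · y ≡ y · c
·-comm c y = Σ-cong (λ e → *-comm (c e) (y e))

·-unit : ∀ {m} (y : Fin m → ℚ) e → y · unit e ≡ y e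
·-unit y e = trans (·-comm y (unit e)) (unit-· e y)

record Row (m : ℕ) : Set where
  constructor row
  field
    coef : Fin m → ℚ
    rhs : ℚ
open Row

slack : ∀ {m} → Row m → (Fin m → ℚ) → ℚ
slack r y = coef r · y - rhs r

slack-move : ∀ {m} (r : Row m) y z α → slack r (λ e → y e + α * z e) ≡ slack r y + α * coef r · z
slack-move r y z α = trans (cong (_- rhs r) (·-move (coef r) y z α)) (lem (coef r · y) (α * coef r · z) (rhs r))
  where
  lem : ∀ p q r → p + q - r ≡ p - r + q
  lem = solve-∀ ℚ-ring

Feasible : ∀ {m} → List (Row m) → (Fin m → ℚ) → Set
Feasible rows y = ∀ r → r ∈ rows → 0ℚ ≤ slack r y

-- The ratio test of the simplex method, with slacks `σ` and rates of change `δ`. The smallest ratio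
-- over the decreasing rows is the longest feasible step, and it makes a loose row tight.
ratioTest : ∀ {R : Set} (σ δ : R → ℚ) (rs : List R) →
  (∀ r → r ∈ rs → 0ℚ ≤ σ r) → (∀ r → r ∈ rs → σ r ≡ 0ℚ → δ r ≡ 0ℚ) →
  (∀ r → r ∈ rs → 0ℚ ≤ δ r) ⊎
  (∃ λ α → 0ℚ < α × (∀ r → r ∈ rs → 0ℚ ≤ σ r + α * δ r) × ∃ λ r → r ∈ rs × 0ℚ < σ r × σ r + α * δ r ≡ 0ℚ)
ratioTest σ δ [] σ≥0 tight = inj₁ (λ _ ())
ratioTest {R} σ δ (r ∷ rs) σ≥0 tight with ratioTest σ δ rs (λ r′ i → σ≥0 r′ (there i)) (λ r′ i → tight r′ (there i)) | δ r <? 0ℚ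
... | inj₁ h | no δ≮0 = inj₁ λ { r′ (here refl) → ≮⇒≥ δ≮0 ; r′ (there i) → h r′ i }
... | inj₂ (α , α>0 , ok , r₀ , i₀ , p₀ , q₀) | no δ≮0 =
  inj₂ (α , α>0 , (λ { r′ (here refl) → +-nonneg (σ≥0 r (here refl)) (*-nonneg (<⇒≤ α>0) (≮⇒≥ δ≮0)) ; r′ (there i) → ok r′ i })
       , r₀ , there i₀ , p₀ , q₀)
... | h | yes δ<0 = go h
  where
  -δ>0 : 0ℚ < - δ r
  -δ>0 = subst (0ℚ <_) (+-identityˡ (- δ r)) (diff>0 δ<0)
  σ>0 : 0ℚ < σ r
  σ>0 = nonneg-≢0⇒pos (σ≥0 r (here refl)) (λ eq → <-irrefl (tight r (here refl) eq) δ<0)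
  inv = inverse⁺ -δ>0
  -- The ratio σ r / (- δ r), at which row `r` becomes tight.
  α₀ = σ r * proj₁ inv
  α₀>0 : 0ℚ < α₀
  α₀>0 = *-pos σ>0 (proj₁ (proj₂ inv))
  hit : σ r + α₀ * δ r ≡ 0ℚ
  hit = trans (lem (σ r) (proj₁ inv) (δ r)) (trans (cong (λ q → σ r - σ r * q) (proj₂ (proj₂ inv))) (lem′ (σ r)))
    where
    lem : ∀ s i d → s + s * i * d ≡ s - s * (i * (- d))
    lem = solve-∀ ℚ-ring
    lem′ : ∀ s → s - s * 1ℚ ≡ 0ℚ
    lem′ = solve-∀ ℚ-ring
  shrink : ∀ {s d} α β → 0ℚ < α → α ≤ β → 0ℚ ≤ s → 0ℚ ≤ s + β * d → 0ℚ ≤ s + α * d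
  shrink {s} {d} α β α>0 α≤β s≥0 h with d <? 0ℚ
  ... | no d≮0 = +-nonneg s≥0 (*-nonneg (<⇒≤ α>0) (≮⇒≥ d≮0))
  ... | yes d<0 = ≤-trans h (≤-by ((β - α) * (0ℚ - d)) (*-nonneg (diff≥0 α≤β) (diff≥0 (<⇒≤ d<0))) (lem s d α β))
    where
    lem : ∀ s d α β → s + α * d ≡ s + β * d + (β - α) * (0ℚ - d)
    lem = solve-∀ ℚ-ring
  go : _ → _
  go (inj₁ h) = inj₂ (α₀ , α₀>0 , (λ { r′ (here refl) → ≤-reflexive (sym hit) ; r′ (there i) → +-nonneg (σ≥0 r′ (there i)) (*-nonneg (<⇒≤ α₀>0) (h r′ i)) })
    , r , here refl , σ>0 , hit)
  -- The smaller of the two steps is feasible for all rows.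
  go (inj₂ (α , α>0 , ok , r₀ , i₀ , p₀ , q₀)) with ≤-total α₀ α
  ... | inj₁ α₀≤α = inj₂ (α₀ , α₀>0 , (λ { r′ (here refl) → ≤-reflexive (sym hit) ; r′ (there i) → shrink α₀ α α₀>0 α₀≤α (σ≥0 r′ (there i)) (ok r′ i) })
    , r , here refl , σ>0 , hit)
  ... | inj₂ α≤α₀ = inj₂ (α , α>0 , (λ { r′ (here refl) → shrink α α₀ α>0 α≤α₀ (σ≥0 r (here refl)) (≤-reflexive (sym hit)) ; r′ (there i) → ok r′ i })
    , r₀ , there i₀ , p₀ , q₀)

bit : Bool → ℕ
bit b = if b then 1 else 0

-- Termination measure: on passing to a smaller face the tight rows stay tight and at least one more
-- becomes tight.
#loose : ∀ {R : Set} → (R → ℚ) → List R → ℕ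
#loose σ [] = 0
#loose σ (r ∷ rs) = bit (isYes (0ℚ <? σ r)) ℕ.+ #loose σ rs

#loose-≤ : ∀ {R : Set} (σ σ′ : R → ℚ) rs → (∀ r → r ∈ rs → 0ℚ ≤ σ r) → (∀ r → r ∈ rs → σ r ≡ 0ℚ → σ′ r ≡ 0ℚ) →
  #loose σ′ rs ℕ.≤ #loose σ rs
#loose-≤ σ σ′ [] σ≥0 tight = ℕ.z≤n
#loose-≤ σ σ′ (r ∷ rs) σ≥0 tight = ℕₚ.+-mono-≤ head (#loose-≤ σ σ′ rs (λ r′ i → σ≥0 r′ (there i)) (λ r′ i → tight r′ (there i)))
  where
  head : bit (isYes (0ℚ <? σ′ r)) ℕ.≤ bit (isYes (0ℚ <? σ r))
  head with 0ℚ <? σ′ r | 0ℚ <? σ r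
  ... | no _ | _ = ℕ.z≤n
  ... | yes _ | yes _ = ℕₚ.≤-refl
  ... | yes p | no q = ⊥-elim (0<⇒≢0 p (tight r (here refl) (≤-antisym (≮⇒≥ q) (σ≥0 r (here refl)))))

#loose-< : ∀ {R : Set} (σ σ′ : R → ℚ) rs → (∀ r → r ∈ rs → 0ℚ ≤ σ r) → (∀ r → r ∈ rs → σ r ≡ 0ℚ → σ′ r ≡ 0ℚ) →
  ∀ {r} → r ∈ rs → 0ℚ < σ r → σ′ r ≡ 0ℚ → #loose σ′ rs ℕ.< #loose σ rs
#loose-< σ σ′ (r ∷ rs) σ≥0 tight (there i) p q =
  ℕₚ.+-mono-≤-< (≤-head (#loose-≤ σ σ′ (r ∷ []) (λ { _ (here refl) → σ≥0 r (here refl) }) (λ { _ (here refl) → tight r (here refl) })))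
    (#loose-< σ σ′ rs (λ r′ i → σ≥0 r′ (there i)) (λ r′ i → tight r′ (there i)) i p q)
  where
  ≤-head : ∀ {a b} → a ℕ.+ 0 ℕ.≤ b ℕ.+ 0 → a ℕ.≤ b
  ≤-head {a} {b} = subst₂ ℕ._≤_ (ℕₚ.+-identityʳ a) (ℕₚ.+-identityʳ b)
#loose-< σ σ′ (r ∷ rs) σ≥0 tight (here refl) p q with 0ℚ <? σ′ r | 0ℚ <? σ r
... | yes p′ | _ = ⊥-elim (0<⇒≢0 p′ q)
... | no _ | no p′ = ⊥-elim (p′ p)
... | no _ | yes _ = ℕ.s≤s (#loose-≤ σ σ′ rs (λ r′ i → σ≥0 r′ (there i)) (λ r′ i → tight r′ (there i)))

-- Moving along `z` stays within the smallest face containing `y`, and `blocked` makes the forward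
-- move stop. Backwards there are two options: a second stop, so that `y` is a mixture of two end
-- points, or `z` ≤ 0, so that the forward end point already lies below `y`.
record Direction {m} (rows : List (Row m)) (y z : Fin m → ℚ) : Set where
  constructor direction
  field
    keepsTight : ∀ r → r ∈ rows → slack r y ≡ 0ℚ → coef r · z ≡ 0ℚ
    blocked : ∃ λ r → r ∈ rows × coef r · z < 0ℚ
    backward : (∃ λ r → r ∈ rows × 0ℚ < coef r · z) ⊎ (∀ e → z e ≤ 0ℚ)

-- A point from which one can move along a line in both directions (or downwards) reaches faces with
-- more tight rows, so a property closed under mixing and increasing needs to be checked only at points
-- from which no such move is possible.
module _ {m} (rows : List (Row m)) (Φ : (Fin m → ℚ) → Set)
  (mix : ∀ {y y₁ y₂} α β → 0ℚ < α → 0ℚ < β → α + β ≡ 1ℚ → (∀ e → α * y₁ e + β * y₂ e ≡ y e) → Φ y₁ → Φ y₂ → Φ y)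
  (up : ∀ {y y′} → (∀ e → y e ≤ y′ e) → Φ y → Φ y′)
  (step : ∀ y → Feasible rows y → Φ y ⊎ ∃ λ z → Direction rows y z) where

  private
    moveUntilTight : ∀ y z → Feasible rows y → (∀ r → r ∈ rows → slack r y ≡ 0ℚ → coef r · z ≡ 0ℚ) →
      (∃ λ r → r ∈ rows × coef r · z < 0ℚ) →
      ∃ λ α → 0ℚ < α × Feasible rows (λ e → y e + α * z e) ×
        #loose (λ r → slack r (λ e → y e + α * z e)) rows ℕ.< #loose (λ r → slack r y) rows
    moveUntilTight y z feas keep (r , i , neg) with ratioTest (λ r → slack r y) (λ r → coef r · z) rows feas keep
    ... | inj₁ h = ⊥-elim (<-irrefl refl (≤-<-trans (h r i) neg))
    ... | inj₂ (α , α>0 , ok , r₀ , i₀ , p₀ , q₀) = α , α>0 , (λ r i → subst (0ℚ ≤_) (sym (slack-move r y z α)) (ok r i)) ,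
      #loose-< (λ r → slack r y) (λ r → slack r (λ e → y e + α * z e)) rows feas (λ r i eq → trans (slack-move r y z α) (trans (cong₂ (λ p q → p + α * q) eq (keep r i eq)) (lem α))) i₀ p₀
        (trans (slack-move r₀ y z α) q₀)
      where
      lem : ∀ α → 0ℚ + α * 0ℚ ≡ 0ℚ
      lem = solve-∀ ℚ-ring

    -- With weights β/(α + β) and α/(α + β) the displacements α z and - β z cancel.
    between : ∀ y (z : Fin m → ℚ) α β → 0ℚ < α → 0ℚ < β → Φ (λ e → y e + α * z e) → Φ (λ e → y e + β * (- z e)) → Φ y
    between y z α β α>0 β>0 = mix {y} {λ e → y e + α * z e} {λ e → y e + β * (- z e)} (i * β) (i * α) (*-pos i>0 β>0) (*-pos i>0 α>0)
      (trans (lem i α β) inv) (λ e → trans (lem′ i α β (y e) (z e)) (trans (cong (_* y e) inv) (*-identityˡ (y e))))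
      where
      inverse-sum = inverse⁺ (+-pos α>0 β>0)
      i = proj₁ inverse-sum
      i>0 = proj₁ (proj₂ inverse-sum)
      inv = proj₂ (proj₂ inverse-sum)
      lem : ∀ i α β → i * β + i * α ≡ i * (α + β)
      lem = solve-∀ ℚ-ring
      lem′ : ∀ i α β y z → (i * β) * (y + α * z) + (i * α) * (y + β * (- z)) ≡ (i * (α + β)) * y
      lem′ = solve-∀ ℚ-ring

    above : ∀ y (z : Fin m → ℚ) α → 0ℚ < α → (∀ e → z e ≤ 0ℚ) → Φ (λ e → y e + α * z e) → Φ y
    above y z α α>0 z≤0 = up {λ e → y e + α * z e} {y} (λ e → ≤-by (α * (0ℚ - z e)) (*-nonneg (<⇒≤ α>0) (diff≥0 (z≤0 e))) (lem (y e) α (z e)))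
      where
      lem : ∀ y α z → y ≡ y + α * z + α * (0ℚ - z)
      lem = solve-∀ ℚ-ring

    induct : ∀ k y → Feasible rows y → #loose (λ r → slack r y) rows ℕ.< k → Φ y
    descend : ∀ k y → Feasible rows y → #loose (λ r → slack r y) rows ℕ.≤ k → ∀ z → Direction rows y z → Φ y

    induct (suc k) y feas (ℕ.s≤s lt) = [ (λ φ → φ) , (λ (z , d) → descend k y feas lt z d) ] (step y feas)

    descend k y feas lt z (direction keep blocked backward) = [ twoSided , (λ z≤0 → above y z α α>0 z≤0 φ₁) ] backward
      where
      forth = moveUntilTight y z feas keep blocked
      α = proj₁ forth
      α>0 = proj₁ (proj₂ forth)
      φ₁ : Φ (λ e → y e + α * z e)
      φ₁ = induct k (λ e → y e + α * z e) (proj₁ (proj₂ (proj₂ forth))) (ℕₚ.<-≤-trans (proj₂ (proj₂ (proj₂ forth))) lt)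
      twoSided : (∃ λ r → r ∈ rows × 0ℚ < coef r · z) → Φ y
      twoSided (r , i , pos) = between y z α β α>0 (proj₁ (proj₂ back)) φ₁
        (induct k (λ e → y e + β * (- z e)) (proj₁ (proj₂ (proj₂ back))) (ℕₚ.<-≤-trans (proj₂ (proj₂ (proj₂ back))) lt))
        where
        back = moveUntilTight y (λ e → - z e) feas
          (λ r i eq → trans (·-neg (coef r) z) (cong -_ (keep r i eq)))
          (r , i , subst (_< 0ℚ) (sym (·-neg (coef r) z)) (neg-antimono-< pos))
        β = proj₁ back

  faceInduction : ∀ y → Feasible rows y → Φ y
  faceInduction y feas = induct _ y feas ℕₚ.≤-refl

-- Homogeneous linear systems

-- Gaussian elimination: a zero equation is dropped, and any other equation is used to eliminate one
-- variable, so the surplus of unknowns over equations never shrinks.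
kernel : ∀ k {m} (eqs : List (Fin m → ℚ)) → length eqs ℕ.≤ k → k ℕ.< m →
  ∃ λ (z : Fin m → ℚ) → (∃ λ e → z e ≢ 0ℚ) × (∀ c → c ∈ eqs → c · z ≡ 0ℚ)
kernel k {suc m} [] le lt = (λ _ → 1ℚ) , (zero , λ ()) , λ _ ()
kernel (suc k) {suc m} (c ∷ eqs) (ℕ.s≤s le) (ℕ.s≤s lt) with Finₚ.any? (λ i → ¬? (c i ℚₚ.≟ 0ℚ))
... | no none with kernel k eqs le (ℕₚ.m<n⇒m<1+n lt)
...   | z , nz , sol = z , nz , λ { _ (here refl) → Σ-zero (λ e → trans (cong (_* z e) (c≡0 e)) (*-zeroˡ (z e))) ; c′ (there i) → sol c′ i }
  where
  c≡0 : ∀ e → c e ≡ 0ℚ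
  c≡0 e with c e ℚₚ.≟ 0ℚ
  ... | yes p = p
  ... | no p = ⊥-elim (none (e , p))
kernel (suc k) {suc m} (c ∷ eqs) (ℕ.s≤s le) (ℕ.s≤s lt) | yes (i , ci≢0) with inverse ci≢0
... | r , rc≡1 = z , (punchIn i (proj₁ nz′) , λ eq → proj₂ nz′ (trans (sym (z-punchIn (proj₁ nz′))) eq)) ,
    λ { _ (here refl) → solves-c ; c′ (there j) → solves c′ j }
  where
  reduce : (Fin (suc m) → ℚ) → Fin m → ℚ
  reduce c′ j = c′ (punchIn i j) + (- (c′ i * r)) * c (punchIn i j)
  IH = kernel k (map reduce eqs) (subst (ℕ._≤ k) (sym (Listₚ.length-map reduce eqs)) le) lt
  z′ = proj₁ IH
  nz′ = proj₁ (proj₂ IH)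
  rest : (Fin (suc m) → ℚ) → ℚ
  rest c′ = (λ j → c′ (punchIn i j)) · z′
  z : Fin (suc m) → ℚ
  -- Back substitution: with `r` the inverse of `c i`, this entry solves the equation `c`.
  z = VF.insertAt z′ i (- (r * rest c))
  z-punchIn : ∀ j → z (punchIn i j) ≡ z′ j
  z-punchIn j = VFₚ.insertAt-punchIn z′ i _ j
  expand : ∀ c′ → c′ · z ≡ c′ i * (- (r * rest c)) + rest c′
  expand c′ = trans (Σ-remove i (λ e → c′ e * z e)) (cong₂ _+_ (cong (c′ i *_) (VFₚ.insertAt-lookup z′ i _)) (Σ-cong (λ j → cong (c′ (punchIn i j) *_) (z-punchIn j))))
  solves-c : c · z ≡ 0ℚ
  solves-c = trans (expand c) (trans (lem (c i) r (rest c)) (trans (cong (λ q → - (q * rest c) + rest c) rc≡1) (lem′ (rest c))))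
    where
    lem : ∀ c r p → c * (- (r * p)) + p ≡ - (r * c * p) + p
    lem = solve-∀ ℚ-ring
    lem′ : ∀ p → - (1ℚ * p) + p ≡ 0ℚ
    lem′ = solve-∀ ℚ-ring
  solves : ∀ c′ → c′ ∈ eqs → c′ · z ≡ 0ℚ
  solves c′ j = trans (expand c′) (trans (lem (c′ i) r (rest c) (rest c′)) (trans (sym reduced) (proj₂ (proj₂ IH) (reduce c′) (∈-map⁺ reduce j))))
    where
    lem : ∀ c r p q → c * (- (r * p)) + q ≡ q + (- (c * r)) * p
    lem = solve-∀ ℚ-ring
    reduced : reduce c′ · z′ ≡ rest c′ + (- (c′ i * r)) * rest c
    reduced = trans (·-comm (reduce c′) z′) (trans (·-move z′ (λ j → c′ (punchIn i j)) (λ j → c (punchIn i j)) (- (c′ i * r)))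
      (cong₂ (λ p q → p + (- (c′ i * r)) * q) (·-comm z′ _) (·-comm z′ _)))

-- Subsets

∅ : ∀ {n} → Subset n
∅ _ = false

_⊕_ : ∀ {n} → Subset n → Subset n → Subset n
(X ⊕ Y) v = X v xor Y v

_∩_ : ∀ {n} → Subset n → Subset n → Subset n
(X ∩ Y) v = X v ∧ Y v

∁ : ∀ {n} → Subset n → Subset n
∁ X v = not (X v)

subsets : ∀ n → List (Subset n)
subsets zero = ∅ ∷ []
subsets (suc n) = map (VF._∷_ true) (subsets n) ++ map (VF._∷_ false) (subsets n)

-- Subsets are functions, so the enumeration is complete only up to `≗`; a property searched for by
-- `anySubset?` must therefore respect `≗`.
subsets-complete : ∀ {n} (X : Subset n) → ∃ λ Y → Y ∈ subsets n × X ≗ Y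
subsets-complete {zero} X = ∅ , here refl , λ ()
subsets-complete {suc n} X with subsets-complete (X ∘ suc) | X zero in eq
... | Y , i , X≗Y | true = true VF.∷ Y , ∈-++⁺ˡ (∈-map⁺ _ i) , λ { zero → eq ; (suc v) → X≗Y v }
... | Y , i , X≗Y | false = false VF.∷ Y , ∈-++⁺ʳ (map (VF._∷_ true) (subsets n)) (∈-map⁺ _ i) , λ { zero → eq ; (suc v) → X≗Y v }

anySubset? : ∀ {n} {P : Subset n → Set} → (∀ X → Dec (P X)) → (∀ {X Y} → X ≗ Y → P X → P Y) → Dec (∃ P)
anySubset? {n} {P} P? resp = map′ (λ a → let (X , _ , p) = find a in X , p)
  (λ (X , p) → let (Y , i , X≗Y) = subsets-complete X in lose i (resp X≗Y p)) (any? P? (subsets n))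

#_ : ∀ {n} → Subset n → ℕ
# X = Σvℕ (λ v → bit (X v))

Σℕ-mono : ∀ {n} {f g : Fin n → ℕ} → (∀ v → f v ℕ.≤ g v) → Σvℕ f ℕ.≤ Σvℕ g
Σℕ-mono {zero} h = ℕ.z≤n
Σℕ-mono {suc n} h = ℕₚ.+-mono-≤ (h zero) (Σℕ-mono (h ∘ suc))

Σℕ-strict : ∀ {n} {f g : Fin n → ℕ} → (∀ v → f v ℕ.≤ g v) → ∀ v → f v ℕ.< g v → Σvℕ f ℕ.< Σvℕ g
Σℕ-strict h zero lt = ℕₚ.+-mono-<-≤ lt (Σℕ-mono (h ∘ suc))
Σℕ-strict h (suc v) lt = ℕₚ.+-mono-≤-< (h zero) (Σℕ-strict (h ∘ suc) v lt)

bit-mono : ∀ {b c} → (b ≡ true → c ≡ true) → bit b ℕ.≤ bit c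
bit-mono {false} h = ℕ.z≤n
bit-mono {true} {c} h rewrite h refl = ℕₚ.≤-refl

#-strict : ∀ {n} {X Y : Subset n} → (∀ v → X v ≡ true → Y v ≡ true) → ∀ v → X v ≡ false → Y v ≡ true → # X ℕ.< # Y
#-strict h v p q = Σℕ-strict (λ u → bit-mono (h u)) v (subst₂ (λ b c → bit b ℕ.< bit c) (sym p) (sym q) ℕₚ.≤-refl)

-- Graphs and cuts

private module XorSemigroup = CommutativeSemigroupProperties (CommutativeMonoid.commutativeSemigroup (CommutativeRing.+-commutativeMonoid xor-∧-commutativeRing))

xor-interchange : ∀ a b c d → (a xor b) xor (c xor d) ≡ (a xor c) xor (b xor d)
xor-interchange = XorSemigroup.interchange

-- Edges are labels, so loops and parallel edges are allowed, and a contraction changes only the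
-- ends: vectors and sets of edges remain valid as they are.
record Graph (n m : ℕ) : Set where
  constructor graph
  field
    src dst : Fin m → Fin n
open Graph

cross : ∀ {n m} → Graph n m → Subset n → Fin m → Bool
cross G X e = X (src G e) xor X (dst G e)

cut : ∀ {n m} → Graph n m → (Fin m → ℚ) → Subset n → ℚ
cut G y X = (λ e → ind (cross G X e)) · y

cross-cong : ∀ {n m} (G : Graph n m) {X Y} → X ≗ Y → ∀ e → cross G X e ≡ cross G Y e
cross-cong G X≗Y e = cong₂ _xor_ (X≗Y (src G e)) (X≗Y (dst G e))

cut-cong′ : ∀ {n m} (G : Graph n m) y {X Y} → (∀ e → cross G X e ≡ cross G Y e) → cut G y X ≡ cut G y Y
cut-cong′ G y h = Σ-cong (λ e → cong (λ b → ind b * y e) (h e))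

cut-cong : ∀ {n m} (G : Graph n m) y {X Y} → X ≗ Y → cut G y X ≡ cut G y Y
cut-cong G y {X} {Y} X≗Y = cut-cong′ G y {X} {Y} (cross-cong G X≗Y)

cross-⊕ : ∀ {n m} (G : Graph n m) X Y e → cross G (X ⊕ Y) e ≡ cross G X e xor cross G Y e
cross-⊕ G X Y e = xor-interchange (X (src G e)) (Y (src G e)) (X (dst G e)) (Y (dst G e))

cross-∁ : ∀ {n m} (G : Graph n m) X e → cross G (∁ X) e ≡ cross G X e
cross-∁ G X e = xor-annihilates-not (X (src G e)) (X (dst G e))

Uncrossed : ∀ {n m} → Graph n m → (Fin m → Bool) → Subset n → Set
Uncrossed G H X = ∀ e → H e ≡ true → cross G X e ≡ false

uncrossed? : ∀ {n m} (G : Graph n m) H X → Dec (Uncrossed G H X)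
uncrossed? G H X = Finₚ.all? (λ e → (H e 𝔹ₚ.≟ true) →-dec (cross G X e 𝔹ₚ.≟ false))

-- T-joins.  The set T is represented by the functional X ↦ |T ∩ X| mod 2.

record Linear {n} (τ : Subset n → Bool) : Set where
  constructor linear
  field
    resp : ∀ {X Y} → X ≗ Y → τ X ≡ τ Y
    additive : ∀ X Y → τ (X ⊕ Y) ≡ τ X xor τ Y
open Linear

-- On singletons this is the degree condition of a T-join, which by linearity implies it for all
-- `X`. The form with all `X` passes directly to contractions.
IsJoin : ∀ {n m} → Graph n m → (Subset n → Bool) → (Fin m → Bool) → Set
IsJoin G τ J = ∀ X → par (λ e → J e ∧ cross G X e) ≡ τ X

-- The sets uncrossed by `H` are the unions of its components, so the hypothesis is that T meets
-- each component evenly. The induction removes one edge at a time.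
joinExists : ∀ {n} m (G : Graph n m) H τ → Linear τ → (∀ X → Uncrossed G H X → τ X ≡ false) →
  ∃ λ J → (∀ e → J e ≡ true → H e ≡ true) × IsJoin G τ J
joinExists zero G H τ lin h = (λ ()) , (λ ()) , λ X → sym (h X (λ ()))
joinExists {n} (suc m) G H τ lin h = byFirst (H zero) refl
  where
  G′ : Graph n m
  G′ = graph (src G ∘ suc) (dst G ∘ suc)
  extend : ∀ X → Uncrossed G′ (H ∘ suc) X → (H zero ≡ true → cross G X zero ≡ false) → Uncrossed G H X
  extend X u p zero = p
  extend X u p (suc e) = u e
  omit : (∀ X → Uncrossed G′ (H ∘ suc) X → τ X ≡ false) → ∃ λ J → (∀ e → J e ≡ true → H e ≡ true) × IsJoin G τ J
  omit h′ with joinExists m G′ (H ∘ suc) τ lin h′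
  ... | J , J≤H , isJoin = (false VF.∷ J) , (λ { zero () ; (suc e) → J≤H e }) , isJoin
  -- The first edge must be used if the others leave a τ-odd set X₀ uncrossed; then X₀ ⊕ X shows that
  -- after switching the parity at its ends no further odd set is uncrossed.
  byFirst : ∀ b → H zero ≡ b → ∃ λ J → (∀ e → J e ≡ true → H e ≡ true) × IsJoin G τ J
  byFirst false H₀ = omit (λ X u → h X (extend X u (λ eq → ⊥-elim (true≢false (trans (sym eq) H₀)))))
  byFirst true H₀ with anySubset? {P = λ X → τ X ≡ true × Uncrossed G′ (H ∘ suc) X}
      (λ X → (τ X 𝔹ₚ.≟ true) ×-dec uncrossed? G′ (H ∘ suc) X)
      (λ X≗Y (p , u) → trans (sym (resp lin X≗Y)) p , λ e He → trans (sym (cross-cong G′ X≗Y e)) (u e He))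
  ... | no none = omit (λ X u → ¬-not (λ τX → none (X , τX , u)))
  ... | yes (X₀ , odd₀ , u₀) with joinExists m G′ (H ∘ suc) τ′ lin′ h′
    where
    τ′ : Subset n → Bool
    τ′ X = cross G X zero xor τ X
    lin′ : Linear τ′
    lin′ = linear (λ X≗Y → cong₂ _xor_ (cross-cong G X≗Y zero) (resp lin X≗Y))
      (λ X Y → trans (cong₂ _xor_ (cross-⊕ G X Y zero) (additive lin X Y)) (xor-interchange (cross G X zero) (cross G Y zero) (τ X) (τ Y)))
    c₀ : cross G X₀ zero ≡ true
    c₀ = ¬-not (λ c → true≢false (trans (sym odd₀) (h X₀ (extend X₀ u₀ (λ _ → c)))))
    h′ : ∀ X → Uncrossed G′ (H ∘ suc) X → τ′ X ≡ false
    h′ X u with cross G X zero in eq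
    ... | false = h X (extend X u (λ _ → eq))
    ... | true = trans (cong (λ b → b xor τ X) (sym odd₀)) (trans (sym (additive lin X₀ X)) (h (X₀ ⊕ X)
          (extend (X₀ ⊕ X) (λ e He → trans (cross-⊕ G′ X₀ X e) (cong₂ _xor_ (u₀ e He) (u e He))) (λ _ → trans (cross-⊕ G X₀ X zero) (cong₂ _xor_ c₀ eq)))))
  ...   | J , J≤H , isJoin = (true VF.∷ J) , (λ { zero _ → H₀ ; (suc e) → J≤H e }) ,
          λ X → trans (cong (cross G X zero xor_) (isJoin X)) (cancel (cross G X zero) (τ X))
    where
    cancel : ∀ a b → a xor (a xor b) ≡ b
    cancel true b = not-involutive b
    cancel false b = refl

Σ-two : ∀ {m} {f : Fin m → ℚ} → (∀ e → 0ℚ ≤ f e) → ∀ {e e′} → e ≢ e′ → f e + f e′ ≤ Σv f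
Σ-two {f = f} f≥0 {e} {e′} e≢e′ = subst (_≤ Σv f)
  (trans (Σ-+ (λ g → unit e g * f g) (λ g → unit e′ g * f g)) (cong₂ _+_ (Σ-single e f) (Σ-single e′ f))) (Σ-mono pointwise)
  where
  pointwise : ∀ g → unit e g * f g + unit e′ g * f g ≤ f g
  pointwise g with g ≟ e | g ≟ e′
  ... | yes refl | yes refl = ⊥-elim (e≢e′ refl)
  ... | yes _ | no _ = ≤-reflexive (lem (f g))
    where
    lem : ∀ p → 1ℚ * p + 0ℚ * p ≡ p
    lem = solve-∀ ℚ-ring
  ... | no _ | yes _ = ≤-reflexive (lem (f g))
    where
    lem : ∀ p → 0ℚ * p + 1ℚ * p ≡ p
    lem = solve-∀ ℚ-ring
  ... | no _ | no _ = ≤-by (f g) (f≥0 g) (lem (f g))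
    where
    lem : ∀ p → p ≡ 0ℚ * p + 0ℚ * p + p
    lem = solve-∀ ℚ-ring

mapDist : ∀ {A B : Set} → (A → B) → Dist A → Dist B
mapDist g [] = []
mapDist g (atom w w>0 a ∷ L) = atom w w>0 (g a) ∷ mapDist g L

𝔼-map : ∀ {A B : Set} (g : A → B) (L : Dist A) f → 𝔼 (mapDist g L) f ≡ 𝔼 L (f ∘ g)
𝔼-map g [] f = refl
𝔼-map g (atom w _ a ∷ L) f = cong (w * f (g a) +_) (𝔼-map g L f)

Dom-map : ∀ {m} {P Q : (Fin m → Bool) → Set} {y} → (∀ J → P J → Q J) → Dom P y → Dom Q y
Dom-map h (dom L t b) = dom (mapDist (λ (J , p) → J , h J p) L) (trans (𝔼-map _ L _) t) (λ e → subst (_≤ _) (sym (𝔼-map _ L _)) (b e))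

-- Gluing along a tight odd cut

module Glue {n m} (G : Graph n m) (τ : Subset n → Bool) (lin : Linear τ) (y : Fin m → ℚ) (y≥0 : ∀ e → 0ℚ ≤ y e)
  (X₀ : Subset n) (tight : cut G y X₀ ≡ 1ℚ) (odd : τ X₀ ≡ true) (odd∁ : τ (∁ X₀) ≡ true) where

  private
    χ : Fin m → ℚ
    χ e = ind (cross G X₀ e)

    χ≥0 : ∀ e → 0ℚ ≤ χ e
    χ≥0 e = ind≥0 (cross G X₀ e)

    -- The inverse of `y`, with default 0 where `y` vanishes; hence `μ` is the indicator of the
    -- support of `y`.
    r : Fin m → ℚ
    r e with 0ℚ <? y e
    ... | yes p = proj₁ (inverse⁺ p)
    ... | no _ = 0ℚ

    μ : Fin m → ℚ
    μ e = r e * y e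

    r≥0 : ∀ e → 0ℚ ≤ r e
    r≥0 e with 0ℚ <? y e
    ... | yes p = <⇒≤ (proj₁ (proj₂ (inverse⁺ p)))
    ... | no _ = ≤-refl

    μ≤1 : ∀ e → μ e ≤ 1ℚ
    μ≤1 e with 0ℚ <? y e
    ... | yes p = ≤-reflexive (proj₂ (proj₂ (inverse⁺ p)))
    ... | no _ = subst (_≤ 1ℚ) (sym (*-zeroˡ (y e))) 0≤1

    μ*y : ∀ e → μ e * y e ≡ y e
    μ*y e with 0ℚ <? y e
    ... | yes p = trans (cong (_* y e) (proj₂ (proj₂ (inverse⁺ p)))) (*-identityˡ (y e))
    ... | no p = trans (cong (λ q → 0ℚ * q * q) (≤-antisym (≮⇒≥ p) (y≥0 e))) (sym (≤-antisym (≮⇒≥ p) (y≥0 e)))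

    χJ : (Fin m → Bool) → Fin m → ℚ
    χJ J e = χ e * ind (J e)

    χJ≥0 : ∀ J e → 0ℚ ≤ χJ J e
    χJ≥0 J e = *-nonneg (χ≥0 e) (ind≥0 (J e))

    size : (Fin m → Bool) → ℚ
    size J = Σv (χJ J)

    -- The second equation places the single crossing edge of `J` in the support of `y`, so that the
    -- coupling may divide by its value.
    Thin : (Fin m → Bool) → Set
    Thin J = size J ≡ 1ℚ × μ · χJ J ≡ 1ℚ

    χJ-one : ∀ J e → cross G X₀ e ≡ true → J e ≡ true → χJ J e ≡ 1ℚ
    χJ-one J e p q = cong₂ (λ b c → ind b * ind c) p q

    Thin-unique : ∀ {J} → Thin J → ∀ {e e′} → cross G X₀ e ≡ true → J e ≡ true → cross G X₀ e′ ≡ true → J e′ ≡ true → e ≡ e′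
    Thin-unique {J} (one , _) {e} {e′} p q p′ q′ with e ≟ e′
    ... | yes eq = eq
    ... | no e≢e′ = ⊥-elim (<-irrefl refl (<-≤-trans (<-by 1ℚ 0<1 refl)
            (subst₂ _≤_ (cong₂ _+_ (χJ-one J e p q) (χJ-one J e′ p′ q′)) one (Σ-two (χJ≥0 J) e≢e′))))

  -- Since J meets δ(X₀) at least once and y(δ(X₀)) = 1, every J in the distribution meets it exactly once;
  -- the factor 2 - μ in g also excludes the edges with y = 0.
  module Thinning {P : (Fin m → Bool) → Set} (oddly : ∀ J → P J → par (λ e → J e ∧ cross G X₀ e) ≡ true) (D : Dom P y) where
    open Dom D renaming (dist to L)

    private
      g : Σ (Fin m → Bool) P → ℚ
      g (J , _) = Σv (λ e → χJ J e + (1ℚ - μ e) * χJ J e)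

      split-g : ∀ Jp → g Jp ≡ size (proj₁ Jp) + Σv (λ e → (1ℚ - μ e) * χJ (proj₁ Jp) e)
      split-g (J , _) = Σ-+ (χJ J) (λ e → (1ℚ - μ e) * χJ J e)

      extra≥0 : ∀ J → 0ℚ ≤ Σv (λ e → (1ℚ - μ e) * χJ J e)
      extra≥0 J = Σ-nonneg (λ e → *-nonneg (diff≥0 (μ≤1 e)) (χJ≥0 J e))

      size≥1 : ∀ Jp → 1ℚ ≤ size (proj₁ Jp)
      size≥1 (J , p) with par-true⇒∃ _ (oddly J p)
      ... | e , q = subst (_≤ size J) (χJ-one J e (∧-conicalʳ (J e) _ q) (∧-conicalˡ (J e) _ q)) (Σ-term (χJ≥0 J) e)

      g≥size : ∀ Jp → size (proj₁ Jp) ≤ g Jp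
      g≥size Jp = ≤-by _ (extra≥0 (proj₁ Jp)) (split-g Jp)

      marg : Fin m → ℚ
      marg e = 𝔼 L (λ J → ind (proj₁ J e))

      -- On the cut the factor 2 - μ does not increase the bound: (2 - μ) y = y because (1 - μ) y =
      -- 0, and y sums to 1 there.
      𝔼g≤1 : 𝔼 L g ≤ 1ℚ
      𝔼g≤1 = subst₂ _≤_ (sym (trans (𝔼-Σ L (λ Jp e → χJ (proj₁ Jp) e + (1ℚ - μ e) * χJ (proj₁ Jp) e)) (Σ-cong (λ e → trans (𝔼-cong L (λ J → lem (χ e) (μ e) (ind (proj₁ J e)))) (𝔼-*ˡ L (χ e * (1ℚ + (1ℚ - μ e))) _))))) tight
        (Σ-mono bound)
        where
        lem : ∀ x m j → x * j + (1ℚ - m) * (x * j) ≡ x * (1ℚ + (1ℚ - m)) * j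
        lem = solve-∀ ℚ-ring
        lem′ : ∀ x m y → x * (1ℚ + (1ℚ - m)) * y ≡ x * (y + (y - m * y))
        lem′ = solve-∀ ℚ-ring
        lem″ : ∀ x y → x * (y + (y - y)) ≡ x * y
        lem″ = solve-∀ ℚ-ring
        bound : ∀ e → χ e * (1ℚ + (1ℚ - μ e)) * marg e ≤ χ e * y e
        bound e = subst (χ e * (1ℚ + (1ℚ - μ e)) * marg e ≤_)
          (trans (lem′ (χ e) (μ e) (y e)) (trans (cong (λ q → χ e * (y e + (y e - q))) (μ*y e)) (lem″ (χ e) (y e))))
          (*-mono _ (*-nonneg (χ≥0 e) (+-nonneg 0≤1 (diff≥0 (μ≤1 e)))) (below e))

      refined = refine L g (λ Jp → ≤-trans (size≥1 Jp) (g≥size Jp)) (subst (𝔼 L g ≤_) (sym total) 𝔼g≤1)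

      thin : ∀ Jp → g Jp ≡ 1ℚ → Thin (proj₁ Jp)
      thin Jp@(J , _) g≡1 = size≡1 , trans (lem (μ · χJ J) (size J) (g Jp) split) (cong₂ (λ p q → p + (p - q)) size≡1 g≡1)
        where
        size≡1 : size J ≡ 1ℚ
        size≡1 = ≤-antisym (subst (size J ≤_) g≡1 (g≥size Jp)) (size≥1 Jp)
        split : g Jp + μ · χJ J ≡ size J + size J
        split = trans (sym (Σ-+ _ (λ e → μ e * χJ J e))) (trans (Σ-cong (λ e → lem (χJ J e) (μ e))) (Σ-+ (χJ J) (χJ J)))
          where
          lem : ∀ x m → x + (1ℚ - m) * x + m * x ≡ x + x
          lem = solve-∀ ℚ-ring
        lem : ∀ p s g → g + p ≡ s + s → p ≡ s + (s - g)
        lem p s g eq = trans (lem₁ p g) (trans (cong (_- g) eq) (lem₂ s g))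
          where
          lem₁ : ∀ p g → p ≡ g + p - g
          lem₁ = solve-∀ ℚ-ring
          lem₂ : ∀ s g → s + s - g ≡ s + (s - g)
          lem₂ = solve-∀ ℚ-ring

    Thinned : Set
    Thinned = Σ (Fin m → Bool) (λ J → P J × Thin J)

    L′ : Dist Thinned
    L′ = mapDist (λ ((J , p) , q) → J , p , thin (J , p) q) (proj₁ refined)

    𝔼′ : ∀ (f : (Fin m → Bool) → ℚ) → 𝔼 L′ (f ∘ proj₁) ≡ 𝔼 L (f ∘ proj₁)
    𝔼′ f = trans (𝔼-map _ (proj₁ refined) _) (proj₂ refined (f ∘ proj₁))

    total′ : 𝔼 L′ (λ _ → 1ℚ) ≡ 1ℚ
    total′ = trans (𝔼′ (λ _ → 1ℚ)) total

    below′ : ∀ e → 𝔼 L′ (λ J → ind (proj₁ J e)) ≤ y e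
    below′ e = subst (_≤ y e) (sym (𝔼′ (λ J → ind (J e)))) (below e)

    -- Edge by edge the left side is at most the right side. Summed over the cut, the left side is
    -- the mean number of crossings, at least 1, and the right side is 1; so equality holds
    -- everywhere.
    exact : ∀ e → χ e * 𝔼 L′ (λ J → ind (proj₁ J e)) ≡ χ e * y e
    exact e = trans (cong (χ e *_) (𝔼′ (λ J → ind (J e)))) (Σ-tight {f = λ e → χ e * marg e} {g = λ e → χ e * y e} (λ e → *-mono (χ e) (χ≥0 e) (below e))
      (subst₂ _≤_ (trans total (sym tight)) (trans (𝔼-Σ L (λ Jp → χJ (proj₁ Jp))) (Σ-cong (λ e → 𝔼-*ˡ L (χ e) (λ J → ind (proj₁ J e))))) (𝔼-mono L size≥1)) e)

  -- The condition for a T-join of the graph with `X` contracted, tested on the sets that avoid the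
  -- contracted vertex. Expressed in `G` itself, it puts both sides of the cut on the same edges.
  Off : Subset n → (Fin m → Bool) → Set
  Off X J = ∀ Z → (∀ v → X v ≡ true → Z v ≡ false) → par (λ e → J e ∧ cross G Z e) ≡ τ Z

  private
    inside : Fin m → Bool
    inside e = X₀ (src G e) ∧ X₀ (dst G e)

    mixture : (Fin m → Bool) → (Fin m → Bool) → Fin m → Bool
    mixture J₁ J₂ e = if inside e then J₂ e else J₁ e

    -- A test set splits into its parts outside and inside `X₀`. An edge within `X₀` does not cross
    -- the outer part. An edge crossing the inner part lies within `X₀` or in the cut, where the two
    -- joins agree.
    glue-isJoin : ∀ {J₁ J₂} → Off X₀ J₁ → Off (∁ X₀) J₂ → (∀ e → cross G X₀ e ≡ true → J₁ e ≡ J₂ e) → IsJoin G τ (mixture J₁ J₂)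
    glue-isJoin {J₁} {J₂} off₁ off₂ agree Z = begin
      par (λ e → J e ∧ cross G Z e) ≡⟨ par-cong (λ e → trans (cong (J e ∧_) (trans (cross-cong G Z≗ e) (cross-⊕ G Zo Zi e))) (∧-distribˡ-xor (J e) _ _)) ⟩
      par (λ e → (J e ∧ cross G Zo e) xor (J e ∧ cross G Zi e)) ≡⟨ par-xor _ (λ e → J e ∧ cross G Zi e) ⟩
      par (λ e → J e ∧ cross G Zo e) xor par (λ e → J e ∧ cross G Zi e) ≡⟨ cong₂ _xor_ (par-cong outer) (par-cong inner) ⟩
      par (λ e → J₁ e ∧ cross G Zo e) xor par (λ e → J₂ e ∧ cross G Zi e)
        ≡⟨ cong₂ _xor_ (off₁ Zo (λ v q → trans (cong (λ b → Z v ∧ not b) q) (∧-zeroʳ (Z v)))) (off₂ Zi (λ v q → trans (cong (Z v ∧_) (not-injective q)) (∧-zeroʳ (Z v)))) ⟩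
      τ Zo xor τ Zi ≡⟨ additive lin Zo Zi ⟨
      τ (Zo ⊕ Zi) ≡⟨ resp lin Z≗ ⟨
      τ Z ∎
      where
      open ≡-Reasoning
      J = mixture J₁ J₂
      Zo = Z ∩ ∁ X₀
      Zi = Z ∩ X₀
      Z≗ : Z ≗ (Zo ⊕ Zi)
      Z≗ v = lem (Z v) (X₀ v)
        where
        lem : ∀ z x → z ≡ (z ∧ not x) xor (z ∧ x)
        lem true true = refl
        lem true false = refl
        lem false x = refl
      outer : ∀ e → J e ∧ cross G Zo e ≡ J₁ e ∧ cross G Zo e
      outer e = lem (X₀ (src G e)) (X₀ (dst G e)) (Z (src G e)) (Z (dst G e)) (J₁ e) (J₂ e)
        where
        lem : ∀ p q z w j k → (if p ∧ q then k else j) ∧ ((z ∧ not p) xor (w ∧ not q)) ≡ j ∧ ((z ∧ not p) xor (w ∧ not q))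
        lem true true z w j k = trans (trans (cong (k ∧_) lem′) (∧-zeroʳ k)) (sym (trans (cong (j ∧_) lem′) (∧-zeroʳ j)))
          where
          lem′ : (z ∧ false) xor (w ∧ false) ≡ false
          lem′ = cong₂ _xor_ (∧-zeroʳ z) (∧-zeroʳ w)
        lem true false z w j k = refl
        lem false q z w j k = refl
      inner : ∀ e → J e ∧ cross G Zi e ≡ J₂ e ∧ cross G Zi e
      inner e = lem (X₀ (src G e)) (X₀ (dst G e)) (Z (src G e)) (Z (dst G e)) (J₁ e) (J₂ e) (agree e)
        where
        lem : ∀ p q z w j k → (p xor q ≡ true → j ≡ k) → (if p ∧ q then k else j) ∧ ((z ∧ p) xor (w ∧ q)) ≡ k ∧ ((z ∧ p) xor (w ∧ q))
        lem true true z w j k h = refl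
        lem true false z w j k h = cong (_∧ _) (h refl)
        lem false true z w j k h = cong (_∧ _) (h refl)
        lem false false z w j k h = trans (trans (cong (j ∧_) lem′) (∧-zeroʳ j)) (sym (trans (cong (k ∧_) lem′) (∧-zeroʳ k)))
          where
          lem′ : (z ∧ false) xor (w ∧ false) ≡ false
          lem′ = cong₂ _xor_ (∧-zeroʳ z) (∧-zeroʳ w)

  -- The two sides are made independent given the common cut edge: `κ` is 1/y(e) if both joins cross
  -- at e, and 0 if they cross at different edges. Its averages are 1 because either side uses e
  -- with probability exactly y(e).
  glue : Dom (Off X₀) y → Dom (Off (∁ X₀)) y → Dom (IsJoin G τ) y
  glue D₁ D₂ = dom joint (trans (𝔼-coupleˡ L₁ L₂ κ κ≥0 margˡ margʳ glued _ (λ _ → 1ℚ) (λ _ _ _ → refl)) T₁.total′) (λ e → jointBelow e (inside e) refl)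
    where
    module T₁ = Thinning (λ J off → trans (par-cong (λ e → cong (J e ∧_) (sym (cross-∁ G X₀ e)))) (trans (off (∁ X₀) (λ v q → cong not q)) odd∁)) D₁
    module T₂ = Thinning (λ J off → trans (off X₀ (λ v q → not-injective q)) odd) D₂
    L₁ = T₁.L′
    L₂ = T₂.L′
    κterm : T₁.Thinned → T₂.Thinned → Fin m → ℚ
    κterm (J₁ , _) (J₂ , _) e = r e * (χJ J₁ e * ind (J₂ e))
    κterm≥0 : ∀ a b e → 0ℚ ≤ κterm a b e
    κterm≥0 (J₁ , _) (J₂ , _) e = *-nonneg (r≥0 e) (*-nonneg (χJ≥0 J₁ e) (ind≥0 (J₂ e)))
    κ : T₁.Thinned → T₂.Thinned → ℚ
    κ a b = Σv (κterm a b)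
    κ≥0 : ∀ a b → 0ℚ ≤ κ a b
    κ≥0 a b = Σ-nonneg (κterm≥0 a b)
    margˡ : ∀ a → 𝔼 L₂ (κ a) ≡ 1ℚ
    margˡ a@(J₁ , _ , _ , thin) = trans (𝔼-Σ L₂ (κterm a)) (trans (Σ-cong (λ e → trans (𝔼-cong L₂ (λ b → lem (r e) (χ e) (ind (J₁ e)) (ind (proj₁ b e))))
      (trans (𝔼-*ˡ L₂ (r e * ind (J₁ e)) _) (trans (cong (r e * ind (J₁ e) *_) (trans (𝔼-*ˡ L₂ (χ e) _) (T₂.exact e))) (lem′ (r e) (χ e) (ind (J₁ e)) (y e)))))) thin)
      where
      lem : ∀ r x j k → r * (x * j * k) ≡ r * j * (x * k)
      lem = solve-∀ ℚ-ring
      lem′ : ∀ r x j y → r * j * (x * y) ≡ r * y * (x * j)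
      lem′ = solve-∀ ℚ-ring
    margʳ : ∀ b → 𝔼 L₁ (λ a → κ a b) ≡ 1ℚ
    margʳ b@(J₂ , _ , _ , thin) = trans (𝔼-Σ L₁ (λ a → κterm a b)) (trans (Σ-cong (λ e → trans (𝔼-cong L₁ (λ a → lem (r e) (χ e) (ind (proj₁ a e)) (ind (J₂ e))))
      (trans (𝔼-*ˡ L₁ (r e * ind (J₂ e)) _) (trans (cong (r e * ind (J₂ e) *_) (trans (𝔼-*ˡ L₁ (χ e) _) (T₁.exact e))) (lem′ (r e) (χ e) (ind (J₂ e)) (y e)))))) thin)
      where
      lem : ∀ r x j k → r * (x * j * k) ≡ r * k * (x * j)
      lem = solve-∀ ℚ-ring
      lem′ : ∀ r x j y → r * j * (x * y) ≡ r * y * (x * j)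
      lem′ = solve-∀ ℚ-ring
    shared : ∀ a b → 0ℚ < κ a b → ∃ λ e → cross G X₀ e ≡ true × proj₁ a e ≡ true × proj₁ b e ≡ true
    shared a@(J₁ , _) b@(J₂ , _) p with Σ-pos⇒∃ (κterm≥0 a b) p
    ... | e , q = e , allTrue (cross G X₀ e) (J₁ e) (J₂ e) q
      where
      allTrue : ∀ c j k → 0ℚ < r e * (ind c * ind j * ind k) → c ≡ true × j ≡ true × k ≡ true
      allTrue true true true _ = refl , refl , refl
      allTrue true true false p = ⊥-elim (0<⇒≢0 p (*-zeroʳ (r e)))
      allTrue true false k p = ⊥-elim (0<⇒≢0 p (trans (cong (r e *_) (*-zeroˡ (ind k))) (*-zeroʳ (r e))))
      allTrue false j k p = ⊥-elim (0<⇒≢0 p (lem (r e) (ind j) (ind k)))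
        where
        lem : ∀ r j k → r * (0ℚ * j * k) ≡ 0ℚ
        lem = solve-∀ ℚ-ring
    glued : ∀ a b → 0ℚ < κ a b → Σ (Fin m → Bool) (IsJoin G τ)
    glued a@(J₁ , off₁ , thin₁) b@(J₂ , off₂ , thin₂) p = mixture J₁ J₂ , glue-isJoin off₁ off₂ agree
      where
      agree : ∀ e → cross G X₀ e ≡ true → J₁ e ≡ J₂ e
      agree e c with shared a b p
      ... | e₀ , c₀ , j₁ , j₂ with J₁ e in eq₁ | J₂ e in eq₂
      ...   | true | true = refl
      ...   | false | false = refl
      ...   | true | false = trans (sym j₂) (trans (cong J₂ (Thin-unique {J₁} thin₁ c₀ j₁ c eq₁)) eq₂)
      ...   | false | true = trans (sym eq₁) (trans (cong J₁ (Thin-unique {J₂} thin₂ c eq₂ c₀ j₂)) j₁)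
    joint = couple L₁ L₂ κ κ≥0 margˡ margʳ glued
    jointBelow : ∀ e b → inside e ≡ b → 𝔼 joint (λ J → ind (proj₁ J e)) ≤ y e
    jointBelow e true eq = subst (_≤ y e) (sym (𝔼-coupleʳ L₁ L₂ κ κ≥0 margˡ margʳ glued _ (λ b → ind (proj₁ b e))
      (λ a b _ → cong (λ c → ind (if c then proj₁ b e else proj₁ a e)) eq))) (T₂.below′ e)
    jointBelow e false eq = subst (_≤ y e) (sym (𝔼-coupleˡ L₁ L₂ κ κ≥0 margˡ margʳ glued _ (λ a → ind (proj₁ a e))
      (λ a b _ → cong (λ c → ind (if c then proj₁ b e else proj₁ a e)) eq))) (T₁.below′ e)

-- Counting

private module ℕS = SemiringSum ℕₚ.+-*-semiring

select : ∀ {n} → Subset n → List (Fin n)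
select {zero} P = []
select {suc n} P = if P zero then zero ∷ map suc (select (P ∘ suc)) else map suc (select (P ∘ suc))

length-select : ∀ {n} (P : Subset n) → length (select P) ≡ # P
length-select {zero} P = refl
length-select {suc n} P with P zero
... | true = cong suc (trans (Listₚ.length-map suc (select (P ∘ suc))) (length-select (P ∘ suc)))
... | false = trans (Listₚ.length-map suc (select (P ∘ suc))) (length-select (P ∘ suc))

∈-select : ∀ {n} (P : Subset n) v → P v ≡ true → v ∈ select P
∈-select {suc n} P zero p rewrite p = here refl
∈-select {suc n} P (suc v) p with P zero
... | true = there (∈-map⁺ suc (∈-select (P ∘ suc) v p))
... | false = ∈-map⁺ suc (∈-select (P ∘ suc) v p)

#-∁ : ∀ {n} (P : Subset n) → # (∁ P) ℕ.+ # P ≡ n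
#-∁ {zero} P = refl
#-∁ {suc n} P with P zero
... | true = trans (ℕₚ.+-suc _ _) (cong suc (#-∁ (P ∘ suc)))
... | false = cong suc (#-∁ (P ∘ suc))

Σℕ-tight : ∀ {n} {f g : Fin n → ℕ} → (∀ v → g v ℕ.≤ f v) → Σvℕ f ℕ.≤ Σvℕ g → ∀ v → f v ≡ g v
Σℕ-tight {n} {f} {g} h le v with f v ℕ.≤? g v
... | yes p = ℕₚ.≤-antisym p (h v)
... | no p = ⊥-elim (ℕₚ.<-irrefl refl (ℕₚ.<-≤-trans (Σℕ-strict h v (ℕₚ.≰⇒> p)) le))

#-singleton : ∀ {n} (u : Fin n) → Σvℕ (λ v → bit (singleton v u)) ≡ 1
#-singleton {suc n} zero = cong suc (ℕS.sum-replicate-zero n)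
#-singleton {suc n} (suc u) = trans (ℕS.sum-cong-≗ (λ v → cong bit (==-suc v u))) (#-singleton u)

∃-bit : ∀ {n} (P : Subset n) → # P ≢ 0 → ∃ λ v → P v ≡ true
∃-bit {zero} P h = ⊥-elim (h refl)
∃-bit {suc n} P h with P zero in eq
... | true = zero , eq
... | false with ∃-bit (P ∘ suc) h
...   | v , p = suc v , p

#≡0⇒false : ∀ {n} (P : Subset n) → # P ≡ 0 → ∀ v → P v ≡ false
#≡0⇒false {suc n} P eq v with P zero in p
#≡0⇒false {suc n} P eq zero | false = p
#≡0⇒false {suc n} P eq (suc v) | false = #≡0⇒false (P ∘ suc) eq v

#≥1 : ∀ {n} (P : Subset n) v → P v ≡ true → 1 ℕ.≤ # P
#≥1 {suc n} P zero p rewrite p = ℕ.s≤s ℕ.z≤n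
#≥1 {suc n} P (suc v) p = ℕₚ.≤-trans (#≥1 (P ∘ suc) v p) (ℕₚ.m≤n+m _ (bit (P zero)))

#≥2 : ∀ {n} (P : Subset n) {u v} → u ≢ v → P u ≡ true → P v ≡ true → 2 ℕ.≤ # P
#≥2 P {zero} {zero} u≢v p q = ⊥-elim (u≢v refl)
#≥2 P {zero} {suc v} u≢v p q rewrite p = ℕ.s≤s (#≥1 (P ∘ suc) v q)
#≥2 P {suc u} {zero} u≢v p q rewrite q = ℕ.s≤s (#≥1 (P ∘ suc) u p)
#≥2 P {suc u} {suc v} u≢v p q = ℕₚ.≤-trans (#≥2 (P ∘ suc) (u≢v ∘ cong suc) p q) (ℕₚ.m≤n+m _ (bit (P zero)))

oddℕ : ℕ → Bool
oddℕ zero = false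
oddℕ (suc k) = not (oddℕ k)

oddℕ-# : ∀ {n} (P : Subset n) → oddℕ (# P) ≡ par P
oddℕ-# {zero} P = refl
oddℕ-# {suc n} P with P zero
... | true = cong not (oddℕ-# (P ∘ suc))
... | false = oddℕ-# (P ∘ suc)

toℚ : ℕ → ℚ
toℚ zero = 0ℚ
toℚ (suc k) = 1ℚ + toℚ k

Σ-ind : ∀ {n} (P : Subset n) → Σv (λ v → ind (P v)) ≡ toℚ (# P)
Σ-ind {zero} P = refl
Σ-ind {suc n} P with P zero
... | true = cong (1ℚ +_) (Σ-ind (P ∘ suc))
... | false = trans (+-identityˡ _) (Σ-ind (P ∘ suc))

Two : ∀ {n} → Subset n → Set
Two B = ∃ λ u → ∃ λ v → u ≢ v × B u ≡ true × B v ≡ true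

two? : ∀ {n} (B : Subset n) → Dec (Two B)
two? B = Finₚ.any? (λ u → Finₚ.any? (λ v → ¬? (u ≟ v) ×-dec ((B u 𝔹ₚ.≟ true) ×-dec (B v 𝔹ₚ.≟ true))))

Two-cong : ∀ {n} {B C : Subset n} → B ≗ C → Two B → Two C
Two-cong B≗C (u , v , u≢v , p , q) = u , v , u≢v , trans (sym (B≗C u)) p , trans (sym (B≗C v)) q

-- Contraction

NonTrivial : ∀ {n} → Subset n → Subset n → Set
NonTrivial A X = Two (A ∩ X) × Two (A ∩ ∁ X)

-- Contraction keeps the vertex type: `X` is merged into `u`, and its other vertices stay behind
-- without edges, outside the active set `survivors`.
collapse : ∀ {n} → Subset n → Fin n → Fin n → Fin n
collapse X u v = if X v then u else v

contract : ∀ {n m} → Graph n m → Subset n → Fin n → Graph n m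
contract G X u = graph (collapse X u ∘ src G) (collapse X u ∘ dst G)

survivors : ∀ {n} → Subset n → Subset n → Fin n → Subset n
survivors A X u v = A v ∧ (not (X v) ∨ singleton u v)

collapse-survives : ∀ {n} (A X : Subset n) {u} → A u ≡ true → ∀ v → A v ≡ true → survivors A X u (collapse X u v) ≡ true
collapse-survives A X {u} Au v Av with X v in eq
... | true = cong₂ _∧_ Au (trans (cong (not (X u) ∨_) (==-refl u)) (∨-zeroʳ (not (X u))))
... | false = cong₂ _∧_ Av (cong (λ b → not b ∨ singleton u v) eq)

survivors-⊆ : ∀ {n} (A X : Subset n) u v → survivors A X u v ≡ true → A v ≡ true
survivors-⊆ A X u v = ∧-conicalˡ (A v) _

survivors-< : ∀ {n} (A X : Subset n) {u} → Two (A ∩ X) → # survivors A X u ℕ.< # A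
survivors-< A X {u} (v , w , v≢w , p , q) with v ≟ u
... | yes refl = #-strict (survivors-⊆ A X u) w (trans (cong₂ (λ b c → A w ∧ (not b ∨ c)) (∧-conicalʳ (A w) _ q) (==-≢ (v≢w ∘ sym))) (∧-zeroʳ (A w))) (∧-conicalˡ (A w) _ q)
... | no v≢u = #-strict (survivors-⊆ A X u) v (trans (cong₂ (λ b c → A v ∧ (not b ∨ c)) (∧-conicalʳ (A v) _ p) (==-≢ v≢u)) (∧-zeroʳ (A v))) (∧-conicalˡ (A v) _ p)

EndsIn : ∀ {n m} → Graph n m → Subset n → Set
EndsIn G A = ∀ e → A (src G e) ≡ true × A (dst G e) ≡ true

contract-endsIn : ∀ {n m} (G : Graph n m) A X {u} → A u ≡ true → EndsIn G A → EndsIn (contract G X u) (survivors A X u)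
contract-endsIn G A X Au ends e = collapse-survives A X Au (src G e) (proj₁ (ends e)) , collapse-survives A X Au (dst G e) (proj₂ (ends e))

DependsOn : ∀ {n} → (Subset n → Bool) → Subset n → Set
DependsOn {n} τ A = ∀ X Y → (∀ v → A v ≡ true → X v ≡ Y v) → τ X ≡ τ Y

-- The dominant of the T-join polytope

full : ∀ {n} → Subset n
full _ = true

module JoinStep {n m} (G : Graph n m) (A : Subset n) (τ : Subset n → Bool) (lin : Linear τ)
  (ends : EndsIn G A) (dep : DependsOn τ A) (τ-full : τ full ≡ false) where

  edgeRow : Fin m → Row m
  edgeRow e = row (unit e) 0ℚ

  -- Even sets receive the void inequality 0 ≥ 0, so that rows can be indexed by all subsets.
  cutRow : Subset n → Row m
  cutRow X = if τ X then row (λ e → ind (cross G X e)) 1ℚ else row (λ _ → 0ℚ) 0ℚ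

  rows : List (Row m)
  rows = map edgeRow (allFin m) ++ map cutRow (subsets n)

  edgeRow∈ : ∀ e → edgeRow e ∈ rows
  edgeRow∈ e = ∈-++⁺ˡ (∈-map⁺ edgeRow (∈-allFin e))

  rows-elim : (Q : Row m → Set) → (∀ e → Q (edgeRow e)) → (∀ X → Q (cutRow X)) → ∀ r → r ∈ rows → Q r
  rows-elim Q qe qc r i with ∈-++⁻ (map edgeRow (allFin m)) i
  ... | inj₁ j with ∈-map⁻ edgeRow j
  ...   | e , _ , refl = qe e
  rows-elim Q qe qc r i | inj₂ j with ∈-map⁻ cutRow j
  ...   | X , _ , refl = qc X

  cutRow-elim : ∀ X (Q : Row m → Set) → Q (row (λ _ → 0ℚ) 0ℚ) → (τ X ≡ true → Q (row (λ e → ind (cross G X e)) 1ℚ)) → Q (cutRow X)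
  cutRow-elim X Q q₀ q₁ with τ X
  ... | true = q₁ refl
  ... | false = q₀

  slack-edgeRow : ∀ e y → slack (edgeRow e) y ≡ y e
  slack-edgeRow e y = trans (cong (_- 0ℚ) (unit-· e y)) (lem (y e))
    where
    lem : ∀ p → p - 0ℚ ≡ p
    lem = solve-∀ ℚ-ring

  toFeasible : ∀ y → (∀ e → 0ℚ ≤ y e) → (∀ X → τ X ≡ true → 1ℚ ≤ cut G y X) → Feasible rows y
  toFeasible y y≥0 cuts = rows-elim (λ r → 0ℚ ≤ slack r y) (λ e → subst (0ℚ ≤_) (sym (slack-edgeRow e y)) (y≥0 e)) cutOk
    where
    cutOk : ∀ X → 0ℚ ≤ slack (cutRow X) y
    cutOk X with τ X in eq
    ... | true = diff≥0 (cuts X eq)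
    ... | false = ≤-reflexive (sym (cong (_- 0ℚ) (Σ-zero (λ e → *-zeroˡ (y e)))))

  fromFeasible : ∀ y → Feasible rows y → (∀ e → 0ℚ ≤ y e) × (∀ X → τ X ≡ true → 1ℚ ≤ cut G y X)
  fromFeasible y feas = (λ e → subst (0ℚ ≤_) (slack-edgeRow e y) (feas _ (edgeRow∈ e))) , cutOk
    where
    cutOk′ : ∀ Y → τ Y ≡ true → 0ℚ ≤ slack (cutRow Y) y → 1ℚ ≤ cut G y Y
    cutOk′ Y eq h rewrite eq = ≤-by _ h (+-diff 1ℚ (cut G y Y))
    cutOk : ∀ X → τ X ≡ true → 1ℚ ≤ cut G y X
    cutOk X eq with subsets-complete X
    ... | Y , i , X≗Y = subst (1ℚ ≤_) (sym (cut-cong G y X≗Y)) (cutOk′ Y (trans (sym (resp lin X≗Y)) eq) (feas _ (∈-++⁺ʳ (map edgeRow (allFin m)) (∈-map⁺ cutRow i))))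

  Star : Subset n → Set
  Star X = ∃ λ v → τ (singleton v) ≡ true × (∀ e → cross G X e ≡ cross G (singleton v) e)

  τ-∅ : τ ∅ ≡ false
  τ-∅ = trans (additive lin ∅ ∅) (xor-same (τ ∅))

  τ-∁ : ∀ X → τ (∁ X) ≡ τ X
  τ-∁ X = trans (additive lin full X) (cong (_xor τ X) τ-full)

  -- An odd set contains an active vertex, since `τ` sees only `A`. If there is just one, `X` and
  -- its singleton agree at all ends of edges.
  small⇒star : ∀ X → τ X ≡ true → ¬ Two (A ∩ X) → Star X
  small⇒star X odd ¬two with Finₚ.any? (λ u → (A ∩ X) u 𝔹ₚ.≟ true)
  ... | no none = ⊥-elim (true≢false (trans (sym odd) (trans (dep X ∅ (λ v Av → ¬-not (λ Xv → none (v , cong₂ _∧_ Av Xv)))) τ-∅)))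
  ... | yes (u , p) = u , trans (sym (dep X (singleton u) same)) odd , λ e → cong₂ _xor_ (same _ (proj₁ (ends e))) (same _ (proj₂ (ends e)))
    where
    same : ∀ v → A v ≡ true → X v ≡ singleton u v
    same v Av with v ≟ u
    ... | yes refl = ∧-conicalʳ (A u) _ p
    ... | no v≢u = ¬-not (λ Xv → ¬two (v , u , v≢u , cong₂ _∧_ Av Xv , p))

  trivial⇒star : ∀ X → τ X ≡ true → ¬ NonTrivial A X → Star X
  trivial⇒star X odd ¬nt with two? (A ∩ X) | two? (A ∩ ∁ X)
  ... | no ¬two | _ = small⇒star X odd ¬two
  ... | yes two | yes two′ = ⊥-elim (¬nt (two , two′))
  ... | yes _ | no ¬two with small⇒star (∁ X) (trans (τ-∁ X) odd) ¬two
  ...   | v , p , q = v , p , λ e → trans (sym (cross-∁ G X e)) (q e)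

  inc : Fin n → Fin m → Bool
  inc v = cross G (singleton v)

  -- Reduces the parity of an edge set on an arbitrary cut to its degrees, as needed in `eulerian`.
  cross-inc : ∀ X e → cross G X e ≡ par (λ v → X v ∧ inc v e)
  cross-inc X e = sym (trans (par-cong (λ v → ∧-distribˡ-xor (X v) _ _))
    (trans (par-xor (λ v → X v ∧ singleton v (src G e)) (λ v → X v ∧ singleton v (dst G e))) (cong₂ _xor_ (par-single (src G e) X) (par-single (dst G e) X))))

  -- Points whose tight odd cuts are all stars

  module Stars (y : Fin m → ℚ) (y≥0 : ∀ e → 0ℚ ≤ y e) (cuts : ∀ X → τ X ≡ true → 1ℚ ≤ cut G y X)
    (stars : ∀ X → τ X ≡ true → cut G y X ≡ 1ℚ → Star X)
    (covered : ∀ e → 0ℚ < y e → ∃ λ X → τ X ≡ true × cut G y X ≡ 1ℚ × cross G X e ≡ true) where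

    K : Fin n → Set
    K v = τ (singleton v) ≡ true × cut G y (singleton v) ≡ 1ℚ

    K? : ∀ v → Dec (K v)
    K? v = (τ (singleton v) 𝔹ₚ.≟ true) ×-dec (cut G y (singleton v) ℚₚ.≟ 1ℚ)

    tightStar : ∀ X → τ X ≡ true → cut G y X ≡ 1ℚ → ∃ λ v → K v × (∀ e → cross G X e ≡ inc v e)
    tightStar X odd tight with stars X odd tight
    ... | v , odd′ , same = v , (odd′ , trans (sym (cut-cong′ G y {X} {singleton v} same)) tight) , same

    starOf : ∀ e → 0ℚ < y e → ∃ λ v → K v × inc v e ≡ true
    starOf e p with covered e p
    ... | X , odd , tight , c with tightStar X odd tight
    ...   | v , k , same = v , k , trans (sym (same e)) c

    at : Fin n → Fin m → ℚ
    at v e = ind (inc v e) * y e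

    at≥0 : ∀ v e → 0ℚ ≤ at v e
    at≥0 v e = *-nonneg (ind≥0 (inc v e)) (y≥0 e)

    at-inc : ∀ v e → inc v e ≡ true → at v e ≡ y e
    at-inc v e p = trans (cong (λ b → ind b * y e) p) (*-identityˡ (y e))

    y≤1 : ∀ e → y e ≤ 1ℚ
    y≤1 e with 0ℚ <? y e
    ... | no p = ≤-trans (≮⇒≥ p) 0≤1
    ... | yes p with starOf e p
    ...   | v , (_ , tight) , i = subst₂ _≤_ (at-inc v e i) tight (Σ-term (at≥0 v) e)

    frac : Fin m → Bool
    frac e = isYes (0ℚ <? y e) ∧ isYes (y e <? 1ℚ)

    frac⁻ : ∀ e → frac e ≡ true → 0ℚ < y e × y e < 1ℚ
    frac⁻ e eq with 0ℚ <? y e | y e <? 1ℚ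
    ... | yes p | yes q = p , q

    ¬frac : ∀ e → frac e ≡ false → y e ≡ 0ℚ ⊎ y e ≡ 1ℚ
    ¬frac e eq with 0ℚ <? y e | y e <? 1ℚ
    ... | no p | _ = inj₁ (≤-antisym (≮⇒≥ p) (y≥0 e))
    ... | yes _ | no q = inj₂ (≤-antisym (y≤1 e) (≮⇒≥ q))

    deg : Fin n → ℕ
    deg v = # (λ e → frac e ∧ inc v e)

    -- Tight vertices without fractional edges are left out: their balance equation holds for every
    -- vector supported on fractional edges.
    Kf : Fin n → Bool
    Kf v = isYes (K? v) ∧ not (isYes (deg v ℕ.≟ 0))

    Kf⁺ : ∀ v → K v → deg v ≢ 0 → Kf v ≡ true
    Kf⁺ v k d with K? v | deg v ℕ.≟ 0
    ... | no k′ | _ = ⊥-elim (k′ k)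
    ... | yes _ | yes d′ = ⊥-elim (d d′)
    ... | yes _ | no _ = refl

    Kf⁻ : ∀ v → Kf v ≡ true → K v × deg v ≢ 0
    Kf⁻ v eq with K? v | deg v ℕ.≟ 0
    ... | yes k | no d = k , d

    -- An edge of value 1 next to the fractional edge `e` would push the value of the star above 1.
    clean : ∀ v → K v → ∀ e → frac e ≡ true → inc v e ≡ true → ∀ f → inc v f ≡ true → frac f ≡ false → y f ≡ 0ℚ
    clean v (_ , tight) e fr i f i′ fr′ with ¬frac f fr′
    ... | inj₁ z = z
    ... | inj₂ one = ⊥-elim (<-irrefl refl (<-≤-trans (<-by (y e) (proj₁ (frac⁻ e fr)) (ℚₚ.+-comm (y e) 1ℚ))
        (subst₂ _≤_ (cong₂ _+_ (at-inc v e i) (trans (at-inc v f i′) one)) tight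
          (Σ-two (at≥0 v) {e} {f} (λ { refl → true≢false (trans (sym fr) fr′) })))))

    -- If `e` were the only fractional edge at `v`, the star would have value y(e) < 1.
    second : ∀ v → K v → ∀ e → frac e ≡ true → inc v e ≡ true → ∃ λ f → f ≢ e × (frac f ∧ inc v f) ≡ true
    second v k e fr i with Finₚ.any? (λ f → ¬? (f ≟ e) ×-dec ((frac f ∧ inc v f) 𝔹ₚ.≟ true))
    ... | yes found = found
    ... | no none = ⊥-elim (<-irrefl (trans (sym alone) (proj₂ k)) (proj₂ (frac⁻ e fr)))
      where
      pointwise : ∀ f → at v f ≡ unit e f * y f
      pointwise f with f ≟ e
      ... | yes refl = trans (at-inc v e i) (sym (*-identityˡ (y e)))
      ... | no f≢e = byInc (inc v f) refl
        where
        byInc : ∀ b → inc v f ≡ b → ind b * y f ≡ 0ℚ * y f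
        byInc false _ = refl
        byInc true p = trans (cong (1ℚ *_) (clean v k e fr i f p (¬-not (λ fr′ → none (f , f≢e , cong₂ _∧_ fr′ p))))) (sym (*-zeroˡ (y f)))
      alone : cut G y (singleton v) ≡ y e
      alone = trans (Σ-cong pointwise) (Σ-single e y)

    deg≥2 : ∀ v → 2 ℕ.* bit (Kf v) ℕ.≤ deg v
    deg≥2 v with Kf v in eq
    ... | false = ℕ.z≤n
    ... | true with Kf⁻ v eq
    ...   | k , d with ∃-bit (λ e → frac e ∧ inc v e) d
    ...     | e , p with second v k e (∧-conicalˡ (frac e) _ p) (∧-conicalʳ (frac e) _ p)
    ...       | f , f≢e , q = #≥2 (λ e → frac e ∧ inc v e) f≢e q p

    Σdeg≤ : Σvℕ deg ℕ.≤ 2 ℕ.* # frac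
    Σdeg≤ = subst₂ ℕ._≤_ (sym (ℕS.∑-comm (λ v e → bit (frac e ∧ inc v e)))) (sym (ℕS.*-distribˡ-sum 2 (λ e → bit (frac e)))) (Σℕ-mono ends≤2)
      where
      ends≤2 : ∀ e → Σvℕ (λ v → bit (frac e ∧ inc v e)) ℕ.≤ 2 ℕ.* bit (frac e)
      ends≤2 e with frac e
      ... | false = ℕₚ.≤-reflexive (ℕS.sum-replicate-zero n)
      ... | true = subst (Σvℕ (λ v → bit (inc v e)) ℕ.≤_)
            (trans (ℕS.∑-distrib-+ (λ v → bit (singleton v (src G e))) (λ v → bit (singleton v (dst G e)))) (cong₂ ℕ._+_ (#-singleton (src G e)) (#-singleton (dst G e))))
            (Σℕ-mono (λ v → bit-xor (singleton v (src G e)) (singleton v (dst G e))))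
        where
        bit-xor : ∀ b c → bit (b xor c) ℕ.≤ bit b ℕ.+ bit c
        bit-xor true true = ℕ.z≤n
        bit-xor true false = ℕₚ.≤-refl
        bit-xor false c = ℕₚ.≤-refl

    star·0 : ∀ v (z : Fin m → ℚ) → (∀ e → frac e ≡ false → z e ≡ 0ℚ) → deg v ≡ 0 → (λ e → ind (inc v e)) · z ≡ 0ℚ
    star·0 v z supp d = Σ-zero pointwise
      where
      pointwise : ∀ e → ind (inc v e) * z e ≡ 0ℚ
      pointwise e = byInc (inc v e) (frac e) refl (#≡0⇒false (λ e → frac e ∧ inc v e) d e)
        where
        byInc : ∀ b c → frac e ≡ c → c ∧ b ≡ false → ind b * z e ≡ 0ℚ
        byInc false c _ _ = *-zeroˡ (z e)
        byInc true false p _ = trans (*-identityˡ (z e)) (supp e p)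
        byInc true true _ ()

    findNegative : ∀ (f : Fin m → ℚ) → Σv f ≡ 0ℚ → ∀ e → 0ℚ < f e → ∃ λ e′ → f e′ < 0ℚ
    findNegative f s e p with Finₚ.any? (λ e′ → f e′ <? 0ℚ)
    ... | yes found = found
    ... | no none = ⊥-elim (<-irrefl refl (<-≤-trans p (subst (f e ≤_) s (Σ-term (λ e′ → ≮⇒≥ (λ q → none (e′ , q))) e))))

    ind*neg : ∀ b {z} → ind b * z < 0ℚ → z < 0ℚ
    ind*neg true {z} p = subst (_< 0ℚ) (*-identityˡ z) p
    ind*neg false {z} p = ⊥-elim (<-irrefl refl (subst (_< 0ℚ) (*-zeroˡ z) p))

    -- Every tight odd cut is the star of a vertex of `K`, so a balanced `z` preserves it. A star
    -- through an edge with `z` nonzero balances to 0 and thus has entries of both signs, whose edge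
    -- rows stop the movement both ways.
    toDirection : ∀ (z : Fin m → ℚ) → (∀ e → frac e ≡ false → z e ≡ 0ℚ) → (∀ v → K v → (λ e → ind (inc v e)) · z ≡ 0ℚ) →
      (∃ λ e → z e ≢ 0ℚ) → Direction rows y z
    toDirection z supp bal (e , ze≢0) = direction
      (rows-elim (λ r → slack r y ≡ 0ℚ → coef r · z ≡ 0ℚ)
        (λ e t → trans (unit-· e z) (supp e (¬-not (λ fr → 0<⇒≢0 (proj₁ (frac⁻ e fr)) (trans (sym (slack-edgeRow e y)) t)))))
        keepCut)
      (proj₁ signs) (inj₁ (proj₂ signs))
      where
      slack≡0⇒≡1 : ∀ X → cut G y X - 1ℚ ≡ 0ℚ → cut G y X ≡ 1ℚ
      slack≡0⇒≡1 X t = trans (+-diff 1ℚ (cut G y X)) (cong (1ℚ +_) t)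
      star-balanced : ∀ X → (∃ λ v → K v × (∀ e → cross G X e ≡ inc v e)) → (λ e → ind (cross G X e)) · z ≡ 0ℚ
      star-balanced X (v , k , same) = trans (Σ-cong (λ e → cong (λ b → ind b * z e) (same e))) (bal v k)
      keepCut : ∀ X → slack (cutRow X) y ≡ 0ℚ → coef (cutRow X) · z ≡ 0ℚ
      keepCut X = cutRow-elim X (λ r → slack r y ≡ 0ℚ → coef r · z ≡ 0ℚ)
        (λ _ → Σ-zero (λ e → *-zeroˡ (z e))) (λ odd t → star-balanced X (tightStar X odd (slack≡0⇒≡1 X t)))
      Neg = ∃ λ r → r ∈ rows × coef r · z < 0ℚ
      Pos = ∃ λ r → r ∈ rows × 0ℚ < coef r · z
      neg : ∀ e → z e < 0ℚ → Neg
      neg e p = edgeRow e , edgeRow∈ e , subst (_< 0ℚ) (sym (unit-· e z)) p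
      pos : ∀ e → 0ℚ < z e → Pos
      pos e p = edgeRow e , edgeRow∈ e , subst (0ℚ <_) (sym (unit-· e z)) p
      star : ∃ λ v → K v × inc v e ≡ true
      star = starOf e (proj₁ (frac⁻ e (¬-not (λ fr → ze≢0 (supp e fr)))))
      v = proj₁ star
      atv : ∀ (w : Fin m → ℚ) → ind (inc v e) * w e ≡ w e
      atv w = trans (cong (λ b → ind b * w e) (proj₂ (proj₂ star))) (*-identityˡ (w e))
      bal-v = bal v (proj₁ (proj₂ star))
      -z : Fin m → ℚ
      -z f = - z f
      neg-neg : ∀ p → - (- p) ≡ p
      neg-neg = solve-∀ ℚ-ring
      fromPos : 0ℚ < z e → Neg × Pos
      fromPos p = neg (proj₁ found) (ind*neg (inc v (proj₁ found)) (proj₂ found)) , pos e p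
        where
        found = findNegative (λ f → ind (inc v f) * z f) bal-v e (subst (0ℚ <_) (sym (atv z)) p)
      fromNeg : z e < 0ℚ → Neg × Pos
      fromNeg p = neg e p , pos f (subst (0ℚ <_) (neg-neg (z f)) (neg-antimono-< (ind*neg (inc v f) (proj₂ found))))
        where
        found = findNegative (λ f → ind (inc v f) * -z f) (trans (·-neg (λ f → ind (inc v f)) z) (cong -_ bal-v)) e (subst (0ℚ <_) (sym (atv -z)) (neg-antimono-< p))
        f = proj₁ found
      bySign : Tri (z e < 0ℚ) (z e ≡ 0ℚ) (0ℚ < z e) → Neg × Pos
      bySign (tri< p _ _) = fromNeg p
      bySign (tri≈ _ p _) = ⊥-elim (ze≢0 p)
      bySign (tri> _ _ p) = fromPos p
      signs : Neg × Pos
      signs = bySign (ℚₚ.<-cmp (z e) 0ℚ)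

    -- One equation for each non-fractional edge, forcing `z` to vanish there, and one for each
    -- vertex of `Kf`: together fewer than the number of edges.
    sparse⇒direction : # Kf ℕ.< # frac → ∃ λ z → Direction rows y z
    sparse⇒direction lt = z , toDirection z supp bal nz
      where
      starEq : Fin n → Fin m → ℚ
      starEq v e = ind (inc v e)
      eqs = map unit (select (∁ frac)) ++ map starEq (select Kf)
      len : length eqs ≡ # (∁ frac) ℕ.+ # Kf
      len = trans (Listₚ.length-++ (map unit (select (∁ frac)))) (cong₂ ℕ._+_
        (trans (Listₚ.length-map unit (select (∁ frac))) (length-select (∁ frac))) (trans (Listₚ.length-map starEq (select Kf)) (length-select Kf)))
      ker = kernel (length eqs) eqs ℕₚ.≤-refl (subst₂ ℕ._<_ (sym len) (#-∁ frac) (ℕₚ.+-monoʳ-< (# (∁ frac)) lt))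
      z = proj₁ ker
      nz = proj₁ (proj₂ ker)
      supp : ∀ e → frac e ≡ false → z e ≡ 0ℚ
      supp e p = trans (sym (unit-· e z)) (proj₂ (proj₂ ker) (unit e) (∈-++⁺ˡ (∈-map⁺ unit (∈-select (∁ frac) e (cong not p)))))
      bal : ∀ v → K v → starEq v · z ≡ 0ℚ
      bal v k = byDeg (deg v ℕ.≟ 0)
        where
        byDeg : Dec (deg v ≡ 0) → starEq v · z ≡ 0ℚ
        byDeg (yes d) = star·0 v z supp d
        byDeg (no d) = proj₂ (proj₂ ker) (starEq v) (∈-++⁺ʳ (map unit (select (∁ frac))) (∈-map⁺ starEq (∈-select Kf v (Kf⁺ v k d))))

    -- Here the fractional edges form a 2-regular graph.
    module Regular (dense : # frac ℕ.≤ # Kf) where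

      -- The chain 2|Kf| ≤ sum of degrees ≤ 2|frac| ≤ 2|Kf| leaves no room at any vertex.
      deg≡ : ∀ v → deg v ≡ 2 ℕ.* bit (Kf v)
      deg≡ = Σℕ-tight deg≥2 (ℕₚ.≤-trans Σdeg≤ (ℕₚ.≤-trans (ℕₚ.*-monoʳ-≤ 2 dense) (ℕₚ.≤-reflexive (ℕS.*-distribˡ-sum 2 (λ v → bit (Kf v))))))

      -- The direction is y - ½ on the fractional edges. It is balanced at a vertex of `Kf`: the
      -- star has value 1, carried by its two fractional edges.
      notHalf⇒direction : (∃ λ e → frac e ≡ true × y e ≢ ½) → ∃ λ z → Direction rows y z
      notHalf⇒direction (e , fr , ne) = z , toDirection z supp bal (e , λ eq → ne (trans (lem′ (y e)) (cong (_+ ½)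
          (trans (sym (trans (cong (λ b → ind b * (y e - ½)) fr) (*-identityˡ (y e - ½)))) eq))))
        where
        lem′ : ∀ p → p ≡ p - ½ + ½
        lem′ = solve-∀ ℚ-ring
        z : Fin m → ℚ
        z e = ind (frac e) * (y e - ½)
        supp : ∀ e → frac e ≡ false → z e ≡ 0ℚ
        supp e p = trans (cong (λ b → ind b * (y e - ½)) p) (*-zeroˡ (y e - ½))
        bal : ∀ v → K v → (λ e → ind (inc v e)) · z ≡ 0ℚ
        bal v k with deg v ℕ.≟ 0
        ... | yes d = star·0 v z supp d
        ... | no d = trans (Σ-cong pointwise) (trans (Σ-+ (at v) (λ e → (- ½) * ind (frac e ∧ inc v e)))
              (cong₂ _+_ (proj₂ k) (trans (Σ-*ˡ (- ½) (λ e → ind (frac e ∧ inc v e))) (cong ((- ½) *_) (trans (Σ-ind (λ e → frac e ∧ inc v e)) (cong toℚ deg≡2))))))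
          where
          deg≡2 : deg v ≡ 2
          deg≡2 = trans (deg≡ v) (cong (λ b → 2 ℕ.* bit b) (Kf⁺ v k d))
          some = ∃-bit (λ e → frac e ∧ inc v e) d
          e₀ = proj₁ some
          fr₀ = ∧-conicalˡ (frac e₀) _ (proj₂ some)
          in₀ = ∧-conicalʳ (frac e₀) _ (proj₂ some)
          pointwise : ∀ e → ind (inc v e) * z e ≡ at v e + (- ½) * ind (frac e ∧ inc v e)
          pointwise e = cases (inc v e) (frac e) refl refl
            where
            lem₁ : ∀ q → 1ℚ * (1ℚ * (q - ½)) ≡ 1ℚ * q + (- ½) * 1ℚ
            lem₁ = solve-∀ ℚ-ring
            cases : ∀ b c → inc v e ≡ b → frac e ≡ c → ind b * (ind c * (y e - ½)) ≡ ind b * y e + (- ½) * ind (c ∧ b)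
            cases true true _ _ = lem₁ (y e)
            cases true false p q = trans (cong (λ q → 1ℚ * (0ℚ * (q - ½))) ye) (sym (cong (λ q → 1ℚ * q + (- ½) * 0ℚ) ye))
              where
              ye : y e ≡ 0ℚ
              ye = clean v k e₀ fr₀ in₀ e p q
            cases false c _ _ = trans (*-zeroˡ (ind c * (y e - ½))) (sym (trans (cong (λ b → 0ℚ * y e + (- ½) * ind b) (∧-zeroʳ c)) (cong (_+ (- ½) * 0ℚ) (*-zeroˡ (y e)))))

      -- Each fractional edge lies in exactly one of `J₀` and `J₁`, and every other edge of `J₀` has
      -- value 1, so the average of the two joins is at most `y`.
      half : (∀ e → frac e ≡ true → y e ≡ ½) → Dom (IsJoin G τ) y
      half allHalf = Dom-↑ bound (Dom-mix ½ ½ 0<½ 0<½ refl (λ _ → refl) (Dom-pure J₀ isJoin₀ (λ _ → ≤-refl)) (Dom-pure J₁ isJoin₁ (λ _ → ≤-refl)))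
        where
        supported : Fin m → Bool
        supported e = isYes (0ℚ <? y e)
        supported⁺ : ∀ e → supported e ≡ false → y e ≡ 0ℚ
        supported⁺ e eq with 0ℚ <? y e
        ... | no p = ≤-antisym (≮⇒≥ p) (y≥0 e)
        supported⁻ : ∀ e → supported e ≡ true → 0ℚ < y e
        supported⁻ e eq with 0ℚ <? y e
        ... | yes p = p
        even : ∀ X → Uncrossed G supported X → τ X ≡ false
        even X u = ¬-not (λ odd → <-irrefl refl (<-≤-trans 0<1 (subst (1ℚ ≤_) (Σ-zero pointwise) (cuts X odd))))
          where
          pointwise : ∀ e → ind (cross G X e) * y e ≡ 0ℚ
          pointwise e with supported e in eq
          ... | true = trans (cong (λ b → ind b * y e) (u e eq)) (*-zeroˡ (y e))
          ... | false = trans (cong (ind (cross G X e) *_) (supported⁺ e eq)) (*-zeroʳ (ind (cross G X e)))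
        found = joinExists m G supported τ lin even
        J₀ = proj₁ found
        isJoin₀ = proj₂ (proj₂ found)
        J₁ : Fin m → Bool
        J₁ e = J₀ e xor frac e
        eulerian : ∀ X → par (λ e → frac e ∧ cross G X e) ≡ false
        eulerian X = trans (par-cong (λ e → trans (cong (frac e ∧_) (cross-inc X e)) (sym (par-∧ (frac e) (λ v → X v ∧ inc v e)))))
          (trans (par-comm (λ e v → frac e ∧ (X v ∧ inc v e))) (par-false (λ v → trans (par-cong (λ e → swap (frac e) (X v) (inc v e)))
            (trans (par-∧ (X v) (λ e → frac e ∧ inc v e)) (trans (cong (X v ∧_) (evenDeg v)) (∧-zeroʳ (X v)))))))
          where
          swap : ∀ a b c → a ∧ (b ∧ c) ≡ b ∧ (a ∧ c)
          swap true b c = refl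
          swap false b c = sym (∧-zeroʳ b)
          evenDeg : ∀ v → par (λ e → frac e ∧ inc v e) ≡ false
          evenDeg v = trans (sym (oddℕ-# (λ e → frac e ∧ inc v e))) (trans (cong oddℕ (deg≡ v)) (twice (Kf v)))
            where
            twice : ∀ b → oddℕ (2 ℕ.* bit b) ≡ false
            twice true = refl
            twice false = refl
        isJoin₁ : IsJoin G τ J₁
        isJoin₁ X = trans (par-cong (λ e → ∧-distribʳ-xor (cross G X e) (J₀ e) (frac e)))
          (trans (par-xor (λ e → J₀ e ∧ cross G X e) (λ e → frac e ∧ cross G X e)) (trans (cong₂ _xor_ (isJoin₀ X) (eulerian X)) (xor-identityʳ (τ X))))
        bound : ∀ e → ½ * ind (J₀ e) + ½ * ind (J₁ e) ≤ y e
        bound e = cases (J₀ e) (frac e) refl refl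
          where
          cases : ∀ j f → J₀ e ≡ j → frac e ≡ f → ½ * ind j + ½ * ind (j xor f) ≤ y e
          cases true true _ q = ≤-reflexive (sym (allHalf e q))
          cases false true _ q = ≤-reflexive (sym (allHalf e q))
          cases false false _ _ = y≥0 e
          cases true false p q with ¬frac e q
          ... | inj₂ one = ≤-reflexive (sym one)
          ... | inj₁ zer = ⊥-elim (0<⇒≢0 (supported⁻ e (proj₁ (proj₂ found) e p)) zer)

    conclude : Dom (IsJoin G τ) y ⊎ ∃ λ z → Direction rows y z
    conclude with # Kf ℕ.<? # frac
    ... | yes lt = inj₂ (sparse⇒direction lt)
    ... | no nlt with Finₚ.any? (λ e → (frac e 𝔹ₚ.≟ true) ×-dec ¬? (y e ℚₚ.≟ ½))
    ...   | yes found = inj₂ (Regular.notHalf⇒direction (ℕₚ.≮⇒≥ nlt) found)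
    ...   | no none = inj₁ (Regular.half (ℕₚ.≮⇒≥ nlt) (λ e fr → decidable-stable (y e ℚₚ.≟ ½) (λ ne → none (e , fr , ne))))

  -- Induction for the T-join dominant

  Tight : (Fin m → ℚ) → Subset n → Set
  Tight y X = τ X ≡ true × cut G y X ≡ 1ℚ

  tight? : ∀ y X → Dec (Tight y X)
  tight? y X = (τ X 𝔹ₚ.≟ true) ×-dec (cut G y X ℚₚ.≟ 1ℚ)

  Tight-cong : ∀ y {X Y} → X ≗ Y → Tight y X → Tight y Y
  Tight-cong y X≗Y (p , q) = trans (sym (resp lin X≗Y)) p , trans (sym (cut-cong G y X≗Y)) q

  module _ (nonTrivial : ∀ y → (∀ e → 0ℚ ≤ y e) → (∀ X → τ X ≡ true → 1ℚ ≤ cut G y X) → ∀ X → NonTrivial A X → Tight y X → Dom (IsJoin G τ) y) where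

    step : ∀ y → Feasible rows y → Dom (IsJoin G τ) y ⊎ ∃ λ z → Direction rows y z
    step y feas = findNonTrivial (anySubset? (λ X → (two? (A ∩ X) ×-dec two? (A ∩ ∁ X)) ×-dec tight? y X)
        (λ X≗Y ((t , t′) , p) → (Two-cong (λ v → cong (A v ∧_) (X≗Y v)) t , Two-cong (λ v → cong (λ b → A v ∧ not b) (X≗Y v)) t′) , Tight-cong y X≗Y p))
      where
      y≥0 = proj₁ (fromFeasible y feas)
      cuts = proj₂ (fromFeasible y feas)
      Covers : Fin m → Set
      Covers e = ∃ λ X → Tight y X × cross G X e ≡ true
      covers? : ∀ e → Dec (Covers e)
      covers? e = anySubset? (λ X → tight? y X ×-dec (cross G X e 𝔹ₚ.≟ true)) (λ X≗Y (p , c) → Tight-cong y X≗Y p , trans (sym (cross-cong G X≗Y e)) c)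
      -- No tight odd cut contains `e`, so its value can be decreased. No opposite move is required,
      -- because the property is upward closed.
      lower : ∀ e → 0ℚ < y e → ¬ Covers e → Direction rows y (λ f → - unit e f)
      lower e p unc = direction
        (rows-elim (λ r → slack r y ≡ 0ℚ → coef r · (λ f → - unit e f) ≡ 0ℚ)
          (λ f t → trans (·-neg (unit f) (unit e)) (cong -_ (trans (·-unit (unit f) e) (unit-≢ {e = f} {f = e} (λ { refl → 0<⇒≢0 p (trans (sym (slack-edgeRow e y)) t) })))))
          keepCut)
        (edgeRow e , edgeRow∈ e , subst (_< 0ℚ) (sym (trans (·-neg (unit e) (unit e)) (cong -_ (trans (unit-· e (unit e)) (unit-self e))))) (negative⁻¹ (- 1ℚ)))
        (inj₂ (λ f → neg-antimono-≤ (ind≥0 (singleton e f))))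
        where
        keepCut : ∀ X → slack (cutRow X) y ≡ 0ℚ → coef (cutRow X) · (λ f → - unit e f) ≡ 0ℚ
        keepCut X = cutRow-elim X (λ r → slack r y ≡ 0ℚ → coef r · (λ f → - unit e f) ≡ 0ℚ)
          (λ _ → Σ-zero (λ f → *-zeroˡ (- unit e f)))
          (λ odd t → trans (·-neg (λ f → ind (cross G X f)) (unit e)) (cong -_ (trans (·-unit (λ f → ind (cross G X f)) e)
            (cong ind (¬-not (λ c → unc (X , (odd , slack≡0⇒≡1 X t) , c)))))))
          where
          slack≡0⇒≡1 : ∀ X → cut G y X - 1ℚ ≡ 0ℚ → cut G y X ≡ 1ℚ
          slack≡0⇒≡1 X t = trans (+-diff 1ℚ (cut G y X)) (cong (1ℚ +_) t)
      findUncovered : ¬ (∃ λ X → NonTrivial A X × Tight y X) → Dec (∃ λ e → 0ℚ < y e × ¬ Covers e) → Dom (IsJoin G τ) y ⊎ ∃ λ z → Direction rows y z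
      findUncovered _ (yes (e , p , unc)) = inj₂ (_ , lower e p unc)
      findUncovered none (no all) = Stars.conclude y y≥0 cuts (λ X odd t → trivial⇒star X odd (λ nt → none (X , nt , odd , t)))
        (λ e p → let (X , (odd , t) , c) = decidable-stable (covers? e) (λ unc → all (e , p , unc)) in X , odd , t , c)
      findNonTrivial : Dec (∃ λ X → NonTrivial A X × Tight y X) → Dom (IsJoin G τ) y ⊎ ∃ λ z → Direction rows y z
      findNonTrivial (yes (X , nt , t)) = inj₁ (nonTrivial y y≥0 cuts X nt t)
      findNonTrivial (no none) = findUncovered none (Finₚ.any? (λ e → (0ℚ <? y e) ×-dec ¬? (covers? e)))

    joinDominant : ∀ y → (∀ e → 0ℚ ≤ y e) → (∀ X → τ X ≡ true → 1ℚ ≤ cut G y X) → Dom (IsJoin G τ) y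
    joinDominant y y≥0 cuts = faceInduction rows (Dom (IsJoin G τ)) Dom-mix Dom-↑ step y (toFeasible y y≥0 cuts)

-- Induction on the number of active vertices. A nontrivial cut has two of them on each side, so
-- either contraction has fewer. The same `y` remains feasible, as the cuts of a contraction are the
-- cuts of `G` that do not split the contracted set.
joinPolyhedron′ : ∀ k {n m} (G : Graph n m) A τ → Linear τ → EndsIn G A → DependsOn τ A → # A ℕ.< k →
  ∀ y → (∀ e → 0ℚ ≤ y e) → (∀ X → τ X ≡ true → 1ℚ ≤ cut G y X) → Dom (IsJoin G τ) y
joinPolyhedron′ (suc k) {n} {m} G A τ lin ends dep (ℕ.s≤s lt) y₀ y₀≥0 cuts₀ = joinDominant nonTrivial y₀ y₀≥0 cuts₀
  where
  -- No edge crosses the full set, so its cut inequality would read 1 ≤ 0.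
  τ-full : τ full ≡ false
  τ-full = ¬-not (λ odd → <-irrefl refl (<-≤-trans 0<1 (subst (1ℚ ≤_) (Σ-zero (λ e → *-zeroˡ (y₀ e))) (cuts₀ full odd))))
  open JoinStep G A τ lin ends dep τ-full
  nonTrivial : ∀ y → (∀ e → 0ℚ ≤ y e) → (∀ X → τ X ≡ true → 1ℚ ≤ cut G y X) → ∀ X → NonTrivial A X → Tight y X → Dom (IsJoin G τ) y
  nonTrivial y y≥0 cuts X₀ (two , two∁) (odd , tight) = glue (side X₀ two) (side (∁ X₀) two∁)
    where
    open Glue G τ lin y y≥0 X₀ tight odd (trans (τ-∁ X₀) odd)
    side : ∀ X → Two (A ∩ X) → Dom (Off X) y
    side X two@(u , _ , _ , p , _) = Dom-map off
      (joinPolyhedron′ k (contract G X u) (survivors A X u) (λ Z → τ (Z ∘ collapse X u))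
        (linear (λ X≗Y → resp lin (λ v → X≗Y (collapse X u v))) (λ Y Z → additive lin (Y ∘ collapse X u) (Z ∘ collapse X u)))
        (contract-endsIn G A X (∧-conicalˡ (A u) _ p) ends)
        (λ Y Z same → dep (Y ∘ collapse X u) (Z ∘ collapse X u) (λ v Av → same (collapse X u v) (collapse-survives A X (∧-conicalˡ (A u) _ p) v Av)))
        (ℕₚ.<-≤-trans (survivors-< A X two) lt) y y≥0 (λ Z → cuts (Z ∘ collapse X u)))
      where
      -- A set that avoids `X` equals its pull-back along `collapse`.
      off : ∀ J → IsJoin (contract G X u) (λ Z → τ (Z ∘ collapse X u)) J → Off X J
      off J isJoin Z disj = trans (par-cong (λ e → cong (J e ∧_) (cross-cong G same e))) (trans (isJoin Z) (sym (resp lin same)))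
        where
        same : Z ≗ (Z ∘ collapse X u)
        same v with X v in eq
        ... | true = trans (disj v eq) (sym (disj u (∧-conicalʳ (A u) _ p)))
        ... | false = refl

joinPolyhedron : ∀ {n m} (G : Graph n m) τ → Linear τ → ∀ y → (∀ e → 0ℚ ≤ y e) → (∀ X → τ X ≡ true → 1ℚ ≤ cut G y X) → Dom (IsJoin G τ) y
joinPolyhedron G τ lin = joinPolyhedron′ _ G full τ lin (λ e → refl , refl) (λ X Y same → resp lin (λ v → same v refl)) ℕₚ.≤-refl

-- The dominant of the spanning tree polytope

ins : ∀ {n m} → Graph n m → Subset n → Fin m → Bool
ins G X e = X (src G e) ∧ X (dst G e)

inner : ∀ {n m} → Graph n m → (Fin m → ℚ) → Subset n → ℚ
inner G x X = (λ e → ind (ins G X e)) · x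

card : ∀ {n} → Subset n → ℚ
card X = Σv (λ v → ind (X v))

-- Connectivity by cuts: a set separating two vertices of `A` is crossed. In this form it can be
-- tested on symmetric differences and pulled back along contractions.
ConnectsOn : ∀ {n m} → Graph n m → Subset n → (Fin m → Bool) → Set
ConnectsOn G A S = ∀ X → Uncrossed G S X → ∀ u v → A u ≡ true → A v ≡ true → X u ≡ X v

-- Edmonds' description of the spanning tree polytope: x(E[X]) ≤ |X| - 1 and x(E) = |A| - 1, of
-- which `spanning` is the lower half; for nonempty `A` the upper half is `forest` at the full set.
record TreePoint {n m} (G : Graph n m) (A : Subset n) (x : Fin m → ℚ) : Set where
  field
    x≥0 : ∀ e → 0ℚ ≤ x e
    forest : ∀ X v → (A ∩ X) v ≡ true → inner G x X + 1ℚ ≤ card (A ∩ X)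
    spanning : card A ≤ Σv x + 1ℚ
open TreePoint

card-cong : ∀ {n} {X Y : Subset n} → X ≗ Y → card X ≡ card Y
card-cong X≗Y = Σ-cong (λ v → cong ind (X≗Y v))

inner-cong : ∀ {n m} (G : Graph n m) x {X Y} → X ≗ Y → inner G x X ≡ inner G x Y
inner-cong G x X≗Y = Σ-cong (λ e → cong (λ b → ind b * x e) (cong₂ _∧_ (X≗Y (src G e)) (X≗Y (dst G e))))

card≥2 : ∀ {n} {X : Subset n} {u v} → u ≢ v → X u ≡ true → X v ≡ true → 1ℚ + 1ℚ ≤ card X
card≥2 {X = X} {u} {v} u≢v p q = subst (_≤ card X) (cong₂ (λ b c → ind b + ind c) p q) (Σ-two {f = λ v → ind (X v)} (λ v → ind≥0 (X v)) u≢v)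

ind-mono : ∀ {b c} → (b ≡ true → c ≡ true) → ind b ≤ ind c
ind-mono {false} {c} h = ind≥0 c
ind-mono {true} {c} h = ≤-reflexive (cong ind (sym (h refl)))

card-single : ∀ {n} (u : Fin n) → card (singleton u) ≡ 1ℚ
card-single u = trans (Σ-cong (λ v → sym (*-identityʳ (unit u v)))) (Σ-single u (λ _ → 1ℚ))

card≤1 : ∀ {n} {X : Subset n} u → (∀ v → X v ≡ true → v ≡ u) → card X ≤ 1ℚ
card≤1 {X = X} u h = subst (card X ≤_) (card-single u) (Σ-mono (λ v → ind-mono (λ p → subst (λ w → singleton w v ≡ true) (h v p) (==-refl v))))

module TreeStep {n m} (G : Graph n m) (A : Subset n) (ends : EndsIn G A) where

  nonempty? : ∀ X → Dec (∃ λ v → (A ∩ X) v ≡ true)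
  nonempty? X = Finₚ.any? (λ v → (A ∩ X) v 𝔹ₚ.≟ true)

  edgeRow : Fin m → Row m
  edgeRow e = row (unit e) 0ℚ

  -- Without active vertices the bound |A ∩ X| - 1 would be -1, so such a set gets a void row.
  setRow : Subset n → Row m
  setRow X = if isYes (nonempty? X) then row (λ e → - ind (ins G X e)) (1ℚ - card (A ∩ X)) else row (λ _ → 0ℚ) 0ℚ

  totalRow : Row m
  totalRow = row (λ _ → 1ℚ) (card A - 1ℚ)

  rows : List (Row m)
  rows = totalRow ∷ map edgeRow (allFin m) ++ map setRow (subsets n)

  edgeRow∈ : ∀ e → edgeRow e ∈ rows
  edgeRow∈ e = there (∈-++⁺ˡ (∈-map⁺ edgeRow (∈-allFin e)))

  rows-elim : (Q : Row m → Set) → Q totalRow → (∀ e → Q (edgeRow e)) → (∀ X → Q (setRow X)) → ∀ r → r ∈ rows → Q r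
  rows-elim Q qt qe qc r (here refl) = qt
  rows-elim Q qt qe qc r (there i) with ∈-++⁻ (map edgeRow (allFin m)) i
  ... | inj₁ j with ∈-map⁻ edgeRow j
  ...   | e , _ , refl = qe e
  rows-elim Q qt qe qc r (there i) | inj₂ j with ∈-map⁻ setRow j
  ...   | X , _ , refl = qc X

  setRow-elim : ∀ X (Q : Row m → Set) → Q (row (λ _ → 0ℚ) 0ℚ) →
    ((∃ λ v → (A ∩ X) v ≡ true) → Q (row (λ e → - ind (ins G X e)) (1ℚ - card (A ∩ X)))) → Q (setRow X)
  setRow-elim X Q q₀ q₁ with nonempty? X
  ... | yes p = q₁ p
  ... | no _ = q₀

  setRow-nonempty : ∀ X → (∃ λ v → (A ∩ X) v ≡ true) → setRow X ≡ row (λ e → - ind (ins G X e)) (1ℚ - card (A ∩ X))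
  setRow-nonempty X p with nonempty? X
  ... | yes _ = refl
  ... | no ¬p = ⊥-elim (¬p p)

  slack-edgeRow : ∀ e x → slack (edgeRow e) x ≡ x e
  slack-edgeRow e x = trans (cong (_- 0ℚ) (unit-· e x)) (lem (x e))
    where
    lem : ∀ p → p - 0ℚ ≡ p
    lem = solve-∀ ℚ-ring

  slack-setRow : ∀ X x → slack (row (λ e → - ind (ins G X e)) (1ℚ - card (A ∩ X))) x ≡ card (A ∩ X) - (inner G x X + 1ℚ)
  slack-setRow X x = trans (cong (_- (1ℚ - card (A ∩ X))) (trans (·-comm (λ e → - ind (ins G X e)) x) (trans (·-neg x (λ e → ind (ins G X e))) (cong -_ (·-comm x (λ e → ind (ins G X e)))))))
    (lem (inner G x X) (card (A ∩ X)))
    where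
    lem : ∀ p c → - p - (1ℚ - c) ≡ c - (p + 1ℚ)
    lem = solve-∀ ℚ-ring

  slack-totalRow : ∀ x → slack totalRow x ≡ Σv x + 1ℚ - card A
  slack-totalRow x = trans (cong (_- (card A - 1ℚ)) (trans (Σ-*ˡ 1ℚ x) (*-identityˡ (Σv x)))) (lem (Σv x) (card A))
    where
    lem : ∀ p c → p - (c - 1ℚ) ≡ p + 1ℚ - c
    lem = solve-∀ ℚ-ring

  toFeasible : ∀ x → TreePoint G A x → Feasible rows x
  toFeasible x tp = rows-elim (λ r → 0ℚ ≤ slack r x)
    (subst (0ℚ ≤_) (sym (slack-totalRow x)) (diff≥0 (spanning tp)))
    (λ e → subst (0ℚ ≤_) (sym (slack-edgeRow e x)) (x≥0 tp e))
    (λ X → setRow-elim X (λ r → 0ℚ ≤ slack r x)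
      (≤-reflexive (sym (cong (_- 0ℚ) (Σ-zero (λ e → *-zeroˡ (x e))))))
      (λ (v , p) → subst (0ℚ ≤_) (sym (slack-setRow X x)) (diff≥0 (forest tp X v p))))

  fromFeasible : ∀ x → Feasible rows x → TreePoint G A x
  fromFeasible x feas = record
    { x≥0 = λ e → subst (0ℚ ≤_) (slack-edgeRow e x) (feas _ (edgeRow∈ e))
    ; forest = forest′
    ; spanning = ≤-by _ (subst (0ℚ ≤_) (slack-totalRow x) (feas _ (here refl))) (+-diff (card A) (Σv x + 1ℚ)) }
    where
    forest″ : ∀ Y → Y ∈ subsets n → (∃ λ v → (A ∩ Y) v ≡ true) → inner G x Y + 1ℚ ≤ card (A ∩ Y)
    forest″ Y i p = ≤-by _ (subst (0ℚ ≤_) (slack-setRow Y x) (subst (λ r → 0ℚ ≤ slack r x) (setRow-nonempty Y p)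
      (feas (setRow Y) (there (∈-++⁺ʳ (map edgeRow (allFin m)) (∈-map⁺ setRow i)))))) (+-diff (inner G x Y + 1ℚ) (card (A ∩ Y)))
    forest′ : ∀ X v → (A ∩ X) v ≡ true → inner G x X + 1ℚ ≤ card (A ∩ X)
    forest′ X v p = via (subsets-complete X)
      where
      via : (∃ λ Y → Y ∈ subsets n × X ≗ Y) → inner G x X + 1ℚ ≤ card (A ∩ X)
      via (Y , i , X≗Y) = subst₂ (λ p q → p + 1ℚ ≤ q) (sym (inner-cong G x X≗Y)) (sym (card-cong (λ v → cong (A v ∧_) (X≗Y v))))
        (forest″ Y i (v , trans (cong (A v ∧_) (sym (X≗Y v))) p))

  Separating : Subset n → Set
  Separating X = Two (A ∩ X) × ∃ λ w → (A ∩ ∁ X) w ≡ true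

  Tight : (Fin m → ℚ) → Subset n → Set
  Tight x X = inner G x X + 1ℚ ≡ card (A ∩ X)

  module AtPoint (x : Fin m → ℚ) (tp : TreePoint G A x) where

    term≥0 : ∀ X e → 0ℚ ≤ ind (ins G X e) * x e
    term≥0 X e = *-nonneg (ind≥0 (ins G X e)) (x≥0 tp e)

    inside≤ : ∀ X e → ins G X e ≡ true → x e ≤ inner G x X
    inside≤ X e p = subst (_≤ inner G x X) (trans (cong (λ b → ind b * x e) p) (*-identityˡ (x e))) (Σ-term (term≥0 X) e)

    difference : Fin m → Fin m → Fin m → ℚ
    difference e f g = unit e g + (- 1ℚ) * unit f g

    ·-difference : ∀ c e f → c · difference e f ≡ c e + (- 1ℚ) * c f
    ·-difference c e f = trans (·-move c (unit e) (unit f) (- 1ℚ)) (cong₂ (λ p q → p + (- 1ℚ) * q) (·-unit c e) (·-unit c f))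

    -- A tight set with a single active vertex contains no edge of positive value, and one
    -- containing all of `A` contains every edge. So `e` and `f` lie in the same tight sets, and
    -- shifting weight from one to the other keeps these tight.
    exchange : ¬ (∃ λ X → Separating X × Tight x X) → ∀ e f → e ≢ f → 0ℚ < x e → 0ℚ < x f → Direction rows x (difference e f)
    exchange none e f e≢f xe>0 xf>0 = direction
      (rows-elim (λ r → slack r x ≡ 0ℚ → coef r · difference e f ≡ 0ℚ)
        (λ _ → ·-difference (λ _ → 1ℚ) e f)
        (λ g t → trans (·-difference (unit g) e f) (cong₂ (λ p q → p + (- 1ℚ) * q)
          (unit-≢ {e = g} {f = e} (λ { refl → 0<⇒≢0 xe>0 (trans (sym (slack-edgeRow e x)) t) })) (unit-≢ {e = g} {f = f} (λ { refl → 0<⇒≢0 xf>0 (trans (sym (slack-edgeRow f x)) t) }))))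
        (λ X → setRow-elim X (λ r → slack r x ≡ 0ℚ → coef r · difference e f ≡ 0ℚ)
          (λ _ → Σ-zero (λ g → *-zeroˡ (difference e f g)))
          (λ ne t → trans (·-difference (λ e → - ind (ins G X e)) e f)
            (trans (cong (λ b → - ind (ins G X e) + (- 1ℚ) * (- ind b)) (sym (alike X ne (tightOf X (trans (sym (slack-setRow X x)) t))))) (lem (ind (ins G X e)))))))
      (edgeRow f , edgeRow∈ f , subst (_< 0ℚ) (sym (trans (·-difference (unit f) e f) (cong₂ (λ p q → p + (- 1ℚ) * q) (unit-≢ {e = f} {f = e} e≢f) (unit-self f)))) (negative⁻¹ (- 1ℚ)))
      (inj₁ (edgeRow e , edgeRow∈ e , subst (0ℚ <_) (sym (trans (·-difference (unit e) e f) (cong₂ (λ p q → p + (- 1ℚ) * q) (unit-self e) (unit-≢ {e = e} {f = f} (e≢f ∘ sym))))) 0<1))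
      where
      lem : ∀ p → - p + (- 1ℚ) * (- p) ≡ 0ℚ
      lem = solve-∀ ℚ-ring
      tightOf : ∀ X → card (A ∩ X) - (inner G x X + 1ℚ) ≡ 0ℚ → Tight x X
      tightOf X t = sym (trans (+-diff (inner G x X + 1ℚ) (card (A ∩ X))) (trans (cong (inner G x X + 1ℚ +_) t) (+-identityʳ _)))
      alike : ∀ X → (∃ λ v → (A ∩ X) v ≡ true) → Tight x X → ins G X e ≡ ins G X f
      alike X (v , p) t = cases (two? (A ∩ X)) (Finₚ.any? (λ w → (A ∩ ∁ X) w 𝔹ₚ.≟ true))
        where
        allIn : ¬ (∃ λ w → (A ∩ ∁ X) w ≡ true) → ∀ g → ins G X g ≡ true
        allIn noneOut g = cong₂ _∧_ (in′ (proj₁ (ends g))) (in′ (proj₂ (ends g)))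
          where
          in′ : ∀ {w} → A w ≡ true → X w ≡ true
          in′ {w} Aw = ¬-not (λ Xw → noneOut (w , cong₂ (λ b c → b ∧ not c) Aw Xw))
        noneIn : ¬ Two (A ∩ X) → ∀ g → 0ℚ < x g → ins G X g ≡ false
        noneIn ¬two g xg>0 = ¬-not (λ i → <-irrefl refl (<-≤-trans xg>0 (≤-trans (inside≤ X g i) inner≤0)))
          where
          card≤ : card (A ∩ X) ≤ 1ℚ
          card≤ = card≤1 v (λ w q → decidable-stable (w ≟ v) (λ w≢v → ¬two (w , v , w≢v , q , p)))
          inner≤0 : inner G x X ≤ 0ℚ
          inner≤0 = ≤-by (1ℚ - card (A ∩ X)) (diff≥0 card≤) (trans (lem₀ (inner G x X)) (cong (λ c → inner G x X + (1ℚ - c)) t))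
            where
            lem₀ : ∀ p → 0ℚ ≡ p + (1ℚ - (p + 1ℚ))
            lem₀ = solve-∀ ℚ-ring
        cases : Dec (Two (A ∩ X)) → Dec (∃ λ w → (A ∩ ∁ X) w ≡ true) → ins G X e ≡ ins G X f
        cases (yes two) (yes out) = ⊥-elim (none (X , (two , out) , t))
        cases (no ¬two) _ = trans (noneIn ¬two e xe>0) (sym (noneIn ¬two f xf>0))
        cases (yes _) (no noneOut) = trans (allIn noneOut e) (sym (allIn noneOut f))

    empty : (∀ e → x e ≡ 0ℚ) → Dom (ConnectsOn G A) x
    empty x≡0 = Dom-pure (λ _ → false) connects (λ e → x≥0 tp e)
      where
      connects : ConnectsOn G A (λ _ → false)
      connects X _ u v Au Av = cong X (decidable-stable (u ≟ v) (λ u≢v → <-irrefl refl (<-≤-trans (<-by 1ℚ 0<1 refl)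
        (≤-trans (card≥2 {X = A} u≢v Au Av) (subst (λ p → card A ≤ p + 1ℚ) (Σ-zero x≡0) (spanning tp))))))

    -- With `B` the ends of `e`, |A| ≤ x(e) + 1 ≤ |A ∩ B|. Hence `A` consists of the ends of `e`,
    -- which are distinct because x(e) > 0, and x(e) ≥ 1.
    oneEdge : ∀ e → 0ℚ < x e → (∀ f → f ≢ e → x f ≡ 0ℚ) → Dom (ConnectsOn G A) x
    oneEdge e xe>0 others = Dom-pure (singleton e) connects below
      where
      a = src G e
      b = dst G e
      B : Subset n
      B v = singleton a v ∨ singleton b v
      Ba : B a ≡ true
      Ba = cong (_∨ singleton b a) (==-refl a)
      Bb : B b ≡ true
      Bb = trans (cong (singleton a b ∨_) (==-refl b)) (∨-zeroʳ (singleton a b))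
      Σx≡ : Σv x ≡ x e
      Σx≡ = trans (Σ-cong pointwise) (Σ-single e x)
        where
        pointwise : ∀ f → x f ≡ unit e f * x f
        pointwise f with f ≟ e
        ... | yes refl = sym (*-identityˡ (x f))
        ... | no f≢e = trans (others f f≢e) (sym (*-zeroˡ (x f)))
      cardA≤ : card A ≤ x e + 1ℚ
      cardA≤ = subst (λ p → card A ≤ p + 1ℚ) Σx≡ (spanning tp)
      cardB≥ : x e + 1ℚ ≤ card (A ∩ B)
      cardB≥ = ≤-trans (+-monoˡ-≤ 1ℚ (inside≤ B e (cong₂ _∧_ Ba Bb))) (forest tp B a (cong₂ _∧_ (proj₁ (ends e)) Ba))
      A⊆B : ∀ v → A v ≡ true → B v ≡ true
      A⊆B v Av = lem (B v) (trans (cong (λ c → ind (c ∧ B v)) (sym Av)) (trans (Σ-tight {f = λ v → ind (A v ∧ B v)} {g = λ v → ind (A v)}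
        (λ v → ind-mono (λ p → ∧-conicalˡ (A v) _ p)) (≤-trans cardA≤ cardB≥) v) (cong ind Av)))
        where
        lem : ∀ b → ind b ≡ 1ℚ → b ≡ true
        lem true _ = refl
        lem false ()
      a≢b : a ≢ b
      a≢b a≡b = <-irrefl refl (<-≤-trans xe>0 (≤-by (1ℚ - (x e + 1ℚ)) (diff≥0 (≤-trans cardB≥ (card≤1 a only))) (lem (x e))))
        where
        lem : ∀ p → 0ℚ ≡ p + (1ℚ - (p + 1ℚ))
        lem = solve-∀ ℚ-ring
        only : ∀ v → (A ∩ B) v ≡ true → v ≡ a
        only v p = ==⇒≡ (trans (sym (∨-idem (singleton a v))) (trans (cong (λ w → singleton a v ∨ singleton w v) a≡b) (∧-conicalʳ (A v) _ p)))
      xe≥1 : 1ℚ ≤ x e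
      xe≥1 = ≤-by _ (diff≥0 (≤-trans (card≥2 {X = A} a≢b (proj₁ (ends e)) (proj₂ (ends e))) cardA≤)) (lem (x e))
        where
        lem : ∀ p → p ≡ 1ℚ + (p + 1ℚ - (1ℚ + 1ℚ))
        lem = solve-∀ ℚ-ring
      below : ∀ f → ind (singleton e f) ≤ x f
      below f with f ≟ e
      ... | yes refl = xe≥1
      ... | no _ = x≥0 tp f
      connects : ConnectsOn G A (singleton e)
      connects X unc u v Au Av = trans (toA u Au) (sym (toA v Av))
        where
        Xa≡Xb : X a ≡ X b
        Xa≡Xb = lem (X a) (X b) (unc e (==-refl e))
          where
          lem : ∀ p q → p xor q ≡ false → p ≡ q
          lem true true _ = refl
          lem false false _ = refl
        toA : ∀ v → A v ≡ true → X v ≡ X a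
        toA v Av = byMember (singleton a v) (singleton b v) refl refl (A⊆B v Av)
          where
          byMember : ∀ p q → singleton a v ≡ p → singleton b v ≡ q → p ∨ q ≡ true → X v ≡ X a
          byMember true q p≡ _ _ = cong X (==⇒≡ p≡)
          byMember false true _ q≡ _ = trans (cong X (==⇒≡ q≡)) (sym Xa≡Xb)

    x≡0 : ∀ {e} → ¬ 0ℚ < x e → x e ≡ 0ℚ
    x≡0 {e} p = ≤-antisym (≮⇒≥ p) (x≥0 tp e)

    conclude : ¬ (∃ λ X → Separating X × Tight x X) → Dom (ConnectsOn G A) x ⊎ ∃ λ z → Direction rows x z
    conclude none = byFirst (Finₚ.any? (λ e → 0ℚ <? x e))
      where
      bySecond : ∀ e → 0ℚ < x e → Dec (∃ λ f → f ≢ e × 0ℚ < x f) → Dom (ConnectsOn G A) x ⊎ ∃ λ z → Direction rows x z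
      bySecond e p (yes (f , f≢e , q)) = inj₂ (difference f e , exchange none f e f≢e q p)
      bySecond e p (no alone) = inj₁ (oneEdge e p (λ f f≢e → x≡0 (λ q → alone (f , f≢e , q))))
      byFirst : Dec (∃ λ e → 0ℚ < x e) → Dom (ConnectsOn G A) x ⊎ ∃ λ z → Direction rows x z
      byFirst (yes (e , p)) = bySecond e p (Finₚ.any? (λ f → ¬? (f ≟ e) ×-dec (0ℚ <? x f)))
      byFirst (no noEdge) = inj₁ (empty (λ e → x≡0 (λ p → noEdge (e , p))))

  module _ (separating : ∀ x → TreePoint G A x → ∀ X → Separating X → Tight x X → Dom (ConnectsOn G A) x) where

    treeDominant : ∀ x → TreePoint G A x → Dom (ConnectsOn G A) x
    treeDominant x tp = faceInduction rows (Dom (ConnectsOn G A)) Dom-mix Dom-↑ (λ x feas → step x (fromFeasible x feas)) x (toFeasible x tp)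
      where
      step : ∀ x → TreePoint G A x → Dom (ConnectsOn G A) x ⊎ ∃ λ z → Direction rows x z
      step x tp = bySet (anySubset?
          (λ X → (two? (A ∩ X) ×-dec Finₚ.any? (λ w → (A ∩ ∁ X) w 𝔹ₚ.≟ true)) ×-dec ((inner G x X + 1ℚ) ℚₚ.≟ card (A ∩ X)))
          (λ X≗Y ((two , w , p) , t) → (Two-cong (λ v → cong (A v ∧_) (X≗Y v)) two , w , trans (cong (λ b → A w ∧ not b) (sym (X≗Y w))) p) ,
            trans (cong (_+ 1ℚ) (sym (inner-cong G x X≗Y))) (trans t (card-cong (λ v → cong (A v ∧_) (X≗Y v))))))
        where
        bySet : Dec (∃ λ X → Separating X × Tight x X) → Dom (ConnectsOn G A) x ⊎ ∃ λ z → Direction rows x z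
        bySet (yes (X , sep , t)) = inj₁ (separating x tp X sep t)
        bySet (no none) = AtPoint.conclude x tp none

-- Splitting a spanning tree at a tight set X₀ into a tree inside X₀ and a tree of the contraction.
module TreeSplit {n m} (G : Graph n m) (A : Subset n) (ends : EndsIn G A) (x : Fin m → ℚ) (tp : TreePoint G A x)
  (X₀ : Subset n) (u : Fin n) (Au : A u ≡ true) (X₀u : X₀ u ≡ true) (tight : inner G x X₀ + 1ℚ ≡ card (A ∩ X₀)) where

  ρ : Fin n → Fin n
  ρ = collapse X₀ u

  -- Both parts keep all edge labels. Edges not inside `X₀` become loops in `G₁`, edges inside
  -- become loops in `G₂`, and `x₁` and `x₂` vanish on the respective loops.
  G₁ G₂ : Graph n m
  G₁ = graph (λ e → if ins G X₀ e then src G e else u) (λ e → if ins G X₀ e then dst G e else u)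
  G₂ = contract G X₀ u

  A₁ A₂ : Subset n
  A₁ = A ∩ X₀
  A₂ = survivors A X₀ u

  x₁ x₂ : Fin m → ℚ
  x₁ e = ind (ins G X₀ e) * x e
  x₂ e = ind (not (ins G X₀ e)) * x e

  ends₁ : EndsIn G₁ A₁
  ends₁ e with X₀ (src G e) in p | X₀ (dst G e) in q
  ... | true | true = cong₂ _∧_ (proj₁ (ends e)) p , cong₂ _∧_ (proj₂ (ends e)) q
  ... | true | false = cong₂ _∧_ Au X₀u , cong₂ _∧_ Au X₀u
  ... | false | _ = cong₂ _∧_ Au X₀u , cong₂ _∧_ Au X₀u

  tp₁ : TreePoint G₁ A₁ x₁
  tp₁ = record
    { x≥0 = λ e → *-nonneg (ind≥0 (ins G X₀ e)) (x≥0 tp e)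
    ; forest = λ X v p → subst₂ (λ p q → p + 1ℚ ≤ q) (Σ-cong (λ e → sym (term X e))) (card-cong (λ v → sym (∧-assoc (A v) (X₀ v) (X v))))
        (forest tp (X₀ ∩ X) v (trans (sym (∧-assoc (A v) (X₀ v) (X v))) p))
    ; spanning = ≤-reflexive (sym tight) }
    where
    term : ∀ X e → ind (ins G₁ X e) * x₁ e ≡ ind (ins G (X₀ ∩ X) e) * x e
    term X e = lem (X₀ (src G e)) (X₀ (dst G e))
      where
      zero′ : ∀ p q → p * (0ℚ * q) ≡ 0ℚ * q
      zero′ = solve-∀ ℚ-ring
      lem : ∀ p q → ind (X (if p ∧ q then src G e else u) ∧ X (if p ∧ q then dst G e else u)) * (ind (p ∧ q) * x e)
        ≡ ind ((p ∧ X (src G e)) ∧ (q ∧ X (dst G e))) * x e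
      lem true true = cong (ind (X (src G e) ∧ X (dst G e)) *_) (*-identityˡ (x e))
      lem true false = trans (zero′ (ind (X u ∧ X u)) (x e)) (cong (λ b → ind b * x e) (sym (∧-zeroʳ (X (src G e)))))
      lem false q = zero′ (ind (X u ∧ X u)) (x e)

  -- The added 1 stands for `u`, which the right side counts twice: as a vertex of `X₀` and as its
  -- representative in the contraction.
  count : ∀ X → X u ≡ true → card (A ∩ (X ∘ ρ)) + 1ℚ ≡ card (A ∩ X₀) + card (A₂ ∩ X)
  count X Xu = trans (cong (card (A ∩ (X ∘ ρ)) +_) (sym (card-single u))) (trans (sym (Σ-+ (λ v → ind ((A ∩ (X ∘ ρ)) v)) (unit u)))
    (trans (Σ-cong pointwise) (Σ-+ (λ v → ind ((A ∩ X₀) v)) (λ v → ind ((A₂ ∩ X) v)))))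
    where
    pointwise : ∀ v → ind (A v ∧ X (ρ v)) + unit u v ≡ ind (A v ∧ X₀ v) + ind ((A v ∧ (not (X₀ v) ∨ singleton u v)) ∧ X v)
    pointwise v with v ≟ u
    ... | yes refl = lem (A u) (X₀ u) (X (ρ u)) (X u) Au X₀u (trans (cong X ρu) Xu) Xu
      where
      ρu : ρ u ≡ u
      ρu = cong (λ b → if b then u else u) X₀u
      lem : ∀ a x z y → a ≡ true → x ≡ true → z ≡ true → y ≡ true → ind (a ∧ z) + 1ℚ ≡ ind (a ∧ x) + ind ((a ∧ (not x ∨ true)) ∧ y)
      lem _ _ _ _ refl refl refl refl = refl
    ... | no v≢u = lem (A v) (X₀ v) refl
      where
      lem : ∀ a x → X₀ v ≡ x → ind (a ∧ X (if x then u else v)) + 0ℚ ≡ ind (a ∧ x) + ind ((a ∧ (not x ∨ false)) ∧ X v)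
      lem true true _ = cong (λ b → ind b + 0ℚ) Xu
      lem true false _ = ℚₚ.+-comm (ind (X v)) 0ℚ
      lem false _ _ = refl

  split : ∀ X → X u ≡ true → inner G x (X ∘ ρ) ≡ inner G x X₀ + inner G₂ x₂ X
  split X Xu = trans (Σ-cong pointwise) (Σ-+ (λ e → ind (ins G X₀ e) * x e) (λ e → ind (ins G₂ X e) * x₂ e))
    where
    pointwise : ∀ e → ind (ins G (X ∘ ρ) e) * x e ≡ ind (ins G X₀ e) * x e + ind (ins G₂ X e) * (ind (not (ins G X₀ e)) * x e)
    pointwise e = lem (X₀ (src G e)) (X₀ (dst G e))
      where
      lem₁ : ∀ q → 1ℚ * q ≡ 1ℚ * q + 1ℚ * (0ℚ * q)
      lem₁ = solve-∀ ℚ-ring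
      lem₂ : ∀ p q → p * q ≡ 0ℚ * q + p * (1ℚ * q)
      lem₂ = solve-∀ ℚ-ring
      lem : ∀ p q → ind (X (if p then u else src G e) ∧ X (if q then u else dst G e)) * x e
        ≡ ind (p ∧ q) * x e + ind (X (if p then u else src G e) ∧ X (if q then u else dst G e)) * (ind (not (p ∧ q)) * x e)
      lem true true = trans (cong (λ b → ind (b ∧ b) * x e) Xu) (trans (lem₁ (x e)) (cong (λ b → 1ℚ * x e + ind (b ∧ b) * (0ℚ * x e)) (sym Xu)))
      lem true false = lem₂ (ind (X u ∧ X (dst G e))) (x e)
      lem false q = lem₂ (ind (X (src G e) ∧ X (if q then u else dst G e))) (x e)

  tp₂ : TreePoint G₂ A₂ x₂
  tp₂ = record { x≥0 = x₂≥0 ; forest = λ X v p → forest₂ X v p (X u) refl ; spanning = spanning₂ }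
    where
    x₂≥0 : ∀ e → 0ℚ ≤ x₂ e
    x₂≥0 e = *-nonneg (ind≥0 (not (ins G X₀ e))) (x≥0 tp e)
    arith : ∀ i₂ c₀ c c₂ iZ → iZ + 1ℚ ≤ c → iZ + 1ℚ ≡ c₀ + i₂ → c + 1ℚ ≡ c₀ + c₂ → i₂ + 1ℚ ≤ c₂
    arith i₂ c₀ c c₂ iZ le eq₁ eq₂ = ≤-by _ (diff≥0 le) (trans (lem c₀ c₂) (trans (cong (_- c₀) (sym eq₂)) (trans (lem′ c c₀ (iZ + 1ℚ)) (trans (cong (λ q → q - c₀ + 1ℚ + (c - (iZ + 1ℚ))) eq₁) (lem″ c₀ i₂ (c - (iZ + 1ℚ)))))))
      where
      lem : ∀ p q → q ≡ p + q - p
      lem = solve-∀ ℚ-ring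
      lem′ : ∀ c c₀ i → c + 1ℚ - c₀ ≡ i - c₀ + 1ℚ + (c - i)
      lem′ = solve-∀ ℚ-ring
      lem″ : ∀ c₀ i d → c₀ + i - c₀ + 1ℚ + d ≡ i + 1ℚ + d
      lem″ = solve-∀ ℚ-ring
    splitTight : ∀ X → X u ≡ true → inner G x (X ∘ ρ) + 1ℚ ≡ card (A ∩ X₀) + inner G₂ x₂ X
    splitTight X Xu = trans (cong (_+ 1ℚ) (split X Xu)) (trans (lem (inner G x X₀) (inner G₂ x₂ X)) (cong (_+ inner G₂ x₂ X) tight))
      where
      lem : ∀ p q → p + q + 1ℚ ≡ p + 1ℚ + q
      lem = solve-∀ ℚ-ring
    -- If `X` contains `u`, its pull-back contains `X₀`, and tightness of `X₀` allows its share to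
    -- be subtracted from both sides. Otherwise the pull-back has the same active vertices as `X`,
    -- and `x₂` ≤ `x`.
    forest₂ : ∀ X v → (A₂ ∩ X) v ≡ true → ∀ b → X u ≡ b → inner G₂ x₂ X + 1ℚ ≤ card (A₂ ∩ X)
    forest₂ X v p true Xu = arith (inner G₂ x₂ X) (card (A ∩ X₀)) (card (A ∩ (X ∘ ρ))) (card (A₂ ∩ X)) (inner G x (X ∘ ρ))
      (forest tp (X ∘ ρ) u (cong₂ _∧_ Au (trans (cong (λ b → X (if b then u else u)) X₀u) Xu))) (splitTight X Xu) (count X Xu)
    forest₂ X v p false Xu = ≤-trans (+-monoˡ-≤ 1ℚ (Σ-mono smaller)) (subst (inner G x (X ∘ ρ) + 1ℚ ≤_) (card-cong same)
      (forest tp (X ∘ ρ) v (trans (same v) p)))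
      where
      smaller : ∀ e → ind (ins G₂ X e) * x₂ e ≤ ind (ins G₂ X e) * x e
      smaller e = *-mono _ (ind≥0 (ins G₂ X e)) (lem (ins G X₀ e))
        where
        lem : ∀ b → ind (not b) * x e ≤ x e
        lem true = subst (_≤ x e) (sym (*-zeroˡ (x e))) (x≥0 tp e)
        lem false = ≤-reflexive (*-identityˡ (x e))
      same : ∀ v → A v ∧ X (ρ v) ≡ (A v ∧ (not (X₀ v) ∨ singleton u v)) ∧ X v
      same v = lem (X₀ v) (singleton u v) refl
        where
        lem : ∀ x s → singleton u v ≡ s → A v ∧ X (if x then u else v) ≡ (A v ∧ (not x ∨ s)) ∧ X v
        lem true true eq = trans (cong (A v ∧_) Xu) (trans (∧-zeroʳ (A v)) (sym (trans (cong ((A v ∧ true) ∧_) (trans (cong X (==⇒≡ eq)) Xu)) (∧-zeroʳ (A v ∧ true)))))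
        lem true false eq = trans (cong (A v ∧_) Xu) (trans (∧-zeroʳ (A v)) (sym (cong (_∧ X v) (∧-zeroʳ (A v)))))
        lem false s eq = cong (_∧ X v) (sym (∧-identityʳ (A v)))
    spanning₂ : card A₂ ≤ Σv x₂ + 1ℚ
    spanning₂ = ≤-by _ (diff≥0 (spanning tp)) (sym (trans (cong₂ (λ p q → p + (Σv x + 1ℚ - q)) (trans (lem (card (A ∩ X₀)) (card A₂)) (cong (_- card (A ∩ X₀)) (sym count′))) refl)
        (trans (cong (λ q → card A + 1ℚ - card (A ∩ X₀) + (q - card A)) total′) (lem′ (card A) (card (A ∩ X₀)) (Σv x₂)))))
      where
      lem : ∀ p q → q ≡ p + q - p
      lem = solve-∀ ℚ-ring
      lem′ : ∀ a c s → a + 1ℚ - c + (c + s - a) ≡ s + 1ℚ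
      lem′ = solve-∀ ℚ-ring
      count′ : card A + 1ℚ ≡ card (A ∩ X₀) + card A₂
      count′ = trans (cong (_+ 1ℚ) (card-cong (λ v → sym (∧-identityʳ (A v))))) (trans (count full refl) (cong (card (A ∩ X₀) +_) (card-cong (λ v → ∧-identityʳ (A₂ v)))))
      sum-full : ∀ (w : Fin m → ℚ) → (λ _ → 1ℚ) · w ≡ Σv w
      sum-full w = trans (Σ-*ˡ 1ℚ w) (*-identityˡ (Σv w))
      total′ : Σv x + 1ℚ ≡ card (A ∩ X₀) + Σv x₂
      total′ = trans (cong (_+ 1ℚ) (sym (sum-full x))) (trans (splitTight full refl) (cong (card (A ∩ X₀) +_) (sum-full x₂)))

  union : (Fin m → Bool) → (Fin m → Bool) → Fin m → Bool
  union S₁ S₂ e = if ins G X₀ e then S₁ e else S₂ e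

  -- A set uncrossed by the union is constant on `A ∩ X₀` by the first tree. So `ρ` does not change
  -- its values on `A`, it is uncrossed in the contraction too, and the second tree applies.
  union-connects : ∀ {S₁ S₂} → ConnectsOn G₁ A₁ S₁ → ConnectsOn G₂ A₂ S₂ → ConnectsOn G A (union S₁ S₂)
  union-connects {S₁} {S₂} conn₁ conn₂ X unc v w Av Aw = trans (sym (toρ v Av)) (trans (conn₂ X unc₂ (ρ v) (ρ w) (collapse-survives A X₀ Au v Av) (collapse-survives A X₀ Au w Aw)) (toρ w Aw))
    where
    unc₁ : Uncrossed G₁ S₁ X
    unc₁ e Se = lem (ins G X₀ e) refl
      where
      lem : ∀ b → ins G X₀ e ≡ b → X (if b then src G e else u) xor X (if b then dst G e else u) ≡ false
      lem true eq = unc e (trans (cong (λ b → if b then S₁ e else S₂ e) eq) Se)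
      lem false eq = xor-same (X u)
    toρ : ∀ v → A v ≡ true → X (ρ v) ≡ X v
    toρ v Av with X₀ v in eq
    ... | true = conn₁ X unc₁ u v (cong₂ _∧_ Au X₀u) (cong₂ _∧_ Av eq)
    ... | false = refl
    unc₂ : Uncrossed G₂ S₂ X
    unc₂ e Se = lem (ins G X₀ e) refl
      where
      lem : ∀ b → ins G X₀ e ≡ b → X (ρ (src G e)) xor X (ρ (dst G e)) ≡ false
      lem true eq = trans (cong₂ (λ p q → X (if p then u else src G e) xor X (if q then u else dst G e)) (∧-conicalˡ (X₀ (src G e)) _ eq) (∧-conicalʳ (X₀ (src G e)) _ eq)) (xor-same (X u))
      lem false eq = trans (cong₂ _xor_ (toρ _ (proj₁ (ends e))) (toρ _ (proj₂ (ends e)))) (unc e (trans (cong (λ b → if b then S₁ e else S₂ e) eq) Se))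

  -- Any two trees are compatible, unlike the joins above, so they are drawn independently (`κ` =
  -- 1).
  merge : Dom (ConnectsOn G₁ A₁) x₁ → Dom (ConnectsOn G₂ A₂) x₂ → Dom (ConnectsOn G A) x
  merge (dom L₁ t₁ b₁) (dom L₂ t₂ b₂) = dom (couple L₁ L₂ κ κ≥0 (λ _ → t₂) (λ _ → t₁) g)
    (trans (𝔼-coupleˡ L₁ L₂ κ κ≥0 (λ _ → t₂) (λ _ → t₁) g (λ _ → 1ℚ) (λ _ → 1ℚ) (λ _ _ _ → refl)) t₁) (λ e → bound e (ins G X₀ e) refl)
    where
    κ : Σ (Fin m → Bool) (ConnectsOn G₁ A₁) → Σ (Fin m → Bool) (ConnectsOn G₂ A₂) → ℚ
    κ _ _ = 1ℚ
    κ≥0 : ∀ a b → 0ℚ ≤ κ a b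
    κ≥0 _ _ = 0≤1
    g : ∀ a b → 0ℚ < κ a b → Σ (Fin m → Bool) (ConnectsOn G A)
    g (S₁ , c₁) (S₂ , c₂) _ = union S₁ S₂ , union-connects c₁ c₂
    bound : ∀ e b → ins G X₀ e ≡ b → 𝔼 (couple L₁ L₂ κ κ≥0 (λ _ → t₂) (λ _ → t₁) g) (λ S → ind (proj₁ S e)) ≤ x e
    bound e true eq = subst₂ _≤_ (sym (𝔼-coupleˡ L₁ L₂ κ κ≥0 (λ _ → t₂) (λ _ → t₁) g (λ S → ind (proj₁ S e)) (λ a → ind (proj₁ a e))
      (λ a b _ → cong (λ c → ind (if c then proj₁ a e else proj₁ b e)) eq))) (trans (cong (λ b → ind b * x e) eq) (*-identityˡ (x e))) (b₁ e)
    bound e false eq = subst₂ _≤_ (sym (𝔼-coupleʳ L₁ L₂ κ κ≥0 (λ _ → t₂) (λ _ → t₁) g (λ S → ind (proj₁ S e)) (λ b → ind (proj₁ b e))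
      (λ a b _ → cong (λ c → ind (if c then proj₁ a e else proj₁ b e)) eq))) (trans (cong (λ b → ind (not b) * x e) eq) (*-identityˡ (x e))) (b₂ e)

-- Induction on the number of active vertices: a separating set omits one, which makes the inner
-- part smaller, and contains two, which makes the contraction smaller.
treePolytope : ∀ k {n m} (G : Graph n m) A → EndsIn G A → # A ℕ.< k → ∀ x → TreePoint G A x → Dom (ConnectsOn G A) x
treePolytope (suc k) {n} {m} G A ends (ℕ.s≤s lt) = treeDominant separating
  where
  open TreeStep G A ends
  separating : ∀ x → TreePoint G A x → ∀ X → Separating X → Tight x X → Dom (ConnectsOn G A) x
  separating x tp X₀ (two@(u , _ , _ , p , _) , w , q) tight = merge
    (treePolytope k G₁ A₁ ends₁ (ℕₚ.<-≤-trans (#-strict (λ v → ∧-conicalˡ (A v) _) w (trans (cong (A w ∧_) (not-injective (∧-conicalʳ (A w) _ q))) (∧-zeroʳ (A w))) (∧-conicalˡ (A w) _ q)) lt) x₁ tp₁)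
    (treePolytope k G₂ A₂ (contract-endsIn G A X₀ (∧-conicalˡ (A u) _ p) ends) (ℕₚ.<-≤-trans (survivors-< A X₀ two) lt) x₂ tp₂)
    where
    open TreeSplit G A ends x tp X₀ u (∧-conicalˡ (A u) _ p) (∧-conicalʳ (A u) _ p) tight

-- Tours from trees and joins

2ℚ : ℚ
2ℚ = 1ℚ + 1ℚ

isYes-yes : ∀ {P : Set} (d : Dec P) → P → isYes d ≡ true
isYes-yes (yes _) p = refl
isYes-yes (no ¬p) p = ⊥-elim (¬p p)

isYes-no : ∀ {P : Set} (d : Dec P) → ¬ P → isYes d ≡ false
isYes-no (yes p) ¬p = ⊥-elim (¬p p)
isYes-no (no _) ¬p = refl

toℚ≥0 : ∀ k → 0ℚ ≤ toℚ k
toℚ≥0 zero = ≤-refl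
toℚ≥0 (suc k) = +-nonneg 0≤1 (toℚ≥0 k)

==-sym : ∀ {n} (u v : Fin n) → singleton u v ≡ singleton v u
==-sym u v with v ≟ u | u ≟ v
... | yes _ | yes _ = refl
... | no _ | no _ = refl
... | yes p | no q = ⊥-elim (q (sym p))
... | no p | yes q = ⊥-elim (p (sym q))

par-unique : ∀ {k} (f : Fin k → Bool) i → (∀ j → j ≢ i → f j ≡ false) → par f ≡ f i
par-unique f i h = trans (par-cong pointwise) (par-single i f)
  where
  pointwise : ∀ j → f j ≡ f j ∧ singleton j i
  pointwise j with i ≟ j
  ... | yes refl = sym (∧-identityʳ (f j))
  ... | no i≢j = trans (h j (i≢j ∘ sym)) (sym (∧-zeroʳ (f j)))

xor-cancel : ∀ a b → a xor (a xor b) ≡ b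
xor-cancel true b = not-involutive b
xor-cancel false b = refl

xor≡false⇒≡ : ∀ a b → a xor b ≡ false → a ≡ b
xor≡false⇒≡ true true _ = refl
xor≡false⇒≡ false false _ = refl

constant⇒uncrossed : ∀ {n m} (G : Graph n m) X → (∀ u v → X u ≡ X v) → ∀ e → cross G X e ≡ false
constant⇒uncrossed G X const e = trans (cong (X (src G e) xor_) (const (dst G e) (src G e))) (xor-same (X (src G e)))

#-mono : ∀ {n} {X Y : Subset n} → (∀ v → X v ≡ true → Y v ≡ true) → # X ℕ.≤ # Y
#-mono h = Σℕ-mono (λ v → bit-mono (h v))

#-cong : ∀ {n} {X Y : Subset n} → X ≗ Y → # X ≡ # Y
#-cong {X = X} {Y} X≗Y = ℕₚ.≤-antisym (#-mono {X = X} {Y} (λ v p → trans (sym (X≗Y v)) p)) (#-mono {X = Y} {X} (λ v p → trans (X≗Y v) p))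

#≤n : ∀ {n} (X : Subset n) → # X ℕ.≤ n
#≤n {n} X = subst (# X ℕ.≤_) (#-∁ X) (ℕₚ.m≤n+m (# X) (# (∁ X)))

-- Both conditions are imposed on cuts; on singletons `parity` says that the odd vertices form the
-- symmetric difference of {s} and {t}.
record IsTour {n m} (G : Graph n m) (s t : Fin n) (M : Fin m → ℕ) : Set where
  field
    parity : ∀ X → par (λ e → oddℕ (M e) ∧ cross G X e) ≡ X s xor X t
    connects : ∀ X → (∀ e → 0 ℕ.< M e → cross G X e ≡ false) → ∀ u v → X u ≡ X v

module Tours {n m} (G : Graph n m) (s t : Fin n) (x : Fin m → ℚ) (x≥0 : ∀ e → 0ℚ ≤ x e)
  (loops : ∀ e → src G e ≡ dst G e → x e ≡ 0ℚ)
  (degree : ∀ v → cut G x (singleton v) ≡ 2ℚ - ind (singleton s v) - ind (singleton t v))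
  (cut≥2 : ∀ X v → X v ≡ true → X s ≡ false → X t ≡ false → 2ℚ ≤ cut G x X)
  (cut≥1 : ∀ X → X s ≢ X t → 1ℚ ≤ cut G x X)
  where

  -- Both sides are the sum of x(δ(v)) over v in X, computed once by edges and once by the degree
  -- constraints.
  handshake : ∀ X → inner G x X + inner G x X + cut G x X ≡ card X + card X - ind (X s) - ind (X t)
  handshake X = trans (sym edges) vertices
    where
    degreeSum = Σv (λ v → ind (X v) * cut G x (singleton v))
    edges : degreeSum ≡ inner G x X + inner G x X + cut G x X
    edges = begin
      Σv (λ v → ind (X v) * cut G x (singleton v)) ≡⟨ Σ-cong (λ v → sym (Σ-*ˡ (ind (X v)) (λ e → ind (cross G (singleton v) e) * x e))) ⟩
      Σv (λ v → Σv (λ e → ind (X v) * (ind (cross G (singleton v) e) * x e))) ≡⟨ Σ-comm (λ v e → ind (X v) * (ind (cross G (singleton v) e) * x e)) ⟩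
      Σv (λ e → Σv (λ v → ind (X v) * (ind (cross G (singleton v) e) * x e))) ≡⟨ Σ-cong perEdge ⟩
      Σv (λ e → i e + i e + c e) ≡⟨ Σ-+ (λ e → i e + i e) c ⟩
      Σv (λ e → i e + i e) + Σv c ≡⟨ cong (_+ Σv c) (Σ-+ i i) ⟩
      inner G x X + inner G x X + cut G x X ∎
      where
      open ≡-Reasoning
      i c : Fin m → ℚ
      i e = ind (ins G X e) * x e
      c e = ind (cross G X e) * x e
      perEdge : ∀ e → Σv (λ v → ind (X v) * (ind (cross G (singleton v) e) * x e)) ≡ i e + i e + c e
      perEdge e = byLoop (src G e ≟ dst G e)
        where
        a = src G e
        b = dst G e
        byLoop : Dec (a ≡ b) → Σv (λ v → ind (X v) * (ind (cross G (singleton v) e) * x e)) ≡ i e + i e + c e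
        byLoop (yes a≡b) = trans (Σ-zero (λ v → trans (cong (λ q → ind (X v) * (ind (cross G (singleton v) e) * q)) (loops e a≡b)) (lem (ind (X v)) (ind (cross G (singleton v) e)))))
          (sym (trans (cong (λ q → ind (ins G X e) * q + ind (ins G X e) * q + ind (cross G X e) * q) (loops e a≡b)) (lem′ (ind (ins G X e)) (ind (cross G X e)))))
          where
          lem : ∀ p q → p * (q * 0ℚ) ≡ 0ℚ
          lem = solve-∀ ℚ-ring
          lem′ : ∀ p q → p * 0ℚ + p * 0ℚ + q * 0ℚ ≡ 0ℚ
          lem′ = solve-∀ ℚ-ring
        byLoop (no a≢b) = trans (Σ-cong (λ v → trans (cong (λ p → ind (X v) * (p * x e)) (perVertex v)) (lem (ind (X v)) (unit a v) (unit b v) (x e))))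
          (trans (Σ-+ (λ v → unit a v * (ind (X v) * x e)) (λ v → unit b v * (ind (X v) * x e)))
          (trans (cong₂ _+_ (Σ-single a (λ v → ind (X v) * x e)) (Σ-single b (λ v → ind (X v) * x e))) (byEnds (X a) (X b))))
          where
          lem : ∀ p q r x → p * ((q + r) * x) ≡ q * (p * x) + r * (p * x)
          lem = solve-∀ ℚ-ring
          perVertex : ∀ v → ind (singleton v a xor singleton v b) ≡ unit a v + unit b v
          perVertex v = trans (cong₂ (λ p q → ind (p xor q)) (==-sym v a) (==-sym v b)) (disjoint (singleton a v) (singleton b v) (λ p q → a≢b (trans (sym (==⇒≡ p)) (==⇒≡ q))))
            where
            disjoint : ∀ p q → (p ≡ true → q ≡ true → ⊥) → ind (p xor q) ≡ ind p + ind q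
            disjoint true true h = ⊥-elim (h refl refl)
            disjoint true false h = refl
            disjoint false true h = refl
            disjoint false false h = refl
          lem₁ : ∀ x → 1ℚ * x + 1ℚ * x ≡ 1ℚ * x + 1ℚ * x + 0ℚ * x
          lem₁ = solve-∀ ℚ-ring
          lem₂ : ∀ x → 1ℚ * x + 0ℚ * x ≡ 0ℚ * x + 0ℚ * x + 1ℚ * x
          lem₂ = solve-∀ ℚ-ring
          lem₃ : ∀ x → 0ℚ * x + 1ℚ * x ≡ 0ℚ * x + 0ℚ * x + 1ℚ * x
          lem₃ = solve-∀ ℚ-ring
          lem₄ : ∀ x → 0ℚ * x + 0ℚ * x ≡ 0ℚ * x + 0ℚ * x + 0ℚ * x
          lem₄ = solve-∀ ℚ-ring
          byEnds : ∀ p q → ind p * x e + ind q * x e ≡ ind (p ∧ q) * x e + ind (p ∧ q) * x e + ind (p xor q) * x e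
          byEnds true true = lem₁ (x e)
          byEnds true false = lem₂ (x e)
          byEnds false true = lem₃ (x e)
          byEnds false false = lem₄ (x e)
    vertices : degreeSum ≡ card X + card X - ind (X s) - ind (X t)
    vertices = begin
      Σv (λ v → ind (X v) * cut G x (singleton v)) ≡⟨ Σ-cong (λ v → trans (cong (ind (X v) *_) (degree v)) (lem (ind (X v)) (unit s v) (unit t v))) ⟩
      Σv (λ v → ind (X v) + ind (X v) + (- 1ℚ) * (unit s v * ind (X v) + unit t v * ind (X v)))
        ≡⟨ Σ-+ (λ v → ind (X v) + ind (X v)) (λ v → (- 1ℚ) * (unit s v * ind (X v) + unit t v * ind (X v))) ⟩
      Σv (λ v → ind (X v) + ind (X v)) + Σv (λ v → (- 1ℚ) * (unit s v * ind (X v) + unit t v * ind (X v)))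
        ≡⟨ cong₂ _+_ (Σ-+ (λ v → ind (X v)) (λ v → ind (X v))) (trans (Σ-*ˡ (- 1ℚ) (λ v → unit s v * ind (X v) + unit t v * ind (X v)))
            (cong ((- 1ℚ) *_) (trans (Σ-+ (λ v → unit s v * ind (X v)) (λ v → unit t v * ind (X v))) (cong₂ _+_ (Σ-single s (λ v → ind (X v))) (Σ-single t (λ v → ind (X v))))))) ⟩
      card X + card X + (- 1ℚ) * (ind (X s) + ind (X t)) ≡⟨ lem′ (card X) (ind (X s)) (ind (X t)) ⟩
      card X + card X - ind (X s) - ind (X t) ∎
      where
      open ≡-Reasoning
      lem : ∀ p q r → p * (2ℚ - q - r) ≡ p + p + (- 1ℚ) * (q * p + r * p)
      lem = solve-∀ ℚ-ring
      lem′ : ∀ c p q → c + c + (- 1ℚ) * (p + q) ≡ c + c - p - q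
      lem′ = solve-∀ ℚ-ring

  cut≥0 : ∀ X → 0ℚ ≤ cut G x X
  cut≥0 X = Σ-nonneg (λ e → *-nonneg (ind≥0 (cross G X e)) (x≥0 e))

  halve : ∀ {p q} → p + p ≤ q + q → p ≤ q
  halve {p} {q} le = subst₂ _≤_ (½*2′ p) (½*2′ q) (*-mono ½ (<⇒≤ 0<½) le)
    where
    ½*2′ : ∀ p → ½ * (p + p) ≡ p
    ½*2′ = solve-∀ ℚ-ring

  treePoint : TreePoint G full x
  treePoint = record { x≥0 = x≥0 ; forest = forest′ ; spanning = spanning′ }
    where
    -- By `handshake` this is equivalent to x(E[X]) ≤ |X| - 1: what the cut constraint lacks when X
    -- contains s or t is made up for by their smaller degrees.
    enough : ∀ X v → X v ≡ true → 2ℚ ≤ cut G x X + (ind (X s) + ind (X t))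
    enough X v Xv = cases (X s) (X t) refl refl
      where
      cases : ∀ p q → X s ≡ p → X t ≡ q → 2ℚ ≤ cut G x X + (ind p + ind q)
      cases true true _ _ = ≤-by (cut G x X) (cut≥0 X) (ℚₚ.+-comm (cut G x X) 2ℚ)
      cases true false p q = +-monoˡ-≤ 1ℚ (cut≥1 X (λ eq → true≢false (trans (sym p) (trans eq q))))
      cases false true p q = +-monoˡ-≤ 1ℚ (cut≥1 X (λ eq → true≢false (trans (sym q) (trans (sym eq) p))))
      cases false false p q = ≤-trans (cut≥2 X v Xv p q) (≤-by 0ℚ ≤-refl (lem (cut G x X)))
        where
        lem : ∀ c → c + (0ℚ + 0ℚ) ≡ c + 0ℚ
        lem = solve-∀ ℚ-ring
    forest′ : ∀ X v → (full ∩ X) v ≡ true → inner G x X + 1ℚ ≤ card (full ∩ X)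
    forest′ X v Xv = halve (≤-by _ (diff≥0 (enough X v Xv)) (trans (lem (card X) (ind (X s)) (ind (X t)))
      (trans (cong (_+ (ind (X s) + ind (X t))) (sym (handshake X))) (lem′ (inner G x X) (cut G x X) (ind (X s)) (ind (X t))))))
      where
      lem : ∀ c p q → c + c ≡ c + c - p - q + (p + q)
      lem = solve-∀ ℚ-ring
      lem′ : ∀ i c p q → i + i + c + (p + q) ≡ i + 1ℚ + (i + 1ℚ) + (c + (p + q) - 2ℚ)
      lem′ = solve-∀ ℚ-ring
    spanning′ : card (full {n}) ≤ Σv x + 1ℚ
    spanning′ = halve {card (full {n})} {Σv x + 1ℚ} (≤-reflexive (trans (lem (card (full {n}))) (trans (cong (_+ 2ℚ) (sym (handshake full)))
      (trans (cong₂ (λ p q → p + p + q + 2ℚ) (trans (Σ-*ˡ 1ℚ x) (*-identityˡ (Σv x))) (Σ-zero (λ e → *-zeroˡ (x e)))) (lem′ (Σv x))))))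
      where
      lem : ∀ c → c + c ≡ c + c - 1ℚ - 1ℚ + 2ℚ
      lem = solve-∀ ℚ-ring
      lem′ : ∀ s → s + s + 0ℚ + 2ℚ ≡ s + 1ℚ + (s + 1ℚ)
      lem′ = solve-∀ ℚ-ring

  -- Narrow cuts, represented by their side containing s

  Narrow : Subset n → Set
  Narrow U = U s ≡ true × U t ≡ false × cut G x U < 2ℚ

  narrow? : ∀ U → Dec (Narrow U)
  narrow? U = (U s 𝔹ₚ.≟ true) ×-dec ((U t 𝔹ₚ.≟ false) ×-dec (cut G x U <? 2ℚ))

  Narrow-cong : ∀ {U W} → U ≗ W → Narrow U → Narrow W
  Narrow-cong U≗W (p , q , r) = trans (sym (U≗W s)) p , trans (sym (U≗W t)) q , subst (_< 2ℚ) (cut-cong G x U≗W) r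

  -- Posimodularity rather than submodularity: the two differences avoid both s and t, so `cut≥2`
  -- applies to them when they are nonempty.
  uncross : ∀ U W → cut G x (U ∩ ∁ W) + cut G x (W ∩ ∁ U) ≤ cut G x U + cut G x W
  uncross U W = subst₂ _≤_ (Σ-+ (term (U ∩ ∁ W)) (term (W ∩ ∁ U))) (Σ-+ (term U) (term W)) (Σ-mono perEdge)
    where
    term : Subset n → Fin m → ℚ
    term X e = ind (cross G X e) * x e
    perEdge : ∀ e → term (U ∩ ∁ W) e + term (W ∩ ∁ U) e ≤ term U e + term W e
    perEdge e = subst₂ _≤_ (lem (x e) (ind (cross G (U ∩ ∁ W) e)) (ind (cross G (W ∩ ∁ U) e))) (lem (x e) (ind (cross G U e)) (ind (cross G W e)))
      (*-mono (x e) (x≥0 e) (bool (U (src G e)) (U (dst G e)) (W (src G e)) (W (dst G e))))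
      where
      lem : ∀ x p q → x * (p + q) ≡ p * x + q * x
      lem = solve-∀ ℚ-ring
      0≤2 : 0ℚ ≤ 2ℚ
      0≤2 = +-nonneg 0≤1 0≤1
      bool : ∀ u u′ w w′ → ind ((u ∧ not w) xor (u′ ∧ not w′)) + ind ((w ∧ not u) xor (w′ ∧ not u′)) ≤ ind (u xor u′) + ind (w xor w′)
      bool true true true true = ≤-refl
      bool true true true false = ≤-refl
      bool true true false true = ≤-refl
      bool true true false false = ≤-refl
      bool true false true true = ≤-refl
      bool true false true false = 0≤2
      bool true false false true = ≤-refl
      bool true false false false = ≤-refl
      bool false true true true = ≤-refl
      bool false true true false = ≤-refl
      bool false true false true = 0≤2
      bool false true false false = ≤-refl
      bool false false true true = ≤-refl
      bool false false true false = ≤-refl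
      bool false false false true = ≤-refl
      bool false false false false = ≤-refl

  -- Two nonempty differences would have cuts of value at least 2 each, against a total below 4.
  chain : ∀ {U W} → Narrow U → Narrow W → ∀ v w → U v ≡ true → W v ≡ false → W w ≡ true → U w ≡ false → ⊥
  chain {U} {W} (Us , Ut , U<2) (Ws , Wt , W<2) v w Uv Wv Ww Uw = <-irrefl refl (<-≤-trans (+-mono-< U<2 W<2)
    (≤-trans (+-mono-≤
      (cut≥2 (U ∩ ∁ W) v (cong₂ (λ p q → p ∧ not q) Uv Wv) (cong₂ (λ p q → p ∧ not q) Us Ws) (cong₂ (λ p q → p ∧ not q) Ut Wt))
      (cut≥2 (W ∩ ∁ U) w (cong₂ (λ p q → p ∧ not q) Ww Uw) (cong₂ (λ p q → p ∧ not q) Ws Us) (cong₂ (λ p q → p ∧ not q) Wt Ut)))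
      (uncross U W)))

  narrow-⊆ : ∀ {U W} → Narrow U → Narrow W → # U ℕ.≤ # W → ∀ v → U v ≡ true → W v ≡ true
  narrow-⊆ {U} {W} nU nW le v Uv = ¬-not (λ Wv → ℕₚ.<-irrefl refl (ℕₚ.<-≤-trans
    (#-strict {X = W} {U} (λ w Ww → ¬-not (λ Uw → chain nU nW v w Uv Wv Ww Uw)) v Wv Uv) le))

  narrow-≗ : ∀ {U W} → Narrow U → Narrow W → # U ≡ # W → U ≗ W
  narrow-≗ {U} {W} nU nW eq v with U v in p | W v in q
  ... | true | true = refl
  ... | false | false = refl
  ... | true | false = trans (sym (narrow-⊆ nU nW (ℕₚ.≤-reflexive eq) v p)) q
  ... | false | true = trans (sym p) (narrow-⊆ nW nU (ℕₚ.≤-reflexive (sym eq)) v q)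

  -- The set `U ⊕ W` avoids s and t and is crossed by no edge, so by `cut≥2` it is empty.
  sameCut⇒≗ : ∀ {U W} → Narrow U → Narrow W → (∀ e → cross G U e ≡ cross G W e) → U ≗ W
  sameCut⇒≗ {U} {W} (Us , Ut , _) (Ws , Wt , _) same v = xor≡false⇒≡ (U v) (W v) (¬-not (λ p →
    <-irrefl refl (<-≤-trans (+-pos 0<1 0<1) (subst (2ℚ ≤_) (Σ-zero (λ e → trans (cong (λ b → ind b * x e) (uncrossed e)) (*-zeroˡ (x e))))
      (cut≥2 (U ⊕ W) v p (cong₂ _xor_ Us Ws) (cong₂ _xor_ Ut Wt))))))
    where
    uncrossed : ∀ e → cross G (U ⊕ W) e ≡ false
    uncrossed e = trans (cross-⊕ G U W e) (trans (cong (cross G U e xor_) (sym (same e))) (xor-same (cross G U e)))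

  module _ (noThree : ∀ e U₁ U₂ U₃ → Narrow U₁ → Narrow U₂ → Narrow U₃ →
      cross G U₁ e ≡ true → cross G U₂ e ≡ true → cross G U₃ e ≡ true →
      ¬ (∀ f → cross G U₁ f ≡ cross G U₂ f) → ¬ (∀ f → cross G U₁ f ≡ cross G U₃ f) → ¬ (∀ f → cross G U₂ f ≡ cross G U₃ f) → ⊥) where

    -- Narrow cuts are indexed by their size and coloured by the parity of their rank in the chain.
    NarrowAt : ℕ → Set
    NarrowAt c = ∃ λ U → Narrow U × # U ≡ c

    narrowAt? : ∀ c → Dec (NarrowAt c)
    narrowAt? c = anySubset? (λ U → narrow? U ×-dec (# U ℕ.≟ c)) (λ U≗W (nU , eq) → Narrow-cong U≗W nU , trans (sym (#-cong U≗W)) eq)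

    present : ℕ → Bool
    present c = isYes (narrowAt? c)

    witness : ∀ {c} → Dec (NarrowAt c) → Subset n
    witness (yes (U , _)) = U
    witness (no _) = ∅

    level : ℕ → Subset n
    level c = witness (narrowAt? c)

    level-narrow : ∀ c → present c ≡ true → Narrow (level c) × # (level c) ≡ c
    level-narrow c p = lem (narrowAt? c) p
      where
      lem : ∀ (d : Dec (NarrowAt c)) → isYes d ≡ true → Narrow (witness d) × # (witness d) ≡ c
      lem (yes (_ , q)) _ = q

    present⁺ : ∀ U → Narrow U → present (# U) ≡ true
    present⁺ U nU = isYes-yes (narrowAt? (# U)) (U , nU , refl)

    colour : ℕ → Bool
    colour zero = false
    colour (suc c) = present c xor colour c

    -- As long as no further narrow cut is met above `c`, the colour has switched only once, at `c`
    -- itself.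
    between : ∀ c k → present c ≡ true → (∃ λ d → c ℕ.< d × d ℕ.< suc c ℕ.+ k × present d ≡ true) ⊎ colour (suc c ℕ.+ k) ≡ not (colour c)
    between c zero p = inj₂ (trans (cong colour (cong suc (ℕₚ.+-identityʳ c))) (cong (_xor colour c) p))
    between c (suc k) p = extend (between c k p) (present (suc c ℕ.+ k)) refl
      where
      bump : suc c ℕ.+ suc k ≡ suc (suc c ℕ.+ k)
      bump = ℕₚ.+-suc (suc c) k
      extend : (∃ λ d → c ℕ.< d × d ℕ.< suc c ℕ.+ k × present d ≡ true) ⊎ colour (suc c ℕ.+ k) ≡ not (colour c) → ∀ b → present (suc c ℕ.+ k) ≡ b →
        (∃ λ d → c ℕ.< d × d ℕ.< suc c ℕ.+ suc k × present d ≡ true) ⊎ colour (suc c ℕ.+ suc k) ≡ not (colour c)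
      extend (inj₁ (d , c<d , d< , q)) _ _ = inj₁ (d , c<d , subst (d ℕ.<_) (sym bump) (ℕₚ.m<n⇒m<1+n d<) , q)
      extend (inj₂ _) true eq = inj₁ (suc c ℕ.+ k , ℕ.s≤s (ℕₚ.m≤m+n c k) , subst (suc c ℕ.+ k ℕ.<_) (sym bump) ℕₚ.≤-refl , eq)
      extend (inj₂ col) false eq = inj₂ (trans (cong colour bump) (trans (cong (_xor colour (suc c ℕ.+ k)) eq) col))

    -- An edge leaving both the smallest and the largest of three nested sets has one end in the
    -- smallest and the other outside the largest, so it leaves the middle one.
    sandwich : ∀ p p′ q q′ r r′ → (p ≡ true → q ≡ true) → (p′ ≡ true → q′ ≡ true) → (q ≡ true → r ≡ true) → (q′ ≡ true → r′ ≡ true) →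
      p xor p′ ≡ true → r xor r′ ≡ true → q xor q′ ≡ true
    sandwich true false q q′ r r′ pq _ qr q′r′ _ cr = cong₂ _xor_ (pq refl) (¬-not (λ q′t →
      true≢false (trans (sym cr) (cong₂ _xor_ (qr (pq refl)) (q′r′ q′t)))))
    sandwich false true q q′ r r′ _ pq qr q′r′ _ cr = cong₂ _xor_ (¬-not (λ qt →
      true≢false (trans (sym cr) (cong₂ _xor_ (qr qt) (q′r′ (pq refl)))))) (pq refl)

    distinct : ∀ c d → c ℕ.< d → present c ≡ true → present d ≡ true → ¬ (∀ f → cross G (level c) f ≡ cross G (level d) f)
    distinct c d c<d pc pd same = ℕₚ.<⇒≢ c<d (trans (sym (proj₂ (level-narrow c pc)))
      (trans (#-cong (sameCut⇒≗ (proj₁ (level-narrow c pc)) (proj₁ (level-narrow d pd)) same)) (proj₂ (level-narrow d pd))))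

    level-⊆ : ∀ c d → c ℕ.< d → present c ≡ true → present d ≡ true → ∀ v → level c v ≡ true → level d v ≡ true
    level-⊆ c d c<d pc pd = narrow-⊆ (proj₁ (level-narrow c pc)) (proj₁ (level-narrow d pd))
      (subst₂ ℕ._≤_ (sym (proj₂ (level-narrow c pc))) (sym (proj₂ (level-narrow d pd))) (ℕₚ.<⇒≤ c<d))

    threeLevels : ∀ c f d → c ℕ.< f → f ℕ.< d → present c ≡ true → present f ≡ true → present d ≡ true →
      ∀ e → cross G (level c) e ≡ true → cross G (level d) e ≡ true → ⊥
    threeLevels c f d c<f f<d pc pf pd e ec ed = noThree e (level c) (level f) (level d)
      (proj₁ (level-narrow c pc)) (proj₁ (level-narrow f pf)) (proj₁ (level-narrow d pd)) ec
      (sandwich (level c (src G e)) (level c (dst G e)) (level f (src G e)) (level f (dst G e)) (level d (src G e)) (level d (dst G e))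
        (level-⊆ c f c<f pc pf (src G e)) (level-⊆ c f c<f pc pf (dst G e)) (level-⊆ f d f<d pf pd (src G e)) (level-⊆ f d f<d pf pd (dst G e)) ec ed)
      ed (distinct c f c<f pc pf) (distinct c d (ℕₚ.<-trans c<f f<d) pc pd) (distinct f d f<d pf pd)

    -- Equal colours force a third narrow cut in between, and by `sandwich` a common edge would lie
    -- in all three.
    disjoint-< : ∀ c d → c ℕ.< d → present c ≡ true → present d ≡ true → colour c ≡ colour d → ∀ e → cross G (level c) e ≡ true → cross G (level d) e ≡ true → ⊥
    disjoint-< c d c<d pc pd col e ec ed = cases (between c k pc)
      where
      gap = ℕₚ.m≤n⇒∃[o]m+o≡n c<d
      k = proj₁ gap
      cases : (∃ λ f → c ℕ.< f × f ℕ.< suc c ℕ.+ k × present f ≡ true) ⊎ colour (suc c ℕ.+ k) ≡ not (colour c) → ⊥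
      cases (inj₁ (f , c<f , f<d , pf)) = threeLevels c f d c<f (subst (f ℕ.<_) (proj₂ gap) f<d) pc pf pd e ec ed
      cases (inj₂ col′) = not-¬ refl (trans col (trans (cong colour (sym (proj₂ gap))) col′))

    disjoint : ∀ c d → present c ≡ true → present d ≡ true → colour c ≡ colour d → ∀ e → cross G (level c) e ≡ true → cross G (level d) e ≡ true → c ≡ d
    disjoint c d pc pd col e ec ed with ℕₚ.<-cmp c d
    ... | tri< lt _ _ = ⊥-elim (disjoint-< c d lt pc pd col e ec ed)
    ... | tri≈ _ eq _ = eq
    ... | tri> _ _ gt = ⊥-elim (disjoint-< d c gt pd pc (sym col) e ed ec)

    -- Lonely edges and the vector dominating the T-joins

    Tree : Set
    Tree = Σ (Fin m → Bool) (ConnectsOn G full)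

    trees : Dom (ConnectsOn G full) x
    trees = treePolytope _ G full (λ _ → refl , refl) ℕₚ.≤-refl x treePoint
    open Dom trees renaming (dist to L; total to L-total; below to L-below)

    I : ℕ
    I = suc n

    U : Fin I → Subset n
    U i = level (toℕ i)

    #cross : Tree → Subset n → ℕ
    #cross (S , _) X = # (λ e → S e ∧ cross G X e)

    lonely : Tree → Subset n → Bool
    lonely S X = isYes (#cross S X ℕ.≟ 1)

    lonely⇒≡1 : ∀ S X → lonely S X ≡ true → #cross S X ≡ 1
    lonely⇒≡1 S X = lem (#cross S X ℕ.≟ 1)
      where
      lem : ∀ (d : Dec (#cross S X ≡ 1)) → isYes d ≡ true → #cross S X ≡ 1
      lem (yes p) _ = p

    lonely-unique : ∀ S X → lonely S X ≡ true → ∀ e f → proj₁ S e ≡ true → cross G X e ≡ true → proj₁ S f ≡ true → cross G X f ≡ true → e ≡ f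
    lonely-unique S X p e f Se ce Sf cf = decidable-stable (e ≟ f) (λ e≢f → ℕₚ.<-irrefl refl (subst (2 ℕ.≤_) (lonely⇒≡1 S X p)
      (#≥2 (λ e → proj₁ S e ∧ cross G X e) e≢f (cong₂ _∧_ Se ce) (cong₂ _∧_ Sf cf))))

    -- `X` separates s from t, so the connected `S` crosses it; if there is just one crossing, the
    -- indicator supplies the missing unit.
    lonely-or-two : ∀ S X → Narrow X → 2ℚ ≤ ind (lonely S X) + toℚ (#cross S X)
    lonely-or-two S X (Xs , Xt , _) = lem (#cross S X) (#cross S X ℕ.≟ 1) nonzero
      where
      nonzero : #cross S X ≢ 0
      nonzero eq = true≢false (trans (sym Xs) (trans (proj₂ S X (λ e Se → trans (cong (_∧ cross G X e) (sym Se)) (#≡0⇒false (λ e → proj₁ S e ∧ cross G X e) eq e)) s t refl refl) Xt))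
      lem : ∀ k (d : Dec (k ≡ 1)) → k ≢ 0 → 2ℚ ≤ ind (isYes d) + toℚ k
      lem zero d nz = ⊥-elim (nz refl)
      lem (suc zero) (yes _) nz = ≤-refl
      lem (suc zero) (no p) nz = ⊥-elim (p refl)
      lem (suc (suc k)) d nz = ≤-by (ind (isYes d) + toℚ k) (+-nonneg (ind≥0 (isYes d)) (toℚ≥0 k)) (arith (ind (isYes d)) (toℚ k))
        where
        arith : ∀ p q → p + (1ℚ + (1ℚ + q)) ≡ 2ℚ + (p + q)
        arith = solve-∀ ℚ-ring

    𝔼-#cross : ∀ X → 𝔼 L (λ S → toℚ (#cross S X)) ≤ cut G x X
    𝔼-#cross X = subst (_≤ cut G x X) (sym eq) (Σ-mono (λ e → *-mono (ind (cross G X e)) (ind≥0 (cross G X e)) (L-below e)))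
      where
      eq : 𝔼 L (λ S → toℚ (#cross S X)) ≡ Σv (λ e → ind (cross G X e) * 𝔼 L (λ S → ind (proj₁ S e)))
      eq = trans (𝔼-cong L (λ S → sym (Σ-ind (λ e → proj₁ S e ∧ cross G X e)))) (trans (𝔼-Σ L (λ S e → ind (proj₁ S e ∧ cross G X e)))
        (Σ-cong (λ e → trans (𝔼-cong L (λ S → trans (ind-∧ (proj₁ S e) (cross G X e)) (*-comm (ind (proj₁ S e)) (ind (cross G X e))))) (𝔼-*ˡ L (ind (cross G X e)) (λ S → ind (proj₁ S e))))))

    𝔼-lonely : ∀ X → Narrow X → 2ℚ - cut G x X ≤ 𝔼 L (λ S → ind (lonely S X))
    𝔼-lonely X nX = ≤-by _ (+-nonneg (diff≥0 sum≥2) (diff≥0 (𝔼-#cross X))) (arith (𝔼 L (λ S → ind (lonely S X))) (𝔼 L (λ S → toℚ (#cross S X))) (cut G x X))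
      where
      arith : ∀ l k c → l ≡ 2ℚ - c + ((l + k - 2ℚ) + (c - k))
      arith = solve-∀ ℚ-ring
      sum≥2 : 2ℚ ≤ 𝔼 L (λ S → ind (lonely S X)) + 𝔼 L (λ S → toℚ (#cross S X))
      sum≥2 = subst₂ _≤_ (𝔼-const L 2ℚ L-total) (𝔼-+ L (λ S → ind (lonely S X)) (λ S → toℚ (#cross S X))) (𝔼-mono L (λ S → lonely-or-two S X nX))

    deleted : Tree → Fin I → Bool
    deleted S i = present (toℕ i) ∧ lonely S (U i)

    -- The probability that `e` is the lonely edge of the narrow cut with index `i`.
    loss : Fin I → Fin m → ℚ
    loss i e = 𝔼 L (λ S → ind (deleted S i ∧ (proj₁ S e ∧ cross G (U i) e)))

    loss≥0 : ∀ i e → 0ℚ ≤ loss i e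
    loss≥0 i e = 𝔼-nonneg L (λ S → ind≥0 (deleted S i ∧ (proj₁ S e ∧ cross G (U i) e)))

    -- The deleted edges pay for raising x/2 to 1 on the narrow cuts.
    y : Fin m → ℚ
    y e = ½ * x e + ½ * Σv (λ i → loss i e)

    y≥0 : ∀ e → 0ℚ ≤ y e
    y≥0 e = +-nonneg (*-nonneg (<⇒≤ 0<½) (x≥0 e)) (*-nonneg (<⇒≤ 0<½) (Σ-nonneg (λ i → loss≥0 i e)))

    -- A tree in which `U i` is lonely contributes exactly one edge to `loss i`, so the loss over
    -- the cut is the probability of loneliness.
    cut-loss : ∀ i → present (toℕ i) ≡ true → 2ℚ - cut G x (U i) ≤ cut G (loss i) (U i)
    cut-loss i p = subst (2ℚ - cut G x (U i) ≤_) (sym eq) (𝔼-lonely (U i) (proj₁ (level-narrow (toℕ i) p)))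
      where
      χ : Fin m → ℚ
      χ e = ind (cross G (U i) e)
      perTree : ∀ S → Σv (λ e → χ e * ind (deleted S i ∧ (proj₁ S e ∧ cross G (U i) e))) ≡ ind (lonely S (U i))
      perTree S = trans (Σ-cong (λ e → trans (cong (λ b → χ e * ind ((b ∧ lonely S (U i)) ∧ (proj₁ S e ∧ cross G (U i) e))) p) (absorb (cross G (U i) e) (lonely S (U i)) (proj₁ S e))))
        (trans (Σ-*ˡ (ind (lonely S (U i))) (λ e → ind (proj₁ S e ∧ cross G (U i) e))) (trans (cong (ind (lonely S (U i)) *_) (Σ-ind (λ e → proj₁ S e ∧ cross G (U i) e))) (byLonely (lonely S (U i)) refl)))
        where
        absorb : ∀ c l q → ind c * ind (l ∧ (q ∧ c)) ≡ ind l * ind (q ∧ c)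
        absorb true true q = refl
        absorb true false q = sym (*-zeroˡ (ind (q ∧ true)))
        absorb false l true = trans (*-zeroˡ (ind (l ∧ false))) (sym (*-zeroʳ (ind l)))
        absorb false l false = trans (*-zeroˡ (ind (l ∧ false))) (sym (*-zeroʳ (ind l)))
        byLonely : ∀ b → lonely S (U i) ≡ b → ind b * toℚ (#cross S (U i)) ≡ ind b
        byLonely true q = cong (λ k → 1ℚ * toℚ k) (lonely⇒≡1 S (U i) q)
        byLonely false _ = *-zeroˡ (toℚ (#cross S (U i)))
      eq : cut G (loss i) (U i) ≡ 𝔼 L (λ S → ind (lonely S (U i)))
      eq = trans (Σ-cong (λ e → sym (𝔼-*ˡ L (χ e) (λ S → ind (deleted S i ∧ (proj₁ S e ∧ cross G (U i) e))))))
        (trans (sym (𝔼-Σ L (λ S e → χ e * ind (deleted S i ∧ (proj₁ S e ∧ cross G (U i) e))))) (𝔼-cong L perTree))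

    -- With c = x(δ(`U i`)), the loss of this cut alone already gives c/2 + (2 - c)/2 = 1; the other
    -- losses are nonnegative.
    y-level : ∀ i → present (toℕ i) ≡ true → 1ℚ ≤ cut G y (U i)
    y-level i p = ≤-trans (≤-by _ (*-nonneg (<⇒≤ 0<½) (diff≥0 (cut-loss i p))) (arith (cut G x (U i)) (cut G (loss i) (U i))))
      (subst (_≤ cut G y (U i)) eq (Σ-mono (λ e → *-mono (χ e) (ind≥0 (cross G (U i) e))
        (+-monoʳ-≤ (½ * x e) (*-mono ½ (<⇒≤ 0<½) (Σ-term (λ j → loss≥0 j e) i))))))
      where
      χ : Fin m → ℚ
      χ e = ind (cross G (U i) e)
      arith : ∀ c l → ½ * c + ½ * l ≡ 1ℚ + ½ * (l - (2ℚ - c))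
      arith = solve-∀ ℚ-ring
      lem : ∀ c x l → c * (½ * x + ½ * l) ≡ ½ * (c * x) + ½ * (c * l)
      lem = solve-∀ ℚ-ring
      eq : Σv (λ e → χ e * (½ * x e + ½ * loss i e)) ≡ ½ * cut G x (U i) + ½ * cut G (loss i) (U i)
      eq = trans (Σ-cong (λ e → lem (χ e) (x e) (loss i e))) (trans (Σ-+ (λ e → ½ * (χ e * x e)) (λ e → ½ * (χ e * loss i e)))
        (cong₂ _+_ (Σ-*ˡ ½ (λ e → χ e * x e)) (Σ-*ˡ ½ (λ e → χ e * loss i e))))

    y-wide : ∀ X → 2ℚ ≤ cut G x X → 1ℚ ≤ cut G y X
    y-wide X le = ≤-trans (*-mono ½ (<⇒≤ 0<½) le) (subst (_≤ cut G y X) (Σ-*ˡ ½ (λ e → χ e * x e)) (Σ-mono (λ e →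
      ≤-by (χ e * (½ * Σv (λ i → loss i e))) (*-nonneg (ind≥0 (cross G X e)) (*-nonneg (<⇒≤ 0<½) (Σ-nonneg (λ i → loss≥0 i e)))) (lem (χ e) (x e) (Σv (λ i → loss i e))))))
      where
      χ : Fin m → ℚ
      χ e = ind (cross G X e)
      lem : ∀ c x l → c * (½ * x + ½ * l) ≡ ½ * (c * x) + c * (½ * l)
      lem = solve-∀ ℚ-ring

    y-narrow : ∀ X → Narrow X → 1ℚ ≤ cut G y X
    y-narrow X nX = subst (1ℚ ≤_) (cut-cong G y same) (y-level i p)
      where
      i : Fin I
      i = fromℕ< (ℕ.s≤s (#≤n X))
      i≡ : toℕ i ≡ # X
      i≡ = Finₚ.toℕ-fromℕ< (ℕ.s≤s (#≤n X))
      p : present (toℕ i) ≡ true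
      p = trans (cong present i≡) (present⁺ X nX)
      same : U i ≗ X
      same = narrow-≗ (proj₁ (level-narrow (toℕ i) p)) nX (trans (proj₂ (level-narrow (toℕ i) p)) i≡)

    y-from-s : ∀ X u → X u ≡ false → X s ≡ true → 1ℚ ≤ cut G y X
    y-from-s X u Xu Xs = byT (X t) refl
      where
      byWidth : X t ≡ false → Dec (cut G x X < 2ℚ) → 1ℚ ≤ cut G y X
      byWidth Xt (yes lt) = y-narrow X (Xs , Xt , lt)
      byWidth Xt (no nlt) = y-wide X (≮⇒≥ nlt)
      byT : ∀ b → X t ≡ b → 1ℚ ≤ cut G y X
      byT false Xt = byWidth Xt (cut G x X <? 2ℚ)
      byT true Xt = y-wide X (subst (2ℚ ≤_) (cut-cong′ G x {∁ X} {X} (cross-∁ G X)) (cut≥2 (∁ X) u (cong not Xu) (cong not Xs) (cong not Xt)))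

    -- Up to complement, a proper cut belongs either to a set containing s but not t, which is
    -- narrow or has value at least 2, or to a nonempty set avoiding both, where `cut≥2` applies.
    y-cut : ∀ X u v → X u ≡ true → X v ≡ false → 1ℚ ≤ cut G y X
    y-cut X u v Xu Xv = byS (X s) refl
      where
      byS : ∀ b → X s ≡ b → 1ℚ ≤ cut G y X
      byS true Xs = y-from-s X v Xv Xs
      byS false Xs = subst (1ℚ ≤_) (cut-cong′ G y {∁ X} {X} (cross-∁ G X)) (y-from-s (∁ X) u (cong not Xu) (cong not Xs))

    -- Deleting the lonely edges of one colour and repairing with a join

    module OfTree (S : Tree) (c : Bool) where

      D : Fin I → Bool
      D i = deleted S i ∧ not (colour (toℕ i) xor c)

      Hit : Fin m → Set
      Hit e = ∃ λ i → D i ∧ cross G (U i) e ≡ true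

      hit? : ∀ e → Dec (Hit e)
      hit? e = Finₚ.any? (λ i → (D i ∧ cross G (U i) e) 𝔹ₚ.≟ true)

      F : Fin m → Bool
      F e = proj₁ S e ∧ not (isYes (hit? e))

      D⇒ : ∀ i → D i ≡ true → present (toℕ i) ≡ true × lonely S (U i) ≡ true × colour (toℕ i) ≡ c
      D⇒ i p = ∧-conicalˡ (present (toℕ i)) _ del , ∧-conicalʳ (present (toℕ i)) _ del , xor≡false⇒≡ (colour (toℕ i)) c (not-injective (∧-conicalʳ (deleted S i) _ p))
        where
        del = ∧-conicalˡ (deleted S i) _ p

      D-unique : ∀ e i j → D i ∧ cross G (U i) e ≡ true → D j ∧ cross G (U j) e ≡ true → i ≡ j
      D-unique e i j p q = Finₚ.toℕ-injective (disjoint (toℕ i) (toℕ j) (proj₁ dᵢ) (proj₁ dⱼ) (trans (proj₂ (proj₂ dᵢ)) (sym (proj₂ (proj₂ dⱼ)))) e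
          (∧-conicalʳ (D i) (cross G (U i) e) p) (∧-conicalʳ (D j) (cross G (U j) e) q))
        where
        dᵢ = D⇒ i (∧-conicalˡ (D i) (cross G (U i) e) p)
        dⱼ = D⇒ j (∧-conicalˡ (D j) (cross G (U j) e) q)

      F⁺ : ∀ e → proj₁ S e ≡ true → ¬ Hit e → F e ≡ true
      F⁺ e Se ¬hit = cong₂ (λ a b → a ∧ not b) Se (isYes-no (hit? e) ¬hit)

      F-hit : ∀ e → Hit e → F e ≡ false
      F-hit e h = trans (cong (λ b → proj₁ S e ∧ not b) (isYes-yes (hit? e) h)) (∧-zeroʳ (proj₁ S e))

      -- Deleted cuts of one colour share no edge, so an edge of the tree is charged to at most one
      -- of them, and only if it is missing from `F`.
      account : ∀ e → ind (F e) + Σv (λ i → ind (D i ∧ (proj₁ S e ∧ cross G (U i) e))) ≤ ind (proj₁ S e)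
      account e = byS (proj₁ S e) refl
        where
        byHit : Dec (Hit e) → proj₁ S e ≡ true → ind (F e) + Σv (λ i → ind (D i ∧ cross G (U i) e)) ≤ 1ℚ
        byHit (yes (i , p)) Se = subst (λ b → ind b + Σv (λ i → ind (D i ∧ cross G (U i) e)) ≤ 1ℚ) (sym (F-hit e (i , p)))
          (subst (_≤ 1ℚ) (sym (+-identityˡ _)) (card≤1 i (λ j q → D-unique e j i q p)))
        byHit (no ¬h) Se = subst (λ p → ind (F e) + p ≤ 1ℚ) (sym (Σ-zero (λ i → cong ind (¬-not (λ p → ¬h (i , p)))))) (subst (_≤ 1ℚ) (sym (+-identityʳ (ind (F e)))) (ind-mono {F e} {true} (λ _ → refl)))
        byS : ∀ b → proj₁ S e ≡ b → ind (F e) + Σv (λ i → ind (D i ∧ (b ∧ cross G (U i) e))) ≤ ind b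
        byS true Se = byHit (hit? e) Se
        byS false Se = ≤-reflexive (cong₂ _+_ (cong (λ b → ind (b ∧ not (isYes (hit? e)))) Se) (Σ-zero (λ i → cong ind (∧-zeroʳ (D i)))))

      -- The parity that a join must have on `X` to correct that of `F` to the parity of a tour.
      τ : Subset n → Bool
      τ X = par (λ e → F e ∧ cross G X e) xor (X s xor X t)

      τ-linear : Linear τ
      τ-linear = linear
        (λ X≗Y → cong₂ _xor_ (par-cong (λ e → cong (F e ∧_) (cross-cong G X≗Y e))) (cong₂ _xor_ (X≗Y s) (X≗Y t)))
        (λ X Y → trans (cong₂ _xor_
          (trans (par-cong (λ e → trans (cong (F e ∧_) (cross-⊕ G X Y e)) (∧-distribˡ-xor (F e) (cross G X e) (cross G Y e)))) (par-xor (λ e → F e ∧ cross G X e) (λ e → F e ∧ cross G Y e)))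
          (xor-interchange (X s) (Y s) (X t) (Y t)))
          (xor-interchange (par (λ e → F e ∧ cross G X e)) (par (λ e → F e ∧ cross G Y e)) (X s xor X t) (Y s xor Y t)))

      τ-constant : ∀ X → (∀ u v → X u ≡ X v) → τ X ≡ false
      τ-constant X const = cong₂ _xor_ (par-false (λ e → trans (cong (F e ∧_) (constant⇒uncrossed G X const e)) (∧-zeroʳ (F e)))) (trans (cong (X s xor_) (const t s)) (xor-same (X s)))

      -- `y-cut` covers all sets except the empty and the full one, and these are even.
      joins : Dom (IsJoin G τ) y
      joins = joinPolyhedron G τ τ-linear y y≥0 oddCuts
        where
        oddCuts : ∀ X → τ X ≡ true → 1ℚ ≤ cut G y X
        oddCuts X odd = search (Finₚ.any? (λ u → X u 𝔹ₚ.≟ true)) (Finₚ.any? (λ v → X v 𝔹ₚ.≟ false))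
          where
          search : Dec (∃ λ u → X u ≡ true) → Dec (∃ λ v → X v ≡ false) → 1ℚ ≤ cut G y X
          search (yes (u , p)) (yes (v , q)) = y-cut X u v p q
          search (no none) _ = ⊥-elim (true≢false (trans (sym odd) (τ-constant X (λ u v → trans (¬-not (λ p → none (u , p))) (sym (¬-not (λ p → none (v , p))))))))
          search (yes _) (no none) = ⊥-elim (true≢false (trans (sym odd) (τ-constant X (λ u v → trans (¬-not (λ p → none (u , p))) (sym (¬-not (λ p → none (v , p))))))))

      module OfJoin (J : Fin m → Bool) (isJoin : IsJoin G τ J) where

        M : Fin m → ℕ
        M e = bit (F e) ℕ.+ bit (J e)

        J-meets : ∀ i → D i ≡ true → ∃ λ e → J e ∧ cross G (U i) e ≡ true
        J-meets i Di = par-true⇒∃ (λ e → J e ∧ cross G (U i) e) (trans (isJoin (U i)) (cong₂ _xor_ (par-false F-misses) (cong₂ _xor_ (proj₁ nU) (proj₁ (proj₂ nU)))))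
          where
          nU = proj₁ (level-narrow (toℕ i) (proj₁ (D⇒ i Di)))
          F-misses : ∀ e → F e ∧ cross G (U i) e ≡ false
          F-misses e = lem (cross G (U i) e) refl
            where
            lem : ∀ b → cross G (U i) e ≡ b → F e ∧ b ≡ false
            lem true p = cong (_∧ true) (F-hit e (i , cong₂ _∧_ Di p))
            lem false _ = ∧-zeroʳ (F e)

        -- If F ∪ J does not cross X, then S does not cross X ⊕ ⨁ U i over the deleted cuts U i whose edge crosses X.
        M-connects : ∀ X → (∀ e → 0 ℕ.< M e → cross G X e ≡ false) → ∀ u v → X u ≡ X v
        M-connects X unc u v = trans (sym (Y≗X u)) (trans (Y-const u v) (Y≗X v))
          where
          uncF : ∀ e → F e ≡ true → cross G X e ≡ false
          uncF e p = unc e (subst (λ b → 0 ℕ.< bit b ℕ.+ bit (J e)) (sym p) (ℕ.s≤s ℕ.z≤n))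
          uncJ : ∀ e → J e ≡ true → cross G X e ≡ false
          uncJ e p = unc e (subst (λ b → 0 ℕ.< bit (F e) ℕ.+ bit b) (sym p) (ℕₚ.m≤n+m 1 (bit (F e))))
          Crossing : Fin I → Set
          Crossing i = ∃ λ e → proj₁ S e ∧ (cross G (U i) e ∧ cross G X e) ≡ true
          crossing? : ∀ i → Dec (Crossing i)
          crossing? i = Finₚ.any? (λ e → (proj₁ S e ∧ (cross G (U i) e ∧ cross G X e)) 𝔹ₚ.≟ true)
          -- Selects the deleted cuts whose lonely edge crosses `X`.
          σ : Fin I → Bool
          σ i = D i ∧ isYes (crossing? i)
          Y : Subset n
          Y v = X v xor par (λ i → σ i ∧ U i v)
          cross-Y : ∀ e → cross G Y e ≡ cross G X e xor par (λ i → σ i ∧ cross G (U i) e)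
          cross-Y e = trans (xor-interchange (X (src G e)) (par (λ i → σ i ∧ U i (src G e))) (X (dst G e)) (par (λ i → σ i ∧ U i (dst G e))))
            (cong (cross G X e xor_) (trans (sym (par-xor (λ i → σ i ∧ U i (src G e)) (λ i → σ i ∧ U i (dst G e)))) (par-cong (λ i → sym (∧-distribˡ-xor (σ i) (U i (src G e)) (U i (dst G e)))))))
          σ-cross⇒ : ∀ e i → σ i ∧ cross G (U i) e ≡ true → D i ∧ cross G (U i) e ≡ true
          σ-cross⇒ e i p = cong₂ _∧_ (∧-conicalˡ (D i) _ (∧-conicalˡ (σ i) _ p)) (∧-conicalʳ (σ i) _ p)
          σ-sum : ∀ e i → D i ∧ cross G (U i) e ≡ true → par (λ j → σ j ∧ cross G (U j) e) ≡ σ i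
          σ-sum e i p = trans (par-unique (λ j → σ j ∧ cross G (U j) e) i (λ j j≢i → ¬-not (λ q → j≢i (D-unique e j i (σ-cross⇒ e j q) p))))
            (trans (cong (σ i ∧_) (∧-conicalʳ (D i) _ p)) (∧-identityʳ (σ i)))
          -- The edge witnessing `Crossing i` must be `e` itself, because `e` is the only edge of
          -- `S` in this cut.
          σ-edge : ∀ e i → proj₁ S e ≡ true → D i ∧ cross G (U i) e ≡ true → σ i ≡ cross G X e
          σ-edge e i Se p = trans (cong (_∧ isYes (crossing? i)) Di) (lem (crossing? i) (cross G X e) refl)
            where
            Di = ∧-conicalˡ (D i) _ p
            Ue = ∧-conicalʳ (D i) _ p
            lem : ∀ (d : Dec (Crossing i)) b → cross G X e ≡ b → isYes d ≡ b
            lem (yes _) true _ = refl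
            lem (no none) false _ = refl
            lem (no none) true q = ⊥-elim (none (e , cong₂ _∧_ Se (cong₂ _∧_ Ue q)))
            lem (yes (f , q)) false Xe = trans (sym (∧-conicalʳ (cross G (U i) f) _ (∧-conicalʳ (proj₁ S f) _ q)))
              (trans (cong (cross G X) (lonely-unique S (U i) (proj₁ (proj₂ (D⇒ i Di))) f e (∧-conicalˡ (proj₁ S f) _ q) (∧-conicalˡ (cross G (U i) f) _ (∧-conicalʳ (proj₁ S f) _ q)) Se Ue)) Xe)
          -- On a deleted edge the crossing of its cut cancels that of `X`. An edge that was kept
          -- belongs to `F` and crosses neither `X` nor any selected cut.
          Y-uncrossed : Uncrossed G (proj₁ S) Y
          Y-uncrossed e Se = byHit (hit? e)
            where
            byHit : Dec (Hit e) → cross G Y e ≡ false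
            byHit (yes (i , p)) = trans (cross-Y e) (trans (cong (cross G X e xor_) (trans (σ-sum e i p) (σ-edge e i Se p))) (xor-same (cross G X e)))
            byHit (no ¬h) = trans (cross-Y e) (cong₂ _xor_ (uncF e (F⁺ e Se ¬h)) (par-false (λ i → ¬-not (λ p → ¬h (i , σ-cross⇒ e i p)))))
          Y-const : ∀ u v → Y u ≡ Y v
          Y-const u v = proj₂ S Y Y-uncrossed u v refl refl
          -- Some edge of `J` crosses `U i`. It does not cross `X` and meets no other deleted cut,
          -- so it would cross `Y` if `i` were selected; but `Y` is constant.
          σ-false : ∀ i → σ i ≡ false
          σ-false i = ¬-not λ p →
            let Di = ∧-conicalˡ (D i) _ p
                (j , q) = J-meets i Di
                sum≡ = σ-sum j i (cong₂ _∧_ Di (∧-conicalʳ (J j) _ q))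
            in true≢false (trans (sym (trans (cross-Y j) (cong₂ _xor_ (uncJ j (∧-conicalˡ (J j) _ q)) (trans sum≡ p)))) (constant⇒uncrossed G Y Y-const j))
          Y≗X : ∀ v → Y v ≡ X v
          Y≗X v = trans (cong (X v xor_) (par-false (λ i → cong (_∧ U i v) (σ-false i)))) (xor-identityʳ (X v))

        M-parity : ∀ X → par (λ e → oddℕ (M e) ∧ cross G X e) ≡ X s xor X t
        M-parity X = trans (par-cong (λ e → trans (cong (_∧ cross G X e) (odd-bits (F e) (J e))) (∧-distribʳ-xor (cross G X e) (F e) (J e))))
          (trans (par-xor (λ e → F e ∧ cross G X e) (λ e → J e ∧ cross G X e)) (trans (cong (par (λ e → F e ∧ cross G X e) xor_) (isJoin X)) (xor-cancel (par (λ e → F e ∧ cross G X e)) (X s xor X t))))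
          where
          odd-bits : ∀ f j → oddℕ (bit f ℕ.+ bit j) ≡ f xor j
          odd-bits true true = refl
          odd-bits true false = refl
          odd-bits false true = refl
          odd-bits false false = refl

        isTour : IsTour G s t M
        isTour = record { parity = M-parity ; connects = M-connects }

    -- Averaging over trees, colours and joins

    Tour : Set
    Tour = Σ (Fin m → ℕ) (IsTour G s t)

    toTour : ∀ S c → Σ (Fin m → Bool) (IsJoin G (OfTree.τ S c)) → Tour
    toTour S c (J , isJoin) = OfTree.OfJoin.M S c J isJoin , OfTree.OfJoin.isTour S c J isJoin

    toursOf : Tree → Bool → Dist Tour
    toursOf S c = mapDist (toTour S c) (Dom.dist (OfTree.joins S c))

    tours : Dist Tour
    tours = bind L (λ S → scale ½ 0<½ (toursOf S true) ++ scale ½ 0<½ (toursOf S false))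

    𝔼-tours : ∀ f → 𝔼 tours f ≡ 𝔼 L (λ S → ½ * 𝔼 (toursOf S true) f + ½ * 𝔼 (toursOf S false) f)
    𝔼-tours f = trans (𝔼-bind L (λ S → scale ½ 0<½ (toursOf S true) ++ scale ½ 0<½ (toursOf S false)) f)
      (𝔼-cong L (λ S → trans (𝔼-++ (scale ½ 0<½ (toursOf S true)) (scale ½ 0<½ (toursOf S false)) f)
        (cong₂ _+_ (𝔼-scale ½ 0<½ (toursOf S true) f) (𝔼-scale ½ 0<½ (toursOf S false) f))))

    toursOf-total : ∀ S c → 𝔼 (toursOf S c) (λ _ → 1ℚ) ≡ 1ℚ
    toursOf-total S c = trans (𝔼-map (toTour S c) (Dom.dist (OfTree.joins S c)) (λ _ → 1ℚ)) (Dom.total (OfTree.joins S c))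

    tours-total : 𝔼 tours (λ _ → 1ℚ) ≡ 1ℚ
    tours-total = trans (𝔼-tours (λ _ → 1ℚ)) (trans (𝔼-cong L (λ S → cong₂ (λ p q → ½ * p + ½ * q) (toursOf-total S true) (toursOf-total S false))) L-total)

    usage : Fin m → Tour → ℚ
    usage e M = toℚ (proj₁ M e)

    toursOf-usage : ∀ S c e → 𝔼 (toursOf S c) (usage e) ≤ ind (OfTree.F S c e) + y e
    toursOf-usage S c e = subst (_≤ ind (F e) + y e) (sym eq) (+-monoʳ-≤ (ind (F e)) (Dom.below joins e))
      where
      open OfTree S c
      K = Dom.dist joins
      bits : ∀ f j → toℚ (bit f ℕ.+ bit j) ≡ ind f + ind j
      bits true true = refl
      bits true false = refl
      bits false true = refl
      bits false false = refl
      eq : 𝔼 (toursOf S c) (usage e) ≡ ind (F e) + 𝔼 K (λ J → ind (proj₁ J e))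
      eq = trans (𝔼-map (toTour S c) K (usage e)) (trans (𝔼-cong K (λ J → bits (F e) (proj₁ J e)))
        (trans (𝔼-+ K (λ _ → ind (F e)) (λ J → ind (proj₁ J e))) (cong (_+ 𝔼 K (λ J → ind (proj₁ J e))) (𝔼-const K (ind (F e)) (Dom.total joins)))))

    -- Every lonely narrow cut has exactly one of the two colours, so both deletions together
    -- account for the whole loss of the tree, each with weight ½.
    perTree : ∀ S e → ½ * 𝔼 (toursOf S true) (usage e) + ½ * 𝔼 (toursOf S false) (usage e)
      ≤ ind (proj₁ S e) + (- ½) * Σv (λ i → ind (deleted S i ∧ (proj₁ S e ∧ cross G (U i) e))) + y e
    perTree S e = ≤-trans (+-mono-≤ (*-mono ½ 0≤½ (side true)) (*-mono ½ 0≤½ (side false)))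
      (≤-reflexive (trans (arith (ind (proj₁ S e)) (y e) (D∑ true) (D∑ false)) (cong (λ q → ind (proj₁ S e) + (- ½) * q + y e) both)))
      where
      0≤½ = <⇒≤ 0<½
      D∑ : Bool → ℚ
      D∑ c = Σv (λ i → ind (OfTree.D S c i ∧ (proj₁ S e ∧ cross G (U i) e)))
      side : ∀ c → 𝔼 (toursOf S c) (usage e) ≤ ind (proj₁ S e) - D∑ c + y e
      side c = ≤-trans (toursOf-usage S c e) (+-monoˡ-≤ (y e) (≤-by {ind (OfTree.F S c e)} {ind (proj₁ S e) - D∑ c} (ind (proj₁ S e) - (ind (OfTree.F S c e) + D∑ c)) (diff≥0 (OfTree.account S c e)) (lem (ind (OfTree.F S c e)) (D∑ c) (ind (proj₁ S e)))))
        where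
        lem : ∀ f d s → s - d ≡ f + (s - (f + d))
        lem = solve-∀ ℚ-ring
      arith : ∀ s y d d′ → ½ * (s - d + y) + ½ * (s - d′ + y) ≡ s + (- ½) * (d + d′) + y
      arith = solve-∀ ℚ-ring
      both : D∑ true + D∑ false ≡ Σv (λ i → ind (deleted S i ∧ (proj₁ S e ∧ cross G (U i) e)))
      both = trans (sym (Σ-+ (λ i → ind (OfTree.D S true i ∧ (proj₁ S e ∧ cross G (U i) e))) (λ i → ind (OfTree.D S false i ∧ (proj₁ S e ∧ cross G (U i) e)))))
        (Σ-cong (λ i → lem (deleted S i) (colour (toℕ i)) (proj₁ S e ∧ cross G (U i) e)))
        where
        lem : ∀ d k z → ind ((d ∧ not (k xor true)) ∧ z) + ind ((d ∧ not (k xor false)) ∧ z) ≡ ind (d ∧ z)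
        lem true true z = +-identityʳ (ind z)
        lem true false z = +-identityˡ (ind z)
        lem false k z = refl

    -- The expected saving by deletions, half of the total loss, equals what `y` adds to x/2.
    tours-usage : ∀ e → 𝔼 tours (usage e) ≤ x e + ½ * x e
    tours-usage e = subst (_≤ x e + ½ * x e) (sym (𝔼-tours (usage e))) (≤-trans (𝔼-mono L (λ S → perTree S e)) (subst (_≤ x e + ½ * x e) (sym eq)
      (≤-trans (+-monoˡ-≤ (y e) (+-monoˡ-≤ ((- ½) * Λ) (L-below e))) (≤-reflexive (arith (x e) Λ)))))
      where
      Λ = Σv (λ i → loss i e)
      arith : ∀ x l → x + (- ½) * l + (½ * x + ½ * l) ≡ x + ½ * x
      arith = solve-∀ ℚ-ring
      del : Tree → Fin I → ℚ
      del S i = ind (deleted S i ∧ (proj₁ S e ∧ cross G (U i) e))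
      eq : 𝔼 L (λ S → ind (proj₁ S e) + (- ½) * Σv (del S) + y e) ≡ 𝔼 L (λ S → ind (proj₁ S e)) + (- ½) * Λ + y e
      eq = trans (𝔼-+ L (λ S → ind (proj₁ S e) + (- ½) * Σv (del S)) (λ _ → y e)) (cong₂ _+_
        (trans (𝔼-+ L (λ S → ind (proj₁ S e)) (λ S → (- ½) * Σv (del S))) (cong (𝔼 L (λ S → ind (proj₁ S e)) +_)
          (trans (𝔼-*ˡ L (- ½) (λ S → Σv (del S))) (cong ((- ½) *_) (𝔼-Σ L del)))))
        (𝔼-const L (y e) L-total))

-- From dominated to exact convex combinations

oddℕ-+ : ∀ a b → oddℕ (a ℕ.+ b) ≡ oddℕ a xor oddℕ b
oddℕ-+ zero b = refl
oddℕ-+ (suc a) b = trans (cong not (oddℕ-+ a b)) (not-distribˡ-xor (oddℕ a) (oddℕ b))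

toℚ-+ : ∀ a b → toℚ (a ℕ.+ b) ≡ toℚ a + toℚ b
toℚ-+ zero b = sym (+-identityˡ (toℚ b))
toℚ-+ (suc a) b = trans (cong (1ℚ +_) (toℚ-+ a b)) (sym (ℚₚ.+-assoc 1ℚ (toℚ a) (toℚ b)))

module Exact {n m} (G : Graph n m) (s t : Fin n) where

  Tour : Set
  Tour = Σ (Fin m → ℕ) (IsTour G s t)

  mean : Dist Tour → Fin m → ℚ
  mean L e = 𝔼 L (λ M → toℚ (proj₁ M e))

  extra : Fin m → Fin m → ℕ
  extra e f = if singleton e f then 4 else 0

  addFour : Fin m → Tour → Tour
  addFour e (M , tour) = (λ f → extra e f ℕ.+ M f) , record
    { parity = λ X → trans (par-cong (λ f → cong (_∧ cross G X f) (trans (oddℕ-+ (extra e f) (M f)) (cong (_xor oddℕ (M f)) (even (singleton e f)))))) (IsTour.parity tour X)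
    ; connects = λ X unc → IsTour.connects tour X (λ f p → unc f (ℕₚ.<-≤-trans p (ℕₚ.m≤n+m (M f) (extra e f)))) }
    where
    even : ∀ b → oddℕ (if b then 4 else 0) ≡ false
    even true = refl
    even false = refl

  -- A deficit below 4 at e is filled by adding four copies of e with a suitable probability.
  fill : ∀ L e δ → 𝔼 L (λ _ → 1ℚ) ≡ 1ℚ → 0ℚ < δ → δ < toℚ 4 →
    ∃ λ L′ → 𝔼 L′ (λ _ → 1ℚ) ≡ 1ℚ × mean L′ e ≡ mean L e + δ × (∀ f → f ≢ e → mean L′ f ≡ mean L f)
  fill L e δ total δ>0 δ<4 = L′ ,
    trans (𝔼-L′ (λ _ → 1ℚ)) (trans (cong₂ (λ p q → β * p + α * q) total (trans (𝔼-map (addFour e) L (λ _ → 1ℚ)) total)) (lem α)) ,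
    trans (shift e) (trans (cong (λ b → mean L e + α * toℚ (if b then 4 else 0)) (==-refl e)) (cong (mean L e +_) (lem₄ δ))) ,
    λ f f≢e → trans (shift f) (trans (cong (λ b → mean L f + α * toℚ (if b then 4 else 0)) (==-≢ f≢e)) (lem₀ (mean L f) α))
    where
    ¼ : ℚ
    ¼ = ½ * ½
    α β : ℚ
    α = ¼ * δ
    β = 1ℚ - α
    α>0 : 0ℚ < α
    α>0 = *-pos (*-pos 0<½ 0<½) δ>0
    lem : ∀ a → (1ℚ - a) * 1ℚ + a * 1ℚ ≡ 1ℚ
    lem = solve-∀ ℚ-ring
    lem₁ : ∀ d → 1ℚ - ¼ * d ≡ ¼ * (toℚ 4 - d)
    lem₁ = solve-∀ ℚ-ring
    lem₄ : ∀ d → ¼ * d * toℚ 4 ≡ d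
    lem₄ = solve-∀ ℚ-ring
    lem₀ : ∀ p a → p + a * 0ℚ ≡ p
    lem₀ = solve-∀ ℚ-ring
    β>0 : 0ℚ < β
    β>0 = subst (0ℚ <_) (sym (lem₁ δ)) (*-pos (*-pos 0<½ 0<½) (diff>0 δ<4))
    L′ : Dist Tour
    L′ = scale β β>0 L ++ scale α α>0 (mapDist (addFour e) L)
    𝔼-L′ : ∀ f → 𝔼 L′ f ≡ β * 𝔼 L f + α * 𝔼 (mapDist (addFour e) L) f
    𝔼-L′ f = trans (𝔼-++ (scale β β>0 L) (scale α α>0 (mapDist (addFour e) L)) f) (cong₂ _+_ (𝔼-scale β β>0 L f) (𝔼-scale α α>0 (mapDist (addFour e) L) f))
    shift : ∀ f → mean L′ f ≡ mean L f + α * toℚ (extra e f)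
    shift f = trans (𝔼-L′ (λ M → toℚ (proj₁ M f))) (trans (cong (λ q → β * mean L f + α * q) added) (arith α (mean L f) (toℚ (extra e f))))
      where
      added : 𝔼 (mapDist (addFour e) L) (λ M → toℚ (proj₁ M f)) ≡ toℚ (extra e f) + mean L f
      added = trans (𝔼-map (addFour e) L (λ M → toℚ (proj₁ M f))) (trans (𝔼-cong L (λ M → toℚ-+ (extra e f) (proj₁ M f)))
        (trans (𝔼-+ L (λ _ → toℚ (extra e f)) (λ M → toℚ (proj₁ M f))) (cong (_+ mean L f) (𝔼-const L (toℚ (extra e f)) total))))
      arith : ∀ a m x → (1ℚ - a) * m + a * (x + m) ≡ m + a * x
      arith = solve-∀ ℚ-ring

  module _ (z : Fin m → ℚ) (z<4 : ∀ e → z e < toℚ 4) where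

    Good : Dist Tour → Set
    Good L = 𝔼 L (λ _ → 1ℚ) ≡ 1ℚ × (∀ e → mean L e ≤ z e)

    exactAt : ∀ L → Good L → ∀ e → ∃ λ L′ → Good L′ × mean L′ e ≡ z e × (∀ f → mean L f ≡ z f → mean L′ f ≡ z f)
    exactAt L (total , below) e = byGap (mean L e <? z e)
      where
      byGap : Dec (mean L e < z e) → ∃ λ L′ → Good L′ × mean L′ e ≡ z e × (∀ f → mean L f ≡ z f → mean L′ f ≡ z f)
      byGap (no nlt) = L , (total , below) , ≤-antisym (below e) (≮⇒≥ nlt) , λ _ eq → eq
      byGap (yes lt) = L′ , (proj₁ (proj₂ filled) , λ f → byEdge f (f ≟ e)) , hit , λ f eq → keep f eq (f ≟ e)
        where
        δ<4 : z e - mean L e < toℚ 4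
        δ<4 = ≤-<-trans (≤-by (mean L e) (𝔼-nonneg L (λ M → toℚ≥0 (proj₁ M e))) (lem (z e) (mean L e))) (z<4 e)
          where
          lem : ∀ p q → p ≡ p - q + q
          lem = solve-∀ ℚ-ring
        filled = fill L e (z e - mean L e) total (diff>0 lt) δ<4
        L′ = proj₁ filled
        hit : mean L′ e ≡ z e
        hit = trans (proj₁ (proj₂ (proj₂ filled))) (sym (+-diff (mean L e) (z e)))
        others = proj₂ (proj₂ (proj₂ filled))
        byEdge : ∀ f → Dec (f ≡ e) → mean L′ f ≤ z f
        byEdge f (yes refl) = ≤-reflexive hit
        byEdge f (no f≢e) = subst (_≤ z f) (sym (others f f≢e)) (below f)
        keep : ∀ f → mean L f ≡ z f → Dec (f ≡ e) → mean L′ f ≡ z f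
        keep f eq (yes refl) = hit
        keep f eq (no f≢e) = trans (others f f≢e) eq

    -- Filling one edge does not change the mean of any other, so equalities already reached
    -- persist.
    exactOn : ∀ (es : List (Fin m)) L → Good L → ∃ λ L′ → Good L′ × (∀ e → e ∈ es → mean L′ e ≡ z e) × (∀ f → mean L f ≡ z f → mean L′ f ≡ z f)
    exactOn [] L good = L , good , (λ _ ()) , λ _ eq → eq
    exactOn (e ∷ es) L good = proj₁ rest , proj₁ (proj₂ rest) ,
        (λ { f (here refl) → proj₂ (proj₂ (proj₂ rest)) f (proj₁ (proj₂ (proj₂ first))) ; f (there i) → proj₁ (proj₂ (proj₂ rest)) f i }) ,
        λ f eq → proj₂ (proj₂ (proj₂ rest)) f (proj₂ (proj₂ (proj₂ first)) f eq)
      where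
      first = exactAt L good e
      rest = exactOn es (proj₁ first) (proj₁ (proj₂ first))

    exact : ∀ L → Good L → ∃ λ L′ → 𝔼 L′ (λ _ → 1ℚ) ≡ 1ℚ × (∀ e → mean L′ e ≡ z e)
    exact L good with exactOn (allFin m) L good
    ... | L′ , (total , _) , all , _ = L′ , total , λ e → all e (∈-allFin e)

-- The support graph

foldr-split : ∀ {A : Set} (_∙_ : A → A → A) (ε : A) → (∀ a b c → (a ∙ b) ∙ c ≡ a ∙ (b ∙ c)) → (∀ a → ε ∙ a ≡ a) →
  ∀ p q (f : Fin (p ℕ.+ q) → A) → VF.foldr _∙_ ε f ≡ VF.foldr _∙_ ε (λ i → f (i ↑ˡ q)) ∙ VF.foldr _∙_ ε (λ j → f (p ↑ʳ j))
foldr-split _∙_ ε assoc idˡ zero q f = sym (idˡ _)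
foldr-split _∙_ ε assoc idˡ (suc p) q f = trans (cong (f zero ∙_) (foldr-split _∙_ ε assoc idˡ p q (f ∘ suc))) (sym (assoc (f zero) _ _))

-- Generic in the operation because it serves both rational sums and parities over ordered pairs.
foldr-combine : ∀ {A : Set} (_∙_ : A → A → A) (ε : A) → (∀ a b c → (a ∙ b) ∙ c ≡ a ∙ (b ∙ c)) → (∀ a → ε ∙ a ≡ a) →
  ∀ k n (f : Fin (k ℕ.* n) → A) → VF.foldr _∙_ ε f ≡ VF.foldr _∙_ ε (λ i → VF.foldr _∙_ ε (λ j → f (combine {k} {n} i j)))
foldr-combine _∙_ ε assoc idˡ zero n f = refl
foldr-combine _∙_ ε assoc idˡ (suc k) n f = trans (foldr-split _∙_ ε assoc idˡ n (k ℕ.* n) f)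
  (cong (VF.foldr _∙_ ε (λ j → f (j ↑ˡ (k ℕ.* n))) ∙_) (foldr-combine _∙_ ε assoc idˡ k n (λ j → f (n ↑ʳ j))))

Σ-combine : ∀ n (f : Fin (n ℕ.* n) → ℚ) → Σv f ≡ Σv (λ i → Σv (λ j → f (combine {n} {n} i j)))
Σ-combine n = foldr-combine _+_ 0ℚ ℚₚ.+-assoc +-identityˡ n n

par-combine : ∀ n (f : Fin (n ℕ.* n) → Bool) → par f ≡ par (λ i → par (λ j → f (combine {n} {n} i j)))
par-combine n = foldr-combine _xor_ false xor-assoc (λ _ → refl) n n

odd-Σ : ∀ {n} (f : Fin n → ℕ) → oddℕ (Σvℕ f) ≡ par (λ i → oddℕ (f i))
odd-Σ {zero} f = refl
odd-Σ {suc n} f = trans (oddℕ-+ (f zero) (Σvℕ (f ∘ suc))) (cong (oddℕ (f zero) xor_) (odd-Σ (f ∘ suc)))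

%2≡bit : ∀ k → k ℕ.% 2 ≡ bit (oddℕ k)
%2≡bit zero = refl
%2≡bit (suc zero) = refl
%2≡bit (suc (suc k)) = trans (%2≡bit k) (cong bit (sym (not-involutive (oddℕ k))))

-- The fraction k/1 is normalised for variable k, so the equation is verified on unnormalised
-- rationals.
ℕ→ℚ-suc : ∀ k → ℕ→ℚ (suc k) ≡ 1ℚ + ℕ→ℚ k
ℕ→ℚ-suc k = ℚₚ.toℚᵘ-injective (ℚᵘₚ.≃-trans (ℚₚ.toℚᵘ-fromℚᵘ (mkℚᵘ (ℤ.+ suc k) 0)) (ℚᵘₚ.≃-sym (ℚᵘₚ.≃-trans (ℚₚ.toℚᵘ-homo-+ 1ℚ (ℕ→ℚ k))
  (ℚᵘₚ.≃-trans (ℚᵘₚ.+-congʳ (toℚᵘ 1ℚ) (ℚₚ.toℚᵘ-fromℚᵘ (mkℚᵘ (ℤ.+ k) 0))) (*≡* (cong (ℤ._* ℤ.+ 1) (cong (ℤ._+_ (ℤ.+ 1)) (ℤₚ.*-identityʳ (ℤ.+ k)))))))))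

ℕ→ℚ≡toℚ : ∀ k → ℕ→ℚ k ≡ toℚ k
ℕ→ℚ≡toℚ zero = refl
ℕ→ℚ≡toℚ (suc k) = trans (ℕ→ℚ-suc k) (cong (1ℚ +_) (ℕ→ℚ≡toℚ k))

-- The edges are all ordered pairs; those which are not an edge i < j of the support become loops.
module Support {n} (x : Fin n → Fin n → ℚ) where

  supp : Fin n → Fin n → Bool
  supp i j = isYes (i Finₚ.<? j) ∧ inSupp x i j

  supp⁺ : ∀ {i j} → i F.< j → 0ℚ < x i j → supp i j ≡ true
  supp⁺ {i} {j} i<j p = cong₂ _∧_ (isYes-yes (i Finₚ.<? j) i<j) (isYes-yes (0ℚ <? x i j) p)

  isYes⇒ : ∀ {P : Set} (d : Dec P) → isYes d ≡ true → P
  isYes⇒ (yes p) _ = p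

  supp⇒< : ∀ {i j} → supp i j ≡ true → i F.< j
  supp⇒< {i} {j} p = isYes⇒ (i Finₚ.<? j) (∧-conicalˡ (isYes (i Finₚ.<? j)) (inSupp x i j) p)

  supp⇒>0 : ∀ {i j} → supp i j ≡ true → 0ℚ < x i j
  supp⇒>0 {i} {j} p = isYes⇒ (0ℚ <? x i j) (∧-conicalʳ (isYes (i Finₚ.<? j)) (inSupp x i j) p)

  head : Fin n × Fin n → Fin n
  head (i , j) = if supp i j then j else i

  value : Fin n × Fin n → ℚ
  value (i , j) = if supp i j then x i j else 0ℚ

  G : Graph n (n ℕ.* n)
  G = graph (λ e → proj₁ (remQuot {n} n e)) (λ e → head (remQuot {n} n e))

  x̂ : Fin (n ℕ.* n) → ℚ
  x̂ e = value (remQuot {n} n e)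

  pairCross : Subset n → Fin n × Fin n → Bool
  pairCross X p = X (proj₁ p) xor X (head p)

  cross-combine : ∀ X i j → cross G X (combine {n} {n} i j) ≡ pairCross X (i , j)
  cross-combine X i j = cong (pairCross X) (Finₚ.remQuot-combine {n} {n} i j)

  pairCross-supp : ∀ X i j → supp i j ≡ true → pairCross X (i , j) ≡ crosses X i j
  pairCross-supp X i j p = cong (λ b → X i xor X (if b then j else i)) p

  pairCross-loop : ∀ X i j → supp i j ≡ false → pairCross X (i , j) ≡ false
  pairCross-loop X i j p = trans (cong (λ b → X i xor X (if b then j else i)) p) (xor-same (X i))

  cut-pairs : ∀ X → cut G x̂ X ≡ Σv (λ i → Σv (λ j → ind (pairCross X (i , j)) * value (i , j)))
  cut-pairs X = trans (Σ-combine n (λ e → ind (cross G X e) * x̂ e)) (Σ-cong (λ i → Σ-cong (λ j →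
    cong (λ p → ind (pairCross X p) * value p) (Finₚ.remQuot-combine {n} {n} i j))))

  cut≡xδE : ∀ X → cut G x̂ X ≡ xδE x X
  cut≡xδE X = trans (cut-pairs X) (Σ-cong (λ i → Σ-cong (λ j → lem i j (isYes (i Finₚ.<? j)) (inSupp x i j))))
    where
    if-* : ∀ b p → ind b * p ≡ (if b then p else 0ℚ)
    if-* true p = *-identityˡ p
    if-* false p = *-zeroˡ p
    if-0 : ∀ b → 0ℚ ≡ (if b then 0ℚ else 0ℚ)
    if-0 true = refl
    if-0 false = refl
    lem : ∀ i j l p → ind (X i xor X (if l ∧ p then j else i)) * (if l ∧ p then x i j else 0ℚ)
      ≡ (if l then (if X i xor X j then (if p then x i j else 0ℚ) else 0ℚ) else 0ℚ)
    lem i j true true = if-* (X i xor X j) (x i j)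
    lem i j true false = trans (*-zeroʳ (ind (X i xor X i))) (if-0 (X i xor X j))
    lem i j false p = *-zeroʳ (ind (X i xor X i))

  module _ (x≥0 : ∀ i j → i F.< j → 0ℚ ≤ x i j) where

    unsupported : ∀ {i j} → i F.< j → supp i j ≡ false → x i j ≡ 0ℚ
    unsupported {i} {j} i<j p = ≤-antisym (≮⇒≥ (λ q → true≢false (trans (sym (supp⁺ i<j q)) p))) (x≥0 i j i<j)

    xδE≡xδ : ∀ X → xδE x X ≡ xδ x X
    xδE≡xδ X = Σ-cong (λ i → Σ-cong (λ j → byOrder i j (i Finₚ.<? j)))
      where
      bySupp : ∀ i j → i F.< j → (d : Dec (0ℚ < x i j)) → (if isYes d then x i j else 0ℚ) ≡ x i j
      bySupp i j i<j (yes _) = refl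
      bySupp i j i<j (no p) = sym (≤-antisym (≮⇒≥ p) (x≥0 i j i<j))
      byOrder : ∀ i j (d : Dec (i F.< j)) →
        (if isYes d then (if crosses X i j then (if inSupp x i j then x i j else 0ℚ) else 0ℚ) else 0ℚ) ≡ (if isYes d then (if crosses X i j then x i j else 0ℚ) else 0ℚ)
      byOrder i j (yes i<j) = cong (λ p → if crosses X i j then p else 0ℚ) (bySupp i j i<j (0ℚ <? x i j))
      byOrder i j (no _) = refl

    cut≡xδ : ∀ X → cut G x̂ X ≡ xδ x X
    cut≡xδ X = trans (cut≡xδE X) (xδE≡xδ X)

  x̂≥0 : ∀ e → 0ℚ ≤ x̂ e
  x̂≥0 e = lem (proj₁ (remQuot {n} n e)) (proj₂ (remQuot {n} n e)) (supp _ _) refl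
    where
    lem : ∀ i j b → supp i j ≡ b → 0ℚ ≤ (if b then x i j else 0ℚ)
    lem i j true p = <⇒≤ (supp⇒>0 p)
    lem i j false _ = ≤-refl

  loops : ∀ e → src G e ≡ dst G e → x̂ e ≡ 0ℚ
  loops e = lem (proj₁ (remQuot {n} n e)) (proj₂ (remQuot {n} n e)) (supp _ _) refl
    where
    lem : ∀ i j b → supp i j ≡ b → i ≡ (if b then j else i) → (if b then x i j else 0ℚ) ≡ 0ℚ
    lem i j true p i≡j = ⊥-elim (Finₚ.<-irrefl i≡j (supp⇒< p))
    lem i j false _ _ = refl

  -- From cut conditions back to walks and degrees

  module FromTour {s t} (M : Fin (n ℕ.* n) → ℕ) (tour : IsTour G s t M) where

    mult : Fin n → Fin n → ℕ
    mult i j = if supp i j then M (combine {n} {n} i j) else 0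

    mult-supp : ∀ i j → supp i j ≡ true → mult i j ≡ M (combine {n} {n} i j)
    mult-supp i j p = cong (λ b → if b then M (combine {n} {n} i j) else 0) p

    mult⇒supp : ∀ i j → 0 ℕ.< mult i j → supp i j ≡ true
    mult⇒supp i j p = ¬-not (λ q → ℕₚ.<-irrefl refl (subst (0 ℕ.<_) (cong (λ b → if b then M (combine {n} {n} i j) else 0) q) p))

    -- Grow the set R of vertices known to be reachable until no edge leaves it.
    explore : ∀ u k R → R u ≡ true → (∀ v → R v ≡ true → Reach mult u v) → # (∁ R) ℕ.< k → ∀ v → Reach mult u v
    explore u (suc k) R Ru reach (ℕ.s≤s le) = search (Finₚ.any? (λ i → Finₚ.any? (λ j → (0 ℕ.<? mult i j) ×-dec (crosses R i j 𝔹ₚ.≟ true))))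
      where
      grow : ∀ w → R w ≡ false → Reach mult u w → ∀ v → Reach mult u v
      grow w Rw r = explore u k (λ v → R v ∨ singleton w v) (cong (_∨ singleton w u) Ru) reach′
        (ℕₚ.<-≤-trans (#-strict {X = ∁ (λ v → R v ∨ singleton w v)} {∁ R} (λ v p → cong not (∨-conicalˡ (R v) (singleton w v) (not-injective p))) w
          (cong not (trans (cong (R w ∨_) (==-refl w)) (∨-zeroʳ (R w)))) (cong not Rw)) le)
        where
        reach′ : ∀ v → R v ∨ singleton w v ≡ true → Reach mult u v
        reach′ v p = byMember (R v) (singleton w v) refl refl p
          where
          byMember : ∀ a b → R v ≡ a → singleton w v ≡ b → a ∨ b ≡ true → Reach mult u v
          byMember true _ q _ _ = reach v q
          byMember false true _ q _ = subst (Reach mult u) (sym (==⇒≡ q)) r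
      search : Dec (∃ λ i → ∃ λ j → 0 ℕ.< mult i j × crosses R i j ≡ true) → ∀ v → Reach mult u v
      search (yes (i , j , p , c)) = byEnd (R i) (R j) refl refl c
        where
        i<j = supp⇒< (mult⇒supp i j p)
        byEnd : ∀ a b → R i ≡ a → R j ≡ b → a xor b ≡ true → ∀ v → Reach mult u v
        byEnd true false q r _ = grow j r (stepF (reach i q) i<j p)
        byEnd false true q r _ = grow i q (stepB (reach j r) i<j p)
      search (no none) v = reach v (trans (IsTour.connects tour R uncrossed v u) Ru)
        where
        uncrossed : ∀ e → 0 ℕ.< M e → cross G R e ≡ false
        uncrossed e p = lem (proj₁ (remQuot {n} n e)) (proj₂ (remQuot {n} n e)) (subst (λ f → 0 ℕ.< M f) (sym (Finₚ.combine-remQuot {n} n e)) p)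
          where
          lem : ∀ i j → 0 ℕ.< M (combine {n} {n} i j) → pairCross R (i , j) ≡ false
          lem i j q = bySupp (supp i j) refl
            where
            bySupp : ∀ b → supp i j ≡ b → pairCross R (i , j) ≡ false
            bySupp true sp = trans (pairCross-supp R i j sp) (¬-not (λ c → none (i , j , subst (0 ℕ.<_) (sym (mult-supp i j sp)) q , c)))
            bySupp false sp = pairCross-loop R i j sp

    connected : ∀ u v → Reach mult u v
    connected u = explore u _ (singleton u) (==-refl u) (λ v p → subst (Reach mult u) (sym (==⇒≡ p)) here) ℕₚ.≤-refl

    -- Modulo 2 the degree of `v` is the number of edges crossing its singleton: the loops drop out
    -- on both sides, and a support edge has distinct ends.
    degree-odd : ∀ v → oddℕ (degM mult v) ≡ isYes (v ≟ s) xor isYes (v ≟ t)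
    degree-odd v = trans (odd-Σ (λ i → Σvℕ (λ j → degTerm i j))) (trans (par-cong (λ i → trans (odd-Σ (λ j → degTerm i j)) (par-cong (λ j → perPair i j))))
      (trans (sym (par-combine n (λ e → oddℕ (M e) ∧ cross G (singleton v) e))) (trans (IsTour.parity tour (singleton v)) (cong₂ _xor_ (==-sym v s) (==-sym v t)))))
      where
      degTerm : Fin n → Fin n → ℕ
      degTerm i j = if isYes (i Finₚ.<? j) then (if isYes (i ≟ v) then mult i j else (if isYes (j ≟ v) then mult i j else 0)) else 0
      perPair : ∀ i j → oddℕ (degTerm i j) ≡ oddℕ (M (combine {n} {n} i j)) ∧ cross G (singleton v) (combine {n} {n} i j)
      perPair i j = trans (bySupp (supp i j) refl) (cong (oddℕ (M (combine {n} {n} i j)) ∧_) (sym (cross-combine (singleton v) i j)))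
        where
        N = M (combine {n} {n} i j)
        odd-zero : ∀ (a b c : Bool) → oddℕ (if a then (if b then 0 else (if c then 0 else 0)) else 0) ≡ false
        odd-zero true true _ = refl
        odd-zero true false true = refl
        odd-zero true false false = refl
        odd-zero false _ _ = refl
        ends : ∀ a b → (a ≡ true → b ≡ true → ⊥) → oddℕ (if a then N else (if b then N else 0)) ≡ oddℕ N ∧ (a xor b)
        ends true true h = ⊥-elim (h refl refl)
        ends true false h = sym (∧-identityʳ (oddℕ N))
        ends false true h = sym (∧-identityʳ (oddℕ N))
        ends false false h = sym (∧-zeroʳ (oddℕ N))
        bySupp : ∀ b → supp i j ≡ b → oddℕ (degTerm i j) ≡ oddℕ N ∧ pairCross (singleton v) (i , j)
        bySupp true p = trans (cong₂ (λ l k → oddℕ (if l then (if isYes (i ≟ v) then k else (if isYes (j ≟ v) then k else 0)) else 0)) (isYes-yes (i Finₚ.<? j) (supp⇒< p)) (mult-supp i j p))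
          (trans (ends (isYes (i ≟ v)) (isYes (j ≟ v)) (λ p₁ p₂ → Finₚ.<-irrefl (trans (==⇒≡ p₁) (sym (==⇒≡ p₂))) (supp⇒< p)))
            (cong (oddℕ N ∧_) (sym (pairCross-supp (singleton v) i j p))))
        bySupp false p = trans (cong (λ k → oddℕ (if isYes (i Finₚ.<? j) then (if isYes (i ≟ v) then k else (if isYes (j ≟ v) then k else 0)) else 0)) (cong (λ b → if b then N else 0) p))
          (trans (odd-zero (isYes (i Finₚ.<? j)) (isYes (i ≟ v)) (isYes (j ≟ v))) (sym (trans (cong (oddℕ N ∧_) (pairCross-loop (singleton v) i j p)) (∧-zeroʳ (oddℕ N)))))

    toSTTour : STTour n s t x
    toSTTour = record
      { mult = mult
      ; inE = λ i j _ p → supp⇒>0 (mult⇒supp i j p)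
      ; connected = connected
      ; oddSet = λ v → trans (%2≡bit (degM mult v)) (cong bit (degree-odd v)) }

-- From the linear program to the tours

module Main {n} (s t : Fin n) (s≢t : s ≢ t) (x : Fin n → Fin n → ℚ) (lp : SubtourLPFeasible n s t x)
  (noThree : ∀ (i j : Fin n) → i F.< j → 0ℚ < x i j → ¬ InMoreThanTwoNarrowCuts x i j) where

  open SubtourLPFeasible lp
  open Support x

  cutδ : ∀ X → cut G x̂ X ≡ xδ x X
  cutδ = cut≡xδ nonneg

  fST≡ : ∀ X → fST s t X ≡ (if X s xor X t then ℕ→ℚ 1 else ℕ→ℚ 2)
  fST≡ X = cong (λ b → if (if b then X s else (X s xor X t)) then ℕ→ℚ 1 else ℕ→ℚ 2) (isYes-no (s ≟ t) s≢t)

  degree′ : ∀ v → cut G x̂ (singleton v) ≡ 2ℚ - ind (singleton s v) - ind (singleton t v)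
  degree′ v = trans (cutδ (singleton v)) (trans (degree v) (trans (fST≡ (singleton v))
    (trans (cong₂ (λ a b → if a xor b then ℕ→ℚ 1 else ℕ→ℚ 2) (==-sym v s) (==-sym v t))
      (lem (singleton s v) (singleton t v) (λ p q → s≢t (trans (sym (==⇒≡ p)) (==⇒≡ q)))))))
    where
    lem : ∀ a b → (a ≡ true → b ≡ true → ⊥) → (if a xor b then ℕ→ℚ 1 else ℕ→ℚ 2) ≡ 2ℚ - ind a - ind b
    lem true true h = ⊥-elim (h refl refl)
    lem true false h = refl
    lem false true h = refl
    lem false false h = refl

  cut≥2 : ∀ X v → X v ≡ true → X s ≡ false → X t ≡ false → 2ℚ ≤ cut G x̂ X
  cut≥2 X v p q r = subst₂ _≤_ (trans (fST≡ X) (cong₂ (λ a b → if a xor b then ℕ→ℚ 1 else ℕ→ℚ 2) q r)) (sym (cutδ X)) (subtour X ((v , p) , (s , q)))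

  separates : ∀ X → X s ≢ X t → NonEmptyProper X × (X s xor X t) ≡ true
  separates X = lem (X s) (X t) refl refl
    where
    lem : ∀ a b → X s ≡ a → X t ≡ b → a ≢ b → NonEmptyProper X × (a xor b) ≡ true
    lem true true _ _ h = ⊥-elim (h refl)
    lem true false p q _ = ((s , p) , (t , q)) , refl
    lem false true p q _ = ((t , q) , (s , p)) , refl
    lem false false _ _ h = ⊥-elim (h refl)

  cut≥1 : ∀ X → X s ≢ X t → 1ℚ ≤ cut G x̂ X
  cut≥1 X h = subst₂ _≤_ (trans (fST≡ X) (cong (λ b → if b then ℕ→ℚ 1 else ℕ→ℚ 2) (proj₂ (separates X h)))) (sym (cutδ X)) (subtour X (proj₁ (separates X h)))

  open Tours G s t x̂ x̂≥0 loops degree′ cut≥2 cut≥1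

  narrow⇒ : ∀ U → Narrow U → NarrowCutOf x U
  narrow⇒ U (p , q , lt) = ((s , p) , (t , q)) , subst (_< 2ℚ) (cut≡xδE U) lt

  noThree′ : ∀ e U₁ U₂ U₃ → Narrow U₁ → Narrow U₂ → Narrow U₃ →
    cross G U₁ e ≡ true → cross G U₂ e ≡ true → cross G U₃ e ≡ true →
    ¬ (∀ f → cross G U₁ f ≡ cross G U₂ f) → ¬ (∀ f → cross G U₁ f ≡ cross G U₃ f) → ¬ (∀ f → cross G U₂ f ≡ cross G U₃ f) → ⊥
  noThree′ e U₁ U₂ U₃ n₁ n₂ n₃ c₁ c₂ c₃ d₁₂ d₁₃ d₂₃ = noThree i j (supp⇒< sp) (supp⇒>0 sp)
    (U₁ , U₂ , U₃ , narrow⇒ U₁ n₁ , narrow⇒ U₂ n₂ , narrow⇒ U₃ n₃ , crossing U₁ c₁ , crossing U₂ c₂ , crossing U₃ c₃ ,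
      d₁₂ ∘ toAll U₁ U₂ , d₁₃ ∘ toAll U₁ U₃ , d₂₃ ∘ toAll U₂ U₃)
    where
    i = proj₁ (remQuot {n} n e)
    j = proj₂ (remQuot {n} n e)
    sp : supp i j ≡ true
    -- A loop crosses no cut, so `e` represents an edge of the support.
    sp = ¬-not (λ q → true≢false (trans (sym c₁) (pairCross-loop U₁ i j q)))
    crossing : ∀ U → cross G U e ≡ true → crosses U i j ≡ true
    crossing U c = trans (sym (pairCross-supp U i j sp)) c
    toAll : ∀ U W → SameCut x U W → ∀ f → cross G U f ≡ cross G W f
    toAll U W same f = lem (proj₁ (remQuot {n} n f)) (proj₂ (remQuot {n} n f)) (supp _ _) refl
      where
      lem : ∀ i j b → supp i j ≡ b → pairCross U (i , j) ≡ pairCross W (i , j)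
      lem i j true p = trans (pairCross-supp U i j p) (trans (same i j (supp⇒< p) (supp⇒>0 p)) (sym (pairCross-supp W i j p)))
      lem i j false p = trans (pairCross-loop U i j p) (sym (pairCross-loop W i j p))

  z : Fin (n ℕ.* n) → ℚ
  z e = x̂ e + ½ * x̂ e

  x̂≤2 : ∀ e → x̂ e ≤ 2ℚ
  x̂≤2 e = byLoop (src G e ≟ dst G e)
    where
    v = src G e
    term : Fin (n ℕ.* n) → ℚ
    term f = ind (cross G (singleton v) f) * x̂ f
    byLoop : Dec (src G e ≡ dst G e) → x̂ e ≤ 2ℚ
    byLoop (yes loop) = subst (_≤ 2ℚ) (sym (loops e loop)) (+-nonneg 0≤1 0≤1)
    byLoop (no noLoop) = ≤-trans (subst (_≤ cut G x̂ (singleton v)) here≡ (Σ-term {f = term} (λ f → *-nonneg (ind≥0 (cross G (singleton v) f)) (x̂≥0 f)) e))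
      (≤-by (ind (singleton s v) + ind (singleton t v)) (+-nonneg (ind≥0 (singleton s v)) (ind≥0 (singleton t v)))
        (trans (lem (ind (singleton s v)) (ind (singleton t v))) (cong (_+ (ind (singleton s v) + ind (singleton t v))) (sym (degree′ v)))))
      where
      lem : ∀ a b → 2ℚ ≡ 2ℚ - a - b + (a + b)
      lem = solve-∀ ℚ-ring
      here≡ : term e ≡ x̂ e
      here≡ = trans (cong₂ (λ a b → ind (a xor b) * x̂ e) (==-refl v) (==-≢ (noLoop ∘ sym))) (*-identityˡ (x̂ e))

  -- The degree constraints give x̂ ≤ 2, hence z ≤ 3; 4 is the smallest even number above this
  -- bound, which explains the four parallel copies used for filling.
  z<4 : ∀ e → z e < toℚ 4
  z<4 e = ≤-<-trans (+-mono-≤ (x̂≤2 e) (*-mono ½ (<⇒≤ 0<½) (x̂≤2 e))) (<-by 1ℚ 0<1 refl)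

  open Exact G s t using (exact; mean)

  exactTours = exact z z<4 (tours noThree′) (tours-total noThree′ , tours-usage noThree′)

  L : Dist (Σ (Fin (n ℕ.* n) → ℕ) (IsTour G s t))
  L = proj₁ exactTours

  entry : Atom (Σ (Fin (n ℕ.* n) → ℕ) (IsTour G s t)) → ℚ × STTour n s t x
  entry (atom w _ (M , tour)) = w , FromTour.toSTTour M tour

  weights≥0 : ∀ K → All (λ p → 0ℚ ≤ proj₁ p) (map entry K)
  weights≥0 [] = []
  weights≥0 (atom w w>0 _ ∷ K) = <⇒≤ w>0 ∷ weights≥0 K

  weights-sum : ∀ K → foldr (λ p acc → proj₁ p + acc) 0ℚ (map entry K) ≡ 𝔼 K (λ _ → 1ℚ)
  weights-sum [] = refl
  weights-sum (atom w _ _ ∷ K) = cong₂ _+_ (sym (*-identityʳ w)) (weights-sum K)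

  multOf : Fin n → Fin n → Σ (Fin (n ℕ.* n) → ℕ) (IsTour G s t) → ℚ
  multOf i j (M , _) = ℕ→ℚ (if supp i j then M (combine {n} {n} i j) else 0)

  weighted-sum : ∀ i j K → foldr (λ p acc → proj₁ p * ℕ→ℚ (STTour.mult (proj₂ p) i j) + acc) 0ℚ (map entry K) ≡ 𝔼 K (multOf i j)
  weighted-sum i j [] = refl
  weighted-sum i j (atom w _ (M , tour) ∷ K) = cong (w * multOf i j (M , tour) +_) (weighted-sum i j K)

  mean-mult : ∀ i j → i F.< j → 𝔼 L (multOf i j) ≡ (ℤ.+ 3 / 2) * x i j
  mean-mult i j i<j = bySupp (supp i j) refl
    where
    lem : ∀ p → p + ½ * p ≡ (ℤ.+ 3 / 2) * p
    lem = solve-∀ ℚ-ring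
    bySupp : ∀ b → supp i j ≡ b → 𝔼 L (multOf i j) ≡ (ℤ.+ 3 / 2) * x i j
    bySupp true p = trans (𝔼-cong L (λ M → trans (cong (λ b → ℕ→ℚ (if b then proj₁ M (combine {n} {n} i j) else 0)) p) (ℕ→ℚ≡toℚ (proj₁ M (combine {n} {n} i j)))))
      (trans (proj₂ (proj₂ exactTours) (combine {n} {n} i j)) (trans (cong (λ q → q + ½ * q) x̂≡) (lem (x i j))))
      where
      x̂≡ : x̂ (combine {n} {n} i j) ≡ x i j
      x̂≡ = trans (cong value (Finₚ.remQuot-combine {n} {n} i j)) (cong (λ b → if b then x i j else 0ℚ) p)
    bySupp false p = trans (𝔼-cong L (λ M → cong (λ b → ℕ→ℚ (if b then proj₁ M (combine {n} {n} i j) else 0)) p))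
      (trans (𝔼-zero L) (sym (trans (cong ((ℤ.+ 3 / 2) *_) (unsupported nonneg i<j p)) (*-zeroʳ (ℤ.+ 3 / 2)))))

  result : IsConvexCombOfTours n s t x (λ i j → (ℤ.+ 3 / 2) * x i j)
  result = map entry L , weights≥0 L , trans (weights-sum L) (proj₁ (proj₂ exactTours)) , λ i j i<j → trans (weighted-sum i j L) (mean-mult i j i<j)

-- Opened only here because the prefix +_ makes sections (p +_) ambiguous.
open import Data.Integer using (+_)

theorem12 : (n : ℕ) (s t : Fin n) → s ≢ t → (x : Fin n → Fin n → ℚ) →
    SubtourLPFeasible n s t x →
    (∀ (i j : Fin n) → i F.< j → 0ℚ < x i j → ¬ InMoreThanTwoNarrowCuts x i j) →
    IsConvexCombOfTours n s t x (λ i j → (+ 3 / 2) * x i j)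
theorem12 n s t s≢t x lp noThree = Main.result s t s≢t x lp noThree
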